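{- For all integers $t,\nu\geq1$ there exists an integer $\psi=\psi(t,\nu)\geq1$ with the following property. Let $G$ be a (theta, prism)-free graph with no clique of cardinality $t$, let $a,b\in V(G)$ be distinct and non-adjacent, and let $\mathcal{P}$ be a collection of pairwise internally disjoint induced paths in $G$ from $a$ to $b$ with $|\mathcal{P}|\geq\psi$. For each $P\in\mathcal{P}$ let $a_P$ be the neighbor of $a$ in $P$. Then there exist $P_1,\ldots,P_\nu\in\mathcal{P}$ such that $\{a_{P_1},\ldots,a_{P_\nu},b\}$ is a stable set in $G$, and for all $i,j\in\{1,\ldots,\nu\}$ with $i<j$, $a_{P_i}$ has a neighbor in $P_j^*\setminus\{a_{P_j}\}$.
   Context: Graphs finite simple. For a path $P$, $P^*$ denotes its interior (vertices other than its ends). Theta: two non-adjacent vertices joined by three internally disjoint induced paths of length $\ge2$ with pairwise anticomplete interiors. Prism: two disjoint triangles $\{a_1,a_2,a_3\},\{b_1,b_2,b_3\}$, disjoint induced paths $P_i$ from $a_i$ to $b_i$, with $a_ia_j,b_ib_j$ the only edges between $P_i,P_j$. (Theta, prism)-free: no induced subgraph isomorphic to a theta or a prism. -}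

module Defs where

open import Data.Nat using (ℕ; zero; suc; _<_; _≤_)
open import Data.Fin using (Fin; toℕ; fromℕ) renaming (_<_ to _<ᶠ_)
open import Data.Bool using (Bool; true; false)
open import Data.Product using (Σ; ∃; _×_; _,_)
open import Data.Sum using (_⊎_)
open import Relation.Binary.PropositionalEquality using (_≡_; _≢_)
open import Relation.Nullary using (¬_)
open import Function.Definitions using (Injective)

record Graph (n : ℕ) : Set where
  field
    adj   : Fin n → Fin n → Bool
    sym   : ∀ u v → adj u v ≡ adj v u
    irrefl : ∀ v → adj v v ≡ false

open Graph public

Adj : ∀ {n} → Graph n → Fin n → Fin n → Set
Adj G u v = adj G u v ≡ true

record Path (n : ℕ) : Set where
  constructor mkPath
  field
    len : ℕ
    vtx : Fin (suc len) → Fin n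

open Path public

OnPath : ∀ {n} → Fin n → Path n → Set
OnPath v P = ∃ λ i → vtx P i ≡ v

Interior : ∀ {n} → Fin n → Path n → Set
Interior v P = ∃ λ i → (0 < toℕ i) × (toℕ i < len P) × (vtx P i ≡ v)

IsInducedPath : ∀ {n} → Graph n → Path n → Fin n → Fin n → Set
IsInducedPath G P a b =
  Injective _≡_ _≡_ (vtx P) ×
  (vtx P Fin.zero ≡ a) ×
  (vtx P (fromℕ (len P)) ≡ b) ×
  (∀ i j → (Adj G (vtx P i) (vtx P j) → (toℕ i ≡ suc (toℕ j) ⊎ toℕ j ≡ suc (toℕ i))) ×
           ((toℕ i ≡ suc (toℕ j) ⊎ toℕ j ≡ suc (toℕ i)) → Adj G (vtx P i) (vtx P j)))
  where import Data.Fin as Fin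

HasTheta : ∀ {n} → Graph n → Set
HasTheta {n} G =
  Σ (Fin n) λ a → Σ (Fin n) λ b → Σ (Fin 3 → Path n) λ P →
    (a ≢ b) × ¬ Adj G a b ×
    (∀ i → IsInducedPath G (P i) a b × 2 ≤ len (P i)) ×
    (∀ i j → i ≢ j → ∀ v → Interior v (P i) → ¬ Interior v (P j)) ×
    (∀ i j → i ≢ j → ∀ u v → Interior u (P i) → Interior v (P j) → ¬ Adj G u v)

HasPrism : ∀ {n} → Graph n → Set
HasPrism {n} G =
  Σ (Fin 3 → Fin n) λ a → Σ (Fin 3 → Fin n) λ b → Σ (Fin 3 → Path n) λ P →
    (∀ i j → i ≢ j → a i ≢ a j × b i ≢ b j × Adj G (a i) (a j) × Adj G (b i) (b j)) ×
    (∀ i j → a i ≢ b j) ×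
    (∀ i → IsInducedPath G (P i) (a i) (b i)) ×
    (∀ i j → i ≢ j → ∀ v → OnPath v (P i) → ¬ OnPath v (P j)) ×
    (∀ i j → i ≢ j → ∀ u v → OnPath u (P i) → OnPath v (P j) → Adj G u v →
       (u ≡ a i × v ≡ a j) ⊎ (u ≡ b i × v ≡ b j))

ThetaPrismFree : ∀ {n} → Graph n → Set
ThetaPrismFree G = ¬ HasTheta G × ¬ HasPrism G

NoClique : ∀ {n} → ℕ → Graph n → Set
NoClique {n} t G =
  (c : Fin t → Fin n) → Injective _≡_ _≡_ c → ¬ (∀ i j → i ≢ j → Adj G (c i) (c j))

-- Write x_P for the neighbour of a on P. Ramsey's theorem first makes the x_P stable; three of them
-- adjacent to b would give a theta. A second and third application make "x_P has a neighbour in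
-- Q* ∖ x_Q" hold for all P before Q, or for all P after Q, as wanted, or else for no P ≠ Q.
-- The last case is contradictory. There every neighbour ℓ of a is a leaf of H = G ∖ a, where
-- G is restricted to the union of the paths.
--
-- Three leaves of H are separated by a clique. Since no induced tree joins them (theta with a),
-- they and a span a pyramid; thicken its three paths to disjoint anticomplete connected sets
-- D₁, D₂, D₃, maximal off the base triangle t₁ t₂ t₃. A vertex outside is adjacent to at most two
-- of them; one adjacent to D_i and D_j is adjacent to t_i, t_j and not to t_k, one adjacent to D_i
-- only is adjacent to t_j and t_k, for otherwise there is a theta or a prism. Hence the boundary
-- of D_i ∪ D_j is a clique for suitable i, j.
--
-- The sets X ∋ ℓ with b ∉ X ∪ N(X) and N(X) a clique are closed under union; let X_ℓ be the
-- largest one and x_ℓ ∈ N(X_ℓ) a vertex where the path of ℓ leaves it. By Ramsey six of the x_ℓ are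
-- stable. Three of them adjacent to b yield a theta between a and b. For three of them not adjacent
-- to b, a clique K separating their leaves makes two of the x_ℓ adjacent if b ∉ K; if b ∈ K, then either
-- some x_ℓ is in K and so adjacent to b, or b has neighbours in all three components: a theta again.

module Submission where

open import Defs renaming (sym to adj-sym; irrefl to adj-irrefl)
open import Level using (0ℓ)
open import Data.Bool using (Bool; true; false; _∧_)
import Data.Bool.Properties as Boolₚ
open import Data.Empty using (⊥; ⊥-elim)
open import Data.Fin using (Fin; zero; suc; toℕ; fromℕ; fromℕ<; inject₁; opposite) renaming (_<_ to _<ᶠ_)
import Data.Fin.Properties as Finₚ
open import Data.List using (List; []; _∷_; length; lookup; allFin)
open import Data.List.Membership.Propositional.Properties using (∈-lookup)
open import Data.List.Properties using (length-tabulate)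
open import Data.List.Relation.Binary.Sublist.Propositional using () renaming (_⊆_ to _⊑_; [] to []ˢ; _∷ʳ_ to _∷ʳˢ_; _∷_ to _∷ˢ_; ⊆-trans to ⊑-trans; minimum to ⊑-minimum)
open import Data.List.Relation.Binary.Sublist.Propositional.Properties using (All-resp-⊆)
open import Data.List.Relation.Unary.All as All using (All; []; _∷_)
open import Data.List.Relation.Unary.AllPairs as AllPairs using (AllPairs; []; _∷_)
open import Data.List.Relation.Unary.Unique.Propositional.Properties using (allFin⁺)
open import Data.Nat using (ℕ; zero; suc; _+_; _≤_; _<_; z≤n; s≤s)
import Data.Nat.Properties as ℕₚ
open import Data.Product using (Σ; ∃; _×_; _,_; proj₁; proj₂)
open import Data.Sum using (_⊎_; inj₁; inj₂; [_,_]′)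
open import Function using (_∘_; id)
open import Function.Definitions using (Injective)
import Relation.Binary.Definitions as Bin
open import Relation.Binary.PropositionalEquality using (_≡_; _≢_; refl; sym; trans; cong; subst; subst₂)
open import Relation.Nullary using (¬_; Dec; yes; no; does)
open import Relation.Nullary.Decidable using (_⊎-dec_; _×-dec_; ¬?)
open import Relation.Unary using (Pred; Decidable; _∪_; _∩_; _⊆_; ∅; ∁)

-- Excluding thetas and prisms still allows pyramids, so three leaves joined by one are no
-- contradiction in themselves; hence the detour through clique separators. The restriction of `G`
-- is what makes the neighbours of `a` leaves: a vertex off the paths could be one more neighbour of
-- `x_P`. Leaves pay off again and again, since a vertex with two neighbours other than `a` cannot
-- be adjacent to `a`, and this supplies the nonadjacencies with `a` that thetas and prisms demand.
-- Paths are seldom handled as sequences: they are replaced by walks inside sets of vertices with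
-- prescribed edges between the sets. An induced path picked inside each set then yields the theta
-- or prism, so nothing has to be kept induced in between.

-- The combinatorial core has conclusion ⊥, where excluded middle costs nothing.
by-cases : {P : Set} → (P → ⊥) → (¬ P → ⊥) → ⊥
by-cases p np = np p

-- Walks, induced paths, thetas and prisms

module Walks {n : ℕ} (G : Graph n) where

  V : Set
  V = Fin n

  infix 4 _~_ _~?_

  _~_ : V → V → Set
  _~_ = Adj G

  _~?_ : ∀ u v → Dec (u ~ v)
  u ~? v = adj G u v Boolₚ.≟ true

  ~-sym : ∀ {u v} → u ~ v → v ~ u
  ~-sym {u} {v} e = trans (adj-sym G v u) e

  ~-irrefl : ∀ {u v} → u ~ v → u ≢ v
  ~-irrefl {u} e refl with trans (sym e) (adj-irrefl G u)
  ... | ()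

  Sing : V → Pred V 0ℓ
  Sing x v = v ≡ x

  infixl 5 _▸_

  -- The start is exempt from `S`, so walks concatenate without a side condition at the joint, and
  -- `Walk S u`, read as a predicate of the end, is the component of `u` in `S` with `u` added.
  data Walk (S : Pred V 0ℓ) (u : V) : V → Set where
    nil : Walk S u u
    _▸_ : ∀ {v w} → Walk S u v → v ~ w × S w → Walk S u w

  map-walk : ∀ {S T u v} → S ⊆ T → Walk S u v → Walk T u v
  map-walk f nil = nil
  map-walk f (p ▸ (e , s)) = map-walk f p ▸ (e , f s)

  infixr 5 _++ʷ_

  _++ʷ_ : ∀ {S u v w} → Walk S u v → Walk S v w → Walk S u w
  p ++ʷ nil = p
  p ++ʷ (q ▸ e) = (p ++ʷ q) ▸ e

  endpoint∈ : ∀ {S u v} → S u → Walk S u v → S v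
  endpoint∈ s nil = s
  endpoint∈ _ (_ ▸ (_ , s)) = s

  reverse-walk : ∀ {S u v} → S u → Walk S u v → Walk S v u
  reverse-walk s nil = nil
  reverse-walk s (p ▸ (e , _)) =
    (nil ▸ (~-sym e , endpoint∈ s p)) ++ʷ reverse-walk s p

  reach-walk : ∀ {S u v} → Walk S u v → Walk (Walk S u) u v
  reach-walk nil = nil
  reach-walk (p ▸ (e , s)) = reach-walk p ▸ (e , p ▸ (e , s))

  Conn : Pred V 0ℓ → Set
  Conn S = ∀ {u v} → S u → S v → Walk S u v

  reach-conn : ∀ {S u} → Conn (Walk S u)
  reach-conn p q = reverse-walk nil (reach-walk p) ++ʷ reach-walk q

  -- The shape of a theta path: `S` carries the interior and the ends stay free. A nil walk makes it
  -- the bare edge `u ~ w`.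
  Thru : Pred V 0ℓ → V → V → Set
  Thru S u w = ∃ λ v → Walk S u v × v ~ w

  map-thru : ∀ {S T u v} → S ⊆ T → Thru S u v → Thru T u v
  map-thru f (v , p , e) = v , map-walk f p , e

  _++ᵗ_ : ∀ {S u v w} → Walk S u v → Thru S v w → Thru S u w
  p ++ᵗ (x , q , e) = x , p ++ʷ q , e

  Touch : Pred V 0ℓ → V → Set
  Touch S w = ∃ λ v → S v × v ~ w

  map-touch : ∀ {S T w} → S ⊆ T → Touch S w → Touch T w
  map-touch f (v , s , e) = v , f s , e

  enter : ∀ {S w v} → Conn S → Touch S w → S v → Walk S w v
  enter c (u , s , e) t = (nil ▸ (~-sym e , s)) ++ʷ c s t

  across : ∀ {S u v} → Conn S → Touch S u → Touch S v → Thru S u v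
  across c t (v , s , e) = v , enter c t s , e

  -- With `R` empty this says disjoint and anticomplete, as for theta interiors; with `R` naming
  -- pairs of corners it is the condition between two paths of a prism.
  record Only (R : V → V → Set) (A B : Pred V 0ℓ) : Set where
    no-eta-equality
    constructor only
    field rel : ∀ {u v} → A u → B v → u ≢ v × (u ~ v → R u v)

    apart : ∀ {u v} → A u → B v → u ≢ v
    apart x y = proj₁ (rel x y)

    edge-of : ∀ {u v} → A u → B v → u ~ v → R u v
    edge-of x y = proj₂ (rel x y)

  open Only public

  Sep : Pred V 0ℓ → Pred V 0ℓ → Set
  Sep = Only (λ _ _ → ⊥)

  sep-sym : ∀ {A B} → Sep A B → Sep B A
  sep-sym s = only λ b a → apart s a b ∘ sym , edge-of s a b ∘ ~-sym

  only-∪ˡ : ∀ {R A B C} → Only R A C → Only R B C → Only R (A ∪ B) C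
  only-∪ˡ s t = only λ { (inj₁ a) c → rel s a c ; (inj₂ b) c → rel t b c }

  only-∪ʳ : ∀ {R A B C} → Only R A B → Only R A C → Only R A (B ∪ C)
  only-∪ʳ s t = only λ { a (inj₁ b) → rel s a b ; a (inj₂ c) → rel t a c }

  only-⊆ : ∀ {R A A′ B B′} → A′ ⊆ A → B′ ⊆ B → Only R A B → Only R A′ B′
  only-⊆ f g s = only λ a b → rel s (f a) (g b)

  only-map : ∀ {R R′ : V → V → Set} {A B} → (∀ {u v} → R u v → R′ u v) → Only R A B → Only R′ A B
  only-map f s = only λ a b → apart s a b , f ∘ edge-of s a b

  sep-only : ∀ {R A B} → Sep A B → Only R A B
  sep-only = only-map λ ()

  sing-sep : ∀ {w B} → ¬ B w → ¬ Touch B w → Sep (Sing w) B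
  sing-sep w∉ w≁ = only λ { refl b → (λ { refl → w∉ b }) , λ e → w≁ (_ , b , ~-sym e) }

  Consecutive : ∀ {m} → Fin m → Fin m → Set
  Consecutive i j = toℕ i ≡ suc (toℕ j) ⊎ toℕ j ≡ suc (toℕ i)

  record Induced (P : Path n) : Set where
    constructor induced
    field
      inj  : Injective _≡_ _≡_ (vtx P)
      edge : ∀ i j → (vtx P i ~ vtx P j → Consecutive i j) × (Consecutive i j → vtx P i ~ vtx P j)

  start finish : Path n → V
  start P = vtx P zero
  finish P = vtx P (fromℕ (len P))

  private
    prepend : V → Path n → Path n
    len (prepend x P) = suc (len P)
    vtx (prepend x P) zero = x
    vtx (prepend x P) (suc i) = vtx P i

    tail : ∀ {l} → (Fin (suc (suc l)) → V) → Path n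
    tail f = mkPath _ (f ∘ suc)

    suc-consecutive : ∀ {m} {i j : Fin m} → Consecutive i j → Consecutive (suc i) (suc j)
    suc-consecutive (inj₁ e) = inj₁ (cong suc e)
    suc-consecutive (inj₂ e) = inj₂ (cong suc e)

    pred-consecutive : ∀ {m} {i j : Fin m} → Consecutive (suc i) (suc j) → Consecutive i j
    pred-consecutive (inj₁ e) = inj₁ (ℕₚ.suc-injective e)
    pred-consecutive (inj₂ e) = inj₂ (ℕₚ.suc-injective e)

    tail-induced : ∀ {l} (f : Fin (suc (suc l)) → V) → Induced (mkPath (suc l) f) → Induced (tail f)
    tail-induced f (induced inj edge) = induced
      (λ e → Finₚ.suc-injective (inj e))
      (λ i j → pred-consecutive ∘ proj₁ (edge (suc i) (suc j)) , proj₂ (edge (suc i) (suc j)) ∘ suc-consecutive)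

    prepend-induced : ∀ {x} P → Induced P → (∀ i → x ≢ vtx P i) → x ~ start P →
                      (∀ i → ¬ x ~ vtx P (suc i)) → Induced (prepend x P)
    prepend-induced {x} P (induced inj edge) x∉ e x≁ = induced inj′ edge′
      where
      inj′ : Injective _≡_ _≡_ (vtx (prepend x P))
      inj′ {zero} {zero} _ = refl
      inj′ {zero} {suc j} q = ⊥-elim (x∉ j q)
      inj′ {suc i} {zero} q = ⊥-elim (x∉ i (sym q))
      inj′ {suc i} {suc j} q = cong suc (inj q)

      first : ∀ i → x ~ vtx P i → toℕ (suc i) ≡ 1
      first zero _ = refl
      first (suc i) q = ⊥-elim (x≁ i q)

      edge′ : ∀ i j → (vtx (prepend x P) i ~ vtx (prepend x P) j → Consecutive i j) ×
                      (Consecutive i j → vtx (prepend x P) i ~ vtx (prepend x P) j)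
      edge′ zero zero = (λ q → ⊥-elim (~-irrefl q refl)) , λ { (inj₁ ()) ; (inj₂ ()) }
      edge′ zero (suc j) = inj₂ ∘ first j , λ { (inj₂ q) → subst (λ k → x ~ vtx P k) (sym (at-zero j q)) e }
        where
        at-zero : ∀ j → toℕ (suc j) ≡ 1 → j ≡ zero
        at-zero zero _ = refl
      edge′ (suc i) zero = inj₁ ∘ first i ∘ ~-sym , λ { (inj₁ q) → ~-sym (subst (λ k → x ~ vtx P k) (sym (at-zero i q)) e) }
        where
        at-zero : ∀ j → toℕ (suc j) ≡ 1 → j ≡ zero
        at-zero zero _ = refl
      edge′ (suc i) (suc j) =
        suc-consecutive ∘ proj₁ (edge i j) , proj₂ (edge i j) ∘ pred-consecutive

    -- Cutting P at its last vertex equal or adjacent to x keeps the path induced.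
    extend : ∀ l f x → Induced (mkPath l f) → ∃ (λ i → x ≡ f i ⊎ x ~ f i) →
             Σ (Path n) λ Q → Induced Q × start Q ≡ x × finish Q ≡ f (fromℕ l) ×
               (∀ i → vtx Q i ≡ x ⊎ OnPath (vtx Q i) (mkPath l f))
    extend l f x ind (zero , inj₁ refl) = mkPath l f , ind , refl , refl , λ i → inj₂ (i , refl)
    extend zero f x ind (zero , inj₂ e) =
      prepend x P , prepend-induced P ind (λ { zero → ~-irrefl e }) e (λ ()) , refl , refl ,
      λ { zero → inj₁ refl ; (suc i) → inj₂ (i , refl) }
      where
      P : Path n
      P = mkPath zero f
    extend (suc l) f x ind (i , h)
      with Finₚ.any? (λ j → (x Finₚ.≟ f (suc j)) ⊎-dec (x ~? f (suc j)))
    extend (suc l) f x ind (i , h) | yes hit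
      with extend l (f ∘ suc) x (tail-induced f ind) hit
    ... | Q , indQ , s , t , on =
      Q , indQ , s , t , λ k → [ inj₁ , (λ { (j , e) → inj₂ (suc j , e) }) ]′ (on k)
    extend (suc l) f x ind (suc i , h) | no ¬hit = ⊥-elim (¬hit (i , h))
    extend (suc l) f x ind (zero , inj₁ refl) | no _ = mkPath (suc l) f , ind , refl , refl , λ i → inj₂ (i , refl)
    extend (suc l) f x ind (zero , inj₂ e) | no ¬hit =
      prepend x P , prepend-induced P ind
        (λ { zero → ~-irrefl e ; (suc j) q → ¬hit (j , inj₁ q) }) e (λ j q → ¬hit (j , inj₂ q)) , refl , refl ,
      λ { zero → inj₁ refl ; (suc i) → inj₂ (i , refl) }
      where
      P : Path n
      P = mkPath (suc l) f

  -- Walks grow at their end and paths are extended at their start, so the path comes out reversed.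
  -- Each new vertex is put in front, and `extend` removes the chords.
  induced-path : ∀ {S u v} → Walk S u v →
    Σ (Path n) λ P → Induced P × start P ≡ v × finish P ≡ u × (∀ i → vtx P i ≡ u ⊎ S (vtx P i))
  induced-path {u = u} nil =
    mkPath 0 (λ _ → u) ,
    induced (λ { {zero} {zero} _ → refl })
            (λ { zero zero → (λ e → ⊥-elim (~-irrefl e refl)) , λ { (inj₁ ()) ; (inj₂ ()) } }) ,
    refl , refl , λ _ → inj₁ refl
  induced-path {S} {u} (p ▸ (e , s)) with induced-path p
  ... | P , ind , refl , t , on with extend (len P) (vtx P) _ ind (zero , inj₂ (~-sym e))
  ... | Q , indQ , s′ , t′ , on′ = Q , indQ , s′ , trans t′ t , place
    where
    place : ∀ i → vtx Q i ≡ u ⊎ S (vtx Q i)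
    place i with on′ i
    ... | inj₁ refl = inj₂ s
    ... | inj₂ (j , q) = subst (λ x → x ≡ u ⊎ S x) q (on j)

  tri : ∀ {ℓ} {A : Set ℓ} → A → A → A → Fin 3 → A
  tri x y z zero = x
  tri x y z (suc zero) = y
  tri x y z (suc (suc zero)) = z

  pairwise : (R : Fin 3 → Fin 3 → Set) →
             (R zero (suc zero) → R (suc zero) zero) →
             (R zero (suc (suc zero)) → R (suc (suc zero)) zero) →
             (R (suc zero) (suc (suc zero)) → R (suc (suc zero)) (suc zero)) →
             R zero (suc zero) → R zero (suc (suc zero)) → R (suc zero) (suc (suc zero)) →
             ∀ i j → i ≢ j → R i j
  pairwise R f g h r s t zero zero ne = ⊥-elim (ne refl)
  pairwise R f g h r s t zero (suc zero) _ = r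
  pairwise R f g h r s t zero (suc (suc zero)) _ = s
  pairwise R f g h r s t (suc zero) zero _ = f r
  pairwise R f g h r s t (suc zero) (suc zero) ne = ⊥-elim (ne refl)
  pairwise R f g h r s t (suc zero) (suc (suc zero)) _ = t
  pairwise R f g h r s t (suc (suc zero)) zero _ = g s
  pairwise R f g h r s t (suc (suc zero)) (suc zero) _ = h t
  pairwise R f g h r s t (suc (suc zero)) (suc (suc zero)) ne = ⊥-elim (ne refl)

  module _ (noTheta : ¬ HasTheta G) where

    -- The induced paths are picked inside the sets `D` with the ends added, so separation of the
    -- sets passes to the interiors. Length at least two comes from the nonadjacency of `x` and `y`.
    theta : ∀ {x y D₁ D₂ D₃} → x ≢ y → ¬ x ~ y →
            ¬ D₁ x → ¬ D₂ x → ¬ D₃ x → ¬ D₁ y → ¬ D₂ y → ¬ D₃ y →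
            Thru D₁ x y → Thru D₂ x y → Thru D₃ x y →
            Sep D₁ D₂ → Sep D₁ D₃ → Sep D₂ D₃ → ⊥
    theta {x} {y} {D₁} {D₂} {D₃} x≢y x≁y x₁ x₂ x₃ y₁ y₂ y₃ p₁ p₂ p₃ s₁₂ s₁₃ s₂₃ =
      noTheta (y , x , P , x≢y ∘ sym , x≁y ∘ ~-sym , isPath ,
        (λ i j i≢j v a b → apart (sep i j i≢j) (inside i a) (inside j b) refl) ,
        λ i j i≢j u v a b → edge-of (sep i j i≢j) (inside i a) (inside j b))
      where
      D : Fin 3 → Pred V 0ℓ
      D = tri D₁ D₂ D₃

      walk : ∀ i → Walk (D i ∪ Sing y) x y
      walk i = go (thru i)
        where
        go : Thru (D i) x y → Walk (D i ∪ Sing y) x y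
        go (_ , p , e) = map-walk inj₁ p ▸ (e , inj₂ refl)
        thru : ∀ i → Thru (D i) x y
        thru zero = p₁
        thru (suc zero) = p₂
        thru (suc (suc zero)) = p₃

      P : Fin 3 → Path n
      P i = proj₁ (induced-path (walk i))

      isPath : ∀ i → IsInducedPath G (P i) y x × 2 ≤ len (P i)
      isPath i with induced-path (walk i)
      ... | mkPath l f , ind , refl , refl , _ =
        (Induced.inj ind , refl , refl , Induced.edge ind) , long l f x≢y x≁y ind
        where
        long : ∀ l (f : Fin (suc l) → V) → f (fromℕ l) ≢ f zero → ¬ f (fromℕ l) ~ f zero →
               Induced (mkPath l f) → 2 ≤ l
        long zero f ne _ _ = ⊥-elim (ne refl)
        long (suc zero) f _ na ind = ⊥-elim (na (proj₂ (Induced.edge ind (suc zero) zero) (inj₁ refl)))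
        long (suc (suc l)) f _ _ _ = s≤s (s≤s z≤n)

      inside : ∀ i {v} → Interior v (P i) → D i v
      inside i (k , 0<k , k<l , refl) with induced-path (walk i)
      ... | mkPath l f , ind , refl , refl , on with on k
      ... | inj₁ e = ⊥-elim (ℕₚ.<-irrefl (trans (cong toℕ (Induced.inj ind e)) (Finₚ.toℕ-fromℕ l)) k<l)
      ... | inj₂ (inj₁ d) = d
      ... | inj₂ (inj₂ e) = ⊥-elim (ℕₚ.<-irrefl (sym (cong toℕ (Induced.inj ind e))) 0<k)

      sep : ∀ i j → i ≢ j → Sep (D i) (D j)
      sep = pairwise (λ i j → Sep (D i) (D j)) sep-sym sep-sym sep-sym s₁₂ s₁₃ s₂₃

  module _ (noPrism : ¬ HasPrism G) where

    Corner : V → V → V → V → V → V → Set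
    Corner p q p′ q′ u v = (u ≡ p × v ≡ p′) ⊎ (u ≡ q × v ≡ q′)

    -- Unlike for thetas, the sets contain the ends of the paths, so the triangle edges have to be
    -- allowed for between them.
    prism : ∀ {p₁ p₂ p₃ q₁ q₂ q₃ E₁ E₂ E₃} →
            p₁ ~ p₂ → p₁ ~ p₃ → p₂ ~ p₃ → q₁ ~ q₂ → q₁ ~ q₃ → q₂ ~ q₃ →
            p₁ ≢ q₁ → p₂ ≢ q₂ → p₃ ≢ q₃ →
            E₁ p₁ → E₂ p₂ → E₃ p₃ →
            Walk E₁ p₁ q₁ → Walk E₂ p₂ q₂ → Walk E₃ p₃ q₃ →
            Only (Corner p₁ q₁ p₂ q₂) E₁ E₂ → Only (Corner p₁ q₁ p₃ q₃) E₁ E₃ →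
            Only (Corner p₂ q₂ p₃ q₃) E₂ E₃ → ⊥
    prism {p₁} {p₂} {p₃} {q₁} {q₂} {q₃} {E₁} {E₂} {E₃}
          p₁₂ p₁₃ p₂₃ q₁₂ q₁₃ q₂₃ n₁ n₂ n₃ m₁ m₂ m₃ w₁ w₂ w₃ s₁₂ s₁₃ s₂₃ =
      noPrism (q , p , P ,
        (λ i j ne → ~-irrefl (qq i j ne) , ~-irrefl (pp i j ne) , qq i j ne , pp i j ne) ,
        q≢p , isPath ,
        (λ i j ne v a b → apart (sep i j ne) (inside i a) (inside j b) refl) ,
        λ i j ne u v a b e → [ inj₂ , inj₁ ]′ (edge-of (sep i j ne) (inside i a) (inside j b) e))
      where
      p q : Fin 3 → V
      p = tri p₁ p₂ p₃
      q = tri q₁ q₂ q₃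

      E : Fin 3 → Pred V 0ℓ
      E = tri E₁ E₂ E₃

      pp : ∀ i j → i ≢ j → p i ~ p j
      pp = pairwise (λ i j → p i ~ p j) ~-sym ~-sym ~-sym p₁₂ p₁₃ p₂₃

      qq : ∀ i j → i ≢ j → q i ~ q j
      qq = pairwise (λ i j → q i ~ q j) ~-sym ~-sym ~-sym q₁₂ q₁₃ q₂₃

      mem : ∀ i → E i (p i)
      mem zero = m₁
      mem (suc zero) = m₂
      mem (suc (suc zero)) = m₃

      walk : ∀ i → Walk (E i) (p i) (q i)
      walk zero = w₁
      walk (suc zero) = w₂
      walk (suc (suc zero)) = w₃

      flip-only : ∀ {a b c d A B} → Only (Corner a b c d) A B → Only (Corner c d a b) B A
      flip-only s = only λ x y → apart s y x ∘ sym ,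
        λ e → [ (λ { (f , g) → inj₁ (g , f) }) , (λ { (f , g) → inj₂ (g , f) }) ]′ (edge-of s y x (~-sym e))

      sep : ∀ i j → i ≢ j → Only (Corner (p i) (q i) (p j) (q j)) (E i) (E j)
      sep = pairwise (λ i j → Only (Corner (p i) (q i) (p j) (q j)) (E i) (E j))
              flip-only flip-only flip-only s₁₂ s₁₃ s₂₃

      q≢p : ∀ i j → q i ≢ p j
      q≢p i j e with i Finₚ.≟ j
      q≢p zero j e | yes refl = n₁ (sym e)
      q≢p (suc zero) j e | yes refl = n₂ (sym e)
      q≢p (suc (suc zero)) j e | yes refl = n₃ (sym e)
      q≢p i j e | no ne = apart (sep i j ne) (endpoint∈ (mem i) (walk i)) (mem j) e

      P : Fin 3 → Path n
      P i = proj₁ (induced-path (walk i))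

      isPath : ∀ i → IsInducedPath G (P i) (q i) (p i)
      isPath i with induced-path (walk i)
      ... | Q , ind , s , t , _ = Induced.inj ind , s , t , Induced.edge ind

      inside : ∀ i {v} → OnPath v (P i) → E i v
      inside i (k , refl) with induced-path (walk i)
      ... | Q , ind , s , t , on with on k
      ... | inj₁ e = subst (E i) (sym e) (mem i)
      ... | inj₂ m = m

-- Attaching a leaf to a path

least : ∀ {m} {R : Fin m → Set} → Decidable R → ∃ R → ∃ λ i → R i × (∀ k → R k → toℕ i ≤ toℕ k)
least {suc m} R? h with R? zero
... | yes r = zero , r , λ _ _ → z≤n
least {suc m} R? (zero , r) | no ¬r = ⊥-elim (¬r r)
least {suc m} R? (suc k , r) | no ¬r with least (R? ∘ suc) (k , r)
... | i , s , lo = suc i , s , λ { zero t → ⊥-elim (¬r t) ; (suc j) t → s≤s (lo j t) }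

greatest : ∀ {m} {R : Fin m → Set} → Decidable R → ∃ R → ∃ λ i → R i × (∀ k → R k → toℕ k ≤ toℕ i)
greatest {suc m} R? h with Finₚ.any? (R? ∘ suc)
... | yes h′ with greatest (R? ∘ suc) h′
...   | i , s , hi = suc i , s , λ { zero _ → z≤n ; (suc j) t → s≤s (hi j t) }
greatest {suc m} R? (zero , r) | no ¬h = zero , r , λ { zero _ → z≤n ; (suc j) t → ⊥-elim (¬h (j , t)) }
greatest {suc m} R? (suc k , r) | no ¬h = ⊥-elim (¬h (k , r))

module Apex {n : ℕ} (G : Graph n) (a : Fin n) (noTheta : ¬ HasTheta G) where

  open Walks G public

  Leafy : Set
  Leafy = ∀ {v u u′} → v ~ a → v ~ u → v ~ u′ → u ≢ a → u′ ≢ a → u ≡ u′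

  -- One end of the theta is the apex, so each leg only has to lead from the centre `c` to a
  -- neighbour of `a`.
  claw : ∀ {c D₁ D₂ D₃} → c ≢ a → ¬ c ~ a → ¬ D₁ c → ¬ D₂ c → ¬ D₃ c → ¬ D₁ a → ¬ D₂ a → ¬ D₃ a →
         Thru D₁ c a → Thru D₂ c a → Thru D₃ c a →
         Sep D₁ D₂ → Sep D₁ D₃ → Sep D₂ D₃ → ⊥
  claw = theta noTheta

  first-step : ∀ {S u v} → Walk S u v → u ≡ v ⊎ ∃ λ x → u ~ x × S x × Walk S x v
  first-step nil = inj₁ refl
  first-step (p ▸ (e , s)) with first-step p
  ... | inj₁ refl = inj₂ (_ , e , s , nil)
  ... | inj₂ (x , f , t , q) = inj₂ (x , f , t , q ▸ (e , s))

  last-visit : ∀ {S T : Pred V 0ℓ} {u v} → Decidable T → Walk S u v → S u → T u →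
               ∃ λ p → S p × T p × Walk (S ∩ ∁ T) p v
  last-visit T? nil s t = _ , s , t , nil
  last-visit T? (_▸_ {w = w} p (e , s′)) s t with T? w
  ... | yes t′ = w , s′ , t′ , nil
  ... | no ¬t with last-visit T? p s t
  ...   | x , sx , tx , q = x , sx , tx , q ▸ (e , s′ , ¬t)

  -- The outcome of joining ℓ, w and w′ inside D ∪ {w, w′} when no claw does so: the three
  -- branches F₁, F₂, F₃ meet only in the triangle y z z′.
  record Net (D : Pred V 0ℓ) (ℓ w w′ : V) : Set₁ where
    no-eta-equality
    field
      y z z′ : V
      F₁ F₂ F₃ : Pred V 0ℓ
      F₁⊆ : F₁ ⊆ D
      F₂⊆ : F₂ ⊆ D ∪ Sing w
      F₃⊆ : F₃ ⊆ D ∪ Sing w′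
      y∈ : F₁ y
      z∈ : F₂ z
      z′∈ : F₃ z′
      w∈ : F₂ w
      w′∈ : F₃ w′
      y→ℓ : Walk F₁ y ℓ
      z→w : Walk F₂ z w
      z′→w′ : Walk F₃ z′ w′
      y~z : y ~ z
      y~z′ : y ~ z′
      z~z′ : z ~ z′
      o₁₂ : Only (λ u v → u ≡ y × v ≡ z) F₁ F₂
      o₁₃ : Only (λ u v → u ≡ y × v ≡ z′) F₁ F₃
      o₂₃ : Only (λ u v → u ≡ z × v ≡ z′) F₂ F₃
      F₂≁a : ∀ {v} → F₂ v → v ≡ w ⊎ ¬ v ~ a
      F₃≁a : ∀ {v} → F₃ v → v ≡ w′ ⊎ ¬ v ~ a

  flip-net : ∀ {D ℓ w w′} → Net D ℓ w w′ → Net D ℓ w′ w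
  flip-net N = record
    { y = y ; z = z′ ; z′ = z ; F₁ = F₁ ; F₂ = F₃ ; F₃ = F₂ ; F₁⊆ = F₁⊆ ; F₂⊆ = F₃⊆ ; F₃⊆ = F₂⊆
    ; y∈ = y∈ ; z∈ = z′∈ ; z′∈ = z∈ ; w∈ = w′∈ ; w′∈ = w∈ ; y→ℓ = y→ℓ ; z→w = z′→w′ ; z′→w′ = z→w
    ; y~z = y~z′ ; y~z′ = y~z ; z~z′ = ~-sym z~z′ ; o₁₂ = o₁₃ ; o₁₃ = o₁₂
    ; o₂₃ = only λ p q → apart o₂₃ q p ∘ sym , λ e → proj₂ (edge-of o₂₃ q p (~-sym e)) , proj₁ (edge-of o₂₃ q p (~-sym e))
    ; F₂≁a = F₃≁a ; F₃≁a = F₂≁a }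
    where open Net N

  module _ (leafy : Leafy) where

    two-nbrs : ∀ {v u u′} → v ~ u → v ~ u′ → u ≢ a → u′ ≢ a → u ≢ u′ → ¬ v ~ a
    two-nbrs e e′ u≢a u′≢a ne v~a = ne (leafy v~a e e′ u≢a u′≢a)

    private
      at : ∀ {l} m → m ≤ l → ∃ λ (i : Fin (suc l)) → toℕ i ≡ m
      at m le = fromℕ< (s≤s le) , Finₚ.toℕ-fromℕ< (s≤s le)

    module _ (l : ℕ) (f : Fin (suc l) → V) (ind : Induced (mkPath l f)) where

      Low High : ℕ → Pred V 0ℓ
      Low m v = ∃ λ k → toℕ k < m × v ≡ f k
      High m v = ∃ λ k → m ≤ toℕ k × v ≡ f k

      private
        edge : ∀ {i k} → toℕ i ≡ suc (toℕ k) → f i ~ f k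
        edge {i} {k} e = proj₂ (Induced.edge ind i k) (inj₁ e)

        down′ : ∀ m i → toℕ i ≡ m → Walk (Low (toℕ i)) (f i) (f zero)
        down′ zero zero _ = nil
        down′ (suc m) i e with at m (ℕₚ.≤-trans (ℕₚ.n≤1+n m) (subst (_≤ l) e (Finₚ.toℕ≤pred[n] i)))
        ... | k , q = (nil ▸ (edge e′ , k , ℕₚ.≤-reflexive (sym e′) , refl)) ++ʷ
                      map-walk (λ { (j , lt , r) → j , ℕₚ.<-trans lt (ℕₚ.≤-reflexive (sym e′)) , r }) (down′ m k q)
          where
          e′ : toℕ i ≡ suc (toℕ k)
          e′ = trans e (cong suc (sym q))

        up′ : ∀ d j → d + toℕ j ≡ l → Walk (High (suc (toℕ j))) (f j) (f (fromℕ l))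
        up′ zero j e = subst (λ k → Walk (High (suc (toℕ j))) (f j) (f k))
                         (Finₚ.toℕ-injective (trans e (sym (Finₚ.toℕ-fromℕ l)))) nil
        up′ (suc d) j e with at (suc (toℕ j)) (subst (suc (toℕ j) ≤_) e (s≤s (ℕₚ.m≤n+m (toℕ j) d)))
        ... | k , q = (nil ▸ (~-sym (edge q) , k , ℕₚ.≤-reflexive (sym q) , refl)) ++ʷ
                      map-walk (λ { (i , lt , r) → i , ℕₚ.≤-trans (ℕₚ.n≤1+n _) (subst (λ x → suc x ≤ toℕ i) q lt) , r })
                        (up′ d k (trans (cong (d +_) q) (trans (ℕₚ.+-suc d (toℕ j)) e)))

      down : ∀ i → Walk (Low (toℕ i)) (f i) (f zero)
      down i = down′ (toℕ i) i refl

      up : ∀ j → Walk (High (suc (toℕ j))) (f j) (f (fromℕ l))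
      up j = up′ _ j (ℕₚ.m∸n+n≡m (Finₚ.toℕ≤pred[n] j))

      inner : (∀ k → f k ≢ a) → ∀ k → 0 < toℕ k → toℕ k < l → ¬ f k ~ a
      inner f≢a (suc k) _ k<l with at (toℕ k) (ℕₚ.≤-trans (ℕₚ.n≤1+n _) (Finₚ.toℕ≤pred[n] (suc k))) | at (suc (suc (toℕ k))) k<l
      ... | i , p | j , q = two-nbrs (edge (cong suc (sym p))) (~-sym (edge q)) (f≢a i) (f≢a j)
              -- The two neighbours have indices `toℕ k` and `toℕ k + 2`, so they differ.
              λ e → ℕₚ.m≢1+m+n (toℕ k) {1} (trans (trans (trans (sym p) (cong toℕ (Induced.inj ind e))) q) (cong suc (sym (ℕₚ.+-comm (toℕ k) 1))))

      low-high : ∀ m → Only (λ u v → ∃ λ k → ∃ λ j → suc (toℕ k) ≡ m × toℕ j ≡ m × u ≡ f k × v ≡ f j) (Low m) (High m)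
      low-high m = only λ { (k , k<m , refl) (j , m≤j , refl) → ne k<m m≤j , consec k<m m≤j }
        where
        ne : ∀ {k j} → toℕ k < m → m ≤ toℕ j → f k ≢ f j
        ne k<m m≤j e = ℕₚ.<-irrefl (cong toℕ (Induced.inj ind e)) (ℕₚ.<-≤-trans k<m m≤j)
        consec : ∀ {k j} → toℕ k < m → m ≤ toℕ j → f k ~ f j →
                 ∃ λ k′ → ∃ λ j′ → suc (toℕ k′) ≡ m × toℕ j′ ≡ m × f k ≡ f k′ × f j ≡ f j′
        consec {k} {j} k<m m≤j e with proj₁ (Induced.edge ind k j) e
        ... | inj₁ q = ⊥-elim (ℕₚ.<-irrefl refl (ℕₚ.<-trans (ℕₚ.<-≤-trans k<m m≤j) (ℕₚ.≤-reflexive (sym q))))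
        ... | inj₂ q = k , j , ℕₚ.≤-antisym k<m (subst (m ≤_) q m≤j) , ℕₚ.≤-antisym (subst (_≤ m) (sym q) k<m) m≤j , refl , refl

      low-high-sep : ∀ {m m′} → m < m′ → Sep (Low m) (High m′)
      low-high-sep {m} {m′} lt = only λ x y → apart s x y , λ e → absurd y (edge-of s x y e)
        where
        s : Only _ (Low m) (High m′)
        s = only-⊆ id (λ { (j , m′≤j , q) → j , ℕₚ.≤-trans (ℕₚ.<⇒≤ lt) m′≤j , q }) (low-high m)
        absurd : ∀ {u v} → High m′ v → (∃ λ k → ∃ λ j → suc (toℕ k) ≡ m × toℕ j ≡ m × u ≡ f k × v ≡ f j) → ⊥
        absurd (j , m′≤j , q) (_ , j′ , _ , j′≡m , _ , r) =
          ℕₚ.<-irrefl (trans (sym j′≡m) (cong toℕ (Induced.inj ind (trans (sym r) q)))) (ℕₚ.<-≤-trans lt m′≤j)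

    module _ {D B B′ : Pred V 0ℓ} {ℓ w w′ : V} (conn : Conn D) (a∉D : ¬ D a) (ℓ∈D : D ℓ) (ℓ~a : ℓ ~ a)
             (w≢a : w ≢ a) (w′≢a : w′ ≢ a) (w∉D : ¬ D w) (w′∉D : ¬ D w′) (w≢w′ : w ≢ w′)
             (w~D : Touch D w) (w′~D : Touch D w′)
             (tail : Thru B w a) (tail′ : Thru B′ w′ a) (a∉B : ¬ B a) (a∉B′ : ¬ B′ a)
             (B∣D : Sep B D) (B′∣D : Sep B′ D) (B∣B′ : Sep B B′)
             (w∣B′ : Sep (Sing w) B′) (w′∣B : Sep (Sing w′) B) (w∉B : ¬ B w) (w′∉B′ : ¬ B′ w′) where

      private
        module OnSpine (l : ℕ) (f : Fin (suc l) → V) (ind : Induced (mkPath l f))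
               (f0 : f zero ≡ w) (fl : f (fromℕ l) ≡ w′) (on : ∀ k → f k ≡ w′ ⊎ (D ∪ Sing w) (f k)) where

          T : Pred V 0ℓ
          T v = ∃ λ k → v ≡ f k ⊎ v ~ f k

          T? : Decidable T
          T? v = Finₚ.any? (λ k → (v Finₚ.≟ f k) ⊎-dec (v ~? f k))

          f≢a : ∀ k → f k ≢ a
          f≢a k e with on k
          ... | inj₁ q = w′≢a (trans (sym q) e)
          ... | inj₂ (inj₁ d) = a∉D (subst D e d)
          ... | inj₂ (inj₂ q) = w≢a (trans (sym q) e)

          D-inner : ∀ k → D (f k) → 0 < toℕ k × toℕ k < l
          D-inner k d = ℕₚ.n≢0⇒n>0 (λ e → w∉D (subst D (trans (cong f (Finₚ.toℕ-injective e)) f0) d)) ,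
            ℕₚ.≤∧≢⇒< (Finₚ.toℕ≤pred[n] k) λ e → w′∉D (subst D (trans (cong f (Finₚ.toℕ-injective (trans e (sym (Finₚ.toℕ-fromℕ l))))) fl) d)

          Low′ High′ : ℕ → Pred V 0ℓ
          Low′ = Low l f ind
          High′ = High l f ind

          low⊆ : ∀ {m} → m ≤ l → Low′ m ⊆ D ∪ Sing w
          low⊆ m≤l (k , k<m , refl) with on k
          ... | inj₂ d = d
          ... | inj₁ e = ⊥-elim (ℕₚ.<-irrefl (trans (cong toℕ (Induced.inj ind (trans e (sym fl)))) (Finₚ.toℕ-fromℕ l)) (ℕₚ.<-≤-trans k<m m≤l))

          high⊆ : ∀ {m} → 0 < m → High′ m ⊆ D ∪ Sing w′
          high⊆ 0<m (k , m≤k , refl) with on k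
          ... | inj₁ e = inj₂ e
          ... | inj₂ (inj₁ d) = inj₁ d
          ... | inj₂ (inj₂ e) = ⊥-elim (ℕₚ.<-irrefl (sym (cong toℕ (Induced.inj ind (trans e (sym f0))))) (ℕₚ.<-≤-trans 0<m m≤k))

          result : ∀ {p} → D p → T p → Walk (D ∩ ∁ T) p ℓ → Net D ℓ w w′
          result {p} p∈D (k₀ , h₀) pℓ = split
            where
            -- On the spine, `p` would be an inner vertex of it. If the walk to `ℓ` is empty, then
            -- `p` is `ℓ` and adjacent to `a`, which inner vertices are not; otherwise the next
            -- vertex is adjacent to the spine at `p`, although the rest of the walk avoids `T`.
            p∉ : ∀ k → p ≢ f k
            p∉ k refl with D-inner k p∈D | first-step pℓ
            ... | 0<k , k<l | inj₁ refl = inner l f ind f≢a k 0<k k<l ℓ~a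
            ... | _ | inj₂ (x , e , (_ , ¬t) , _) = ¬t (k , inj₂ (~-sym e))

            p≢a : p ≢ a
            p≢a e = a∉D (subst D e p∈D)

            touch : ∃ λ k → p ~ f k
            touch = k₀ , [ ⊥-elim ∘ p∉ k₀ , id ]′ h₀

            S₀ : Pred V 0ℓ
            S₀ = D ∩ ∁ T

            S₀-path : ∀ {v k} → S₀ v → v ≢ f k × ¬ v ~ f k
            S₀-path {k = k} (_ , ¬t) = (λ e → ¬t (k , inj₁ e)) , λ e → ¬t (k , inj₂ e)

            S₀-low : ∀ {m} → Sep S₀ (Low′ m)
            S₀-low = only λ { s (k , _ , refl) → S₀-path s }

            S₀-high : ∀ {m} → Sep S₀ (High′ m)
            S₀-high = only λ { s (k , _ , refl) → S₀-path s }

            D∣B : Sep D B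
            D∣B = sep-sym B∣D
            D∣B′ : Sep D B′
            D∣B′ = sep-sym B′∣D

            low∣B′ : ∀ {m} → m ≤ l → Sep (Low′ m) B′
            low∣B′ m≤l = only-⊆ (low⊆ m≤l) id (only-∪ˡ D∣B′ w∣B′)

            high∣B : ∀ {m} → 0 < m → Sep (High′ m) B
            high∣B 0<m = only-⊆ (high⊆ 0<m) id (only-∪ˡ D∣B w′∣B)

            f∉B : ∀ k → ¬ B (f k)
            f∉B k b with on k
            ... | inj₁ e = apart w′∣B refl (subst B e b) refl
            ... | inj₂ (inj₁ d) = apart B∣D b d refl
            ... | inj₂ (inj₂ e) = w∉B (subst B e b)

            f∉B′ : ∀ k → ¬ B′ (f k)
            f∉B′ k b with on k
            ... | inj₁ e = w′∉B′ (subst B′ e b)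
            ... | inj₂ (inj₁ d) = apart B′∣D b d refl
            ... | inj₂ (inj₂ e) = apart w∣B′ refl (subst B′ e b) refl

            low-tail : ∀ i → Thru (Low′ (toℕ i) ∪ B) (f i) a
            low-tail i = subst (Walk _ (f i)) f0 (map-walk inj₁ (down l f ind i)) ++ᵗ map-thru inj₂ tail

            high-tail : ∀ j → Thru (High′ (suc (toℕ j)) ∪ B′) (f j) a
            high-tail j = subst (Walk _ (f j)) fl (map-walk inj₁ (up l f ind j)) ++ᵗ map-thru inj₂ tail′

            a∉low : ∀ {m} → ¬ (Low′ m ∪ B) a
            a∉low (inj₁ (k , _ , e)) = f≢a k (sym e)
            a∉low (inj₂ b) = a∉B b

            a∉high : ∀ {m} → ¬ (High′ m ∪ B′) a
            a∉high (inj₁ (k , _ , e)) = f≢a k (sym e)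
            a∉high (inj₂ b) = a∉B′ b

            open Σ (least (λ k → p ~? f k) touch) renaming (proj₁ to i; proj₂ to i-spec)
            open Σ (greatest (λ k → p ~? f k) touch) renaming (proj₁ to j; proj₂ to j-spec)

            p~i : p ~ f i
            p~i = proj₁ i-spec
            p~j : p ~ f j
            p~j = proj₁ j-spec

            i≤j : toℕ i ≤ toℕ j
            i≤j = proj₂ i-spec j p~j

            low-high∪ : ∀ {m m′} → m < m′ → m ≤ l → 0 < m′ → Sep (Low′ m ∪ B) (High′ m′ ∪ B′)
            low-high∪ lt m≤l 0<m′ =
              only-∪ˡ (only-∪ʳ (low-high-sep l f ind lt) (low∣B′ m≤l)) (only-∪ʳ (sep-sym (high∣B 0<m′)) B∣B′)

            -- One neighbour on the spine: a claw centred there.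
            single : toℕ i ≡ toℕ j → ⊥
            single i≡j = claw {c} {S₀ ∪ Sing p} {Low′ (toℕ i) ∪ B} {High′ (suc (toℕ i)) ∪ B′}
              (f≢a i) c≁a
              (λ { (inj₁ s) → proj₁ (S₀-path s) refl ; (inj₂ e) → p∉ i (sym e) })
              (λ { (inj₁ (k , lt , e)) → ℕₚ.<-irrefl (sym (cong toℕ (Induced.inj ind e))) lt ; (inj₂ b) → f∉B i b })
              (λ { (inj₁ (k , lt , e)) → ℕₚ.<-irrefl (cong toℕ (Induced.inj ind e)) lt ; (inj₂ b) → f∉B′ i b })
              (λ { (inj₁ (d , _)) → a∉D d ; (inj₂ e) → p≢a (sym e) }) a∉low a∉high
              ((nil ▸ (~-sym p~i , inj₂ refl)) ++ᵗ (ℓ , map-walk inj₁ pℓ , ℓ~a)) (low-tail i) (high-tail i)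
              (only-∪ʳ (only-∪ˡ S₀-low p-low) (only-∪ˡ (only-⊆ proj₁ id D∣B) (only λ { refl b → rel D∣B p∈D b })))
              (only-∪ʳ (only-∪ˡ S₀-high p-high) (only-∪ˡ (only-⊆ proj₁ id D∣B′) (only λ { refl b → rel D∣B′ p∈D b })))
              (low-high∪ ℕₚ.≤-refl (Finₚ.toℕ≤pred[n] i) (s≤s z≤n))
              where
              c : V
              c = f i
              p-low : Sep (Sing p) (Low′ (toℕ i))
              p-low = only λ { refl (k , lt , refl) → p∉ k , λ e → ℕₚ.<-irrefl refl (ℕₚ.<-≤-trans lt (proj₂ i-spec k e)) }
              p-high : Sep (Sing p) (High′ (suc (toℕ i)))
              p-high = only λ { refl (k , lt , refl) → p∉ k , λ e → ℕₚ.<-irrefl refl (ℕₚ.<-≤-trans lt (subst (toℕ k ≤_) (sym i≡j) (proj₂ j-spec k e))) }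
              -- As `w ≢ w′`, the spine has an edge at `f i`, which gives `f i` a neighbour besides
              -- `p`.
              nbr : ∃ λ k → f i ~ f k
              nbr with first-step (down l f ind i) | first-step (up l f ind i)
              ... | inj₂ (_ , e , (k , _ , refl) , _) | _ = k , e
              ... | inj₁ _ | inj₂ (_ , e , (k , _ , refl) , _) = k , e
              ... | inj₁ e | inj₁ e′ = ⊥-elim (w≢w′ (trans (sym f0) (trans (sym e) (trans e′ fl))))
              c≁a : ¬ f i ~ a
              c≁a = two-nbrs (~-sym p~i) (proj₂ nbr) p≢a (f≢a _) (p∉ _)

            -- Two nonadjacent neighbours on the spine: a claw centred at p.
            spread : suc (toℕ i) < toℕ j → ⊥
            spread lt = claw {p} {S₀} {Low′ (suc (toℕ i)) ∪ B} {High′ (toℕ j) ∪ B′}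
              p≢a (two-nbrs p~i p~j (f≢a i) (f≢a j) λ e → ℕₚ.<-irrefl (cong toℕ (Induced.inj ind e)) (ℕₚ.<-trans ℕₚ.≤-refl lt))
              (λ { (_ , ¬t) → ¬t (i , inj₂ p~i) })
              (λ { (inj₁ (k , _ , e)) → p∉ k e ; (inj₂ b) → apart D∣B p∈D b refl })
              (λ { (inj₁ (k , _ , e)) → p∉ k e ; (inj₂ b) → apart D∣B′ p∈D b refl })
              (λ { (d , _) → a∉D d }) a∉low a∉high
              (ℓ , pℓ , ℓ~a)
              ((nil ▸ (p~i , inj₁ (i , ℕₚ.≤-refl , refl))) ++ᵗ map-thru (λ { (inj₁ (k , q , e)) → inj₁ (k , ℕₚ.m≤n⇒m≤1+n q , e) ; (inj₂ b) → inj₂ b }) (low-tail i))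
              ((nil ▸ (p~j , inj₁ (j , ℕₚ.≤-refl , refl))) ++ᵗ map-thru (λ { (inj₁ (k , q , e)) → inj₁ (k , ℕₚ.<⇒≤ q , e) ; (inj₂ b) → inj₂ b }) (high-tail j))
              (only-∪ʳ S₀-low (only-⊆ proj₁ id D∣B))
              (only-∪ʳ S₀-high (only-⊆ proj₁ id D∣B′))
              (low-high∪ lt (ℕₚ.<⇒≤ (ℕₚ.<-≤-trans lt (Finₚ.toℕ≤pred[n] j))) (ℕₚ.<-trans (s≤s z≤n) lt))

            triangle : suc (toℕ i) ≡ toℕ j → Net D ℓ w w′
            triangle i+1≡j = record
              { y = p ; z = f i ; z′ = f j
              ; F₁ = S₀ ∪ Sing p ; F₂ = Low′ (suc (toℕ i)) ; F₃ = High′ (suc (toℕ i))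
              ; F₁⊆ = λ { (inj₁ s) → proj₁ s ; (inj₂ refl) → p∈D }
              ; F₂⊆ = low⊆ i<l ; F₃⊆ = high⊆ (s≤s z≤n)
              ; y∈ = inj₂ refl ; z∈ = i , ℕₚ.≤-refl , refl ; z′∈ = j , ℕₚ.≤-reflexive i+1≡j , refl
              ; w∈ = zero , s≤s z≤n , sym f0
              ; w′∈ = fromℕ l , subst (suc (toℕ i) ≤_) (sym (Finₚ.toℕ-fromℕ l)) i<l , sym fl
              ; y→ℓ = map-walk inj₁ pℓ
              ; z→w = subst (Walk _ (f i)) f0 (map-walk (λ { (k , q , e) → k , ℕₚ.m≤n⇒m≤1+n q , e }) (down l f ind i))
              ; z′→w′ = subst (Walk _ (f j)) fl (map-walk (λ { (k , q , e) → k , ℕₚ.<⇒≤ (subst (λ x → suc x ≤ toℕ k) (sym i+1≡j) q) , e }) (up l f ind j))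
              ; y~z = p~i ; y~z′ = p~j
              ; z~z′ = proj₂ (Induced.edge ind i j) (inj₂ (sym i+1≡j))
              ; o₁₂ = only-∪ˡ (sep-only S₀-low) p-low
              ; o₁₃ = only-∪ˡ (sep-only S₀-high) p-high
              ; o₂₃ = only-map (λ { (k , k′ , q , q′ , e , e′) →
                  trans e (cong f (Finₚ.toℕ-injective (ℕₚ.suc-injective q))) ,
                  trans e′ (cong f (Finₚ.toℕ-injective (trans q′ i+1≡j))) }) (low-high l f ind (suc (toℕ i)))
              ; F₂≁a = F₂≁a ; F₃≁a = F₃≁a }
              where
              i<l : toℕ i < l
              i<l = subst (_≤ l) (sym i+1≡j) (Finₚ.toℕ≤pred[n] j)
              p-low : Only (λ u v → u ≡ p × v ≡ f i) (Sing p) (Low′ (suc (toℕ i)))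
              p-low = only λ { refl (k , s≤s k≤i , refl) → p∉ k , λ e → refl , cong f (Finₚ.toℕ-injective (ℕₚ.≤-antisym k≤i (proj₂ i-spec k e))) }
              p-high : Only (λ u v → u ≡ p × v ≡ f j) (Sing p) (High′ (suc (toℕ i)))
              p-high = only λ { refl (k , i<k , refl) → p∉ k , λ e → refl , cong f (Finₚ.toℕ-injective (ℕₚ.≤-antisym (proj₂ j-spec k e) (subst (_≤ toℕ k) i+1≡j i<k))) }
              F₂≁a : ∀ {v} → Low′ (suc (toℕ i)) v → v ≡ w ⊎ ¬ v ~ a
              F₂≁a (zero , _ , e) = inj₁ (trans e f0)
              F₂≁a (suc k , q , refl) = inj₂ (inner l f ind f≢a (suc k) (s≤s z≤n) (ℕₚ.<-≤-trans q i<l))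
              F₃≁a : ∀ {v} → High′ (suc (toℕ i)) v → v ≡ w′ ⊎ ¬ v ~ a
              F₃≁a (k , q , refl) with on k
              ... | inj₁ e = inj₁ e
              ... | inj₂ (inj₁ d) = inj₂ (inner l f ind f≢a k (proj₁ (D-inner k d)) (proj₂ (D-inner k d)))
              ... | inj₂ (inj₂ e) = ⊥-elim (ℕₚ.n≮0 (subst (toℕ i <_) (cong toℕ (Induced.inj ind (trans e (sym f0)))) q))

            split : Net D ℓ w w′
            split with ℕₚ.m≤n⇒m<n∨m≡n i≤j
            ... | inj₂ e = ⊥-elim (single e)
            ... | inj₁ lt with ℕₚ.m≤n⇒m<n∨m≡n lt
            ...   | inj₂ e = triangle e
            ...   | inj₁ lt′ = ⊥-elim (spread lt′)

      abstract
       -- `B` and `B′` lead from `w` and `w′` on to `a` outside `D`. The spine is an induced path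
       -- from `w` to `w′`, and `p` is the last vertex equal or adjacent to it on a walk to `ℓ`. The
       -- first and last neighbours of `p` on the spine decide: if they are equal or nonconsecutive
       -- there is a claw, and if consecutive they form the triangle with `p`.
       fork : Net D ℓ w w′
       fork with induced-path {D ∪ Sing w} {w′} {w} (map-walk inj₁ (enter conn w′~D (proj₁ (proj₂ w~D))) ▸ (proj₂ (proj₂ w~D) , inj₂ refl))
       ... | mkPath l f , ind , f0 , fl , on
         with last-visit (OnSpine.T? l f ind f0 fl on) (conn (proj₁ (proj₂ w~D)) ℓ∈D) (proj₁ (proj₂ w~D))
               (zero , inj₂ (subst (proj₁ w~D ~_) (sym f0) (proj₂ (proj₂ w~D))))
       ... | p , p∈D , t , q = OnSpine.result l f ind f0 fl on p∈D t q

-- Thickened pyramids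

module Pyramid {n : ℕ} (G : Graph n) (a : Fin n) (noTheta : ¬ HasTheta G) (noPrism : ¬ HasPrism G)
               (leafy : Apex.Leafy G a noTheta) where

  open Apex G a noTheta public

  record Leg (ℓ : V) (D : Pred V 0ℓ) (t : V) : Set where
    no-eta-equality
    field
      a∉D : ¬ D a
      conn : Conn D
      ℓ∈D : D ℓ
      ℓ~a : ℓ ~ a
      t∉D : ¬ D t
      t≢a : t ≢ a
      t~D : Touch D t

  open Leg

  record Spread (D : Pred V 0ℓ) (t : V) (D′ : Pred V 0ℓ) (t′ : V) : Set where
    no-eta-equality
    field
      D∣D′ : Sep D D′
      t∣D′ : Sep (Sing t) D′
      D∣t′ : Sep D (Sing t′)
      t~t′ : t ~ t′

  open Spread

  spread-sym : ∀ {D t D′ t′} → Spread D t D′ t′ → Spread D′ t′ D t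
  spread-sym h = record { D∣D′ = sep-sym (D∣D′ h) ; t∣D′ = sep-sym (D∣t′ h) ; D∣t′ = sep-sym (t∣D′ h) ; t~t′ = ~-sym (t~t′ h) }

  -- A pyramid with apex a and base triangle t₁ t₂ t₃ whose three paths have been thickened
  -- to connected sets D₁, D₂, D₃.
  record Thick (ℓ₁ ℓ₂ ℓ₃ : V) (D₁ D₂ D₃ : Pred V 0ℓ) (t₁ t₂ t₃ : V) : Set where
    no-eta-equality
    field
      g₁ : Leg ℓ₁ D₁ t₁
      g₂ : Leg ℓ₂ D₂ t₂
      g₃ : Leg ℓ₃ D₃ t₃
      h₁₂ : Spread D₁ t₁ D₂ t₂
      h₁₃ : Spread D₁ t₁ D₃ t₃
      h₂₃ : Spread D₂ t₂ D₃ t₃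

  swap₁₂ : ∀ {ℓ₁ ℓ₂ ℓ₃ D₁ D₂ D₃ t₁ t₂ t₃} → Thick ℓ₁ ℓ₂ ℓ₃ D₁ D₂ D₃ t₁ t₂ t₃ → Thick ℓ₂ ℓ₁ ℓ₃ D₂ D₁ D₃ t₂ t₁ t₃
  swap₁₂ π = record { g₁ = g₂ ; g₂ = g₁ ; g₃ = g₃ ; h₁₂ = spread-sym h₁₂ ; h₁₃ = h₂₃ ; h₂₃ = h₁₃ }
    where open Thick π

  swap₂₃ : ∀ {ℓ₁ ℓ₂ ℓ₃ D₁ D₂ D₃ t₁ t₂ t₃} → Thick ℓ₁ ℓ₂ ℓ₃ D₁ D₂ D₃ t₁ t₂ t₃ → Thick ℓ₁ ℓ₃ ℓ₂ D₁ D₃ D₂ t₁ t₃ t₂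
  swap₂₃ π = record { g₁ = g₁ ; g₂ = g₃ ; g₃ = g₂ ; h₁₂ = h₁₃ ; h₁₃ = h₁₂ ; h₂₃ = spread-sym h₂₃ }
    where open Thick π

  out : ∀ {ℓ D t w} → Leg ℓ D t → Touch D w → Thru D w a
  out g w~D = _ , enter (conn g) w~D (ℓ∈D g) , ℓ~a g

  touch≢ : ∀ {D u v} → Sep (Sing u) D → Touch D v → v ≢ u
  touch≢ s (d , d∈ , e) refl = edge-of s refl d∈ (~-sym e)

  touch∉ : ∀ {D D′ v} → Sep D D′ → Touch D v → ¬ D′ v
  touch∉ s (d , d∈ , e) v∈ = edge-of s d∈ v∈ e

  adj-only : ∀ {R u v} → (u ≢ v) → (u ~ v → R u v) → Only R (Sing u) (Sing v)
  adj-only ne f = only λ { refl refl → ne , f }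

  apex-sep : ∀ {X : Pred V 0ℓ} → ¬ X a → (∀ {v} → X v → ¬ v ~ a) → Sep (Sing a) X
  apex-sep a∉ na = only λ { refl x → (λ { refl → a∉ x }) , na x ∘ ~-sym }

  avoids : ∀ {D : Pred V 0ℓ} {w} → ¬ D a → w ≢ a → ¬ (D ∪ Sing w) a
  avoids a∉ w≢a (inj₁ d) = a∉ d
  avoids a∉ w≢a (inj₂ e) = w≢a (sym e)

  module NetFacts {D ℓ w w′} (N : Net D ℓ w w′) (a∉ : ¬ D a) (w≢a : w ≢ a) (w≁a : ¬ w ~ a) where
    open Net N public

    a∣F₂ : Sep (Sing a) F₂
    a∣F₂ = apex-sep (avoids {D} a∉ w≢a ∘ F₂⊆) λ x → [ (λ { refl → w≁a }) , id ]′ (F₂≁a x)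

  module ThickFacts {ℓ₁ ℓ₂ ℓ₃ D₁ D₂ D₃ t₁ t₂ t₃} (π : Thick ℓ₁ ℓ₂ ℓ₃ D₁ D₂ D₃ t₁ t₂ t₃) where
    open Thick π public

    -- The third leg with its base vertex, as a single way from a neighbour of `t₃` to the apex.
    E₃ : Pred V 0ℓ
    E₃ = Sing t₃ ∪ D₃

    D₁∣E₃ : Sep D₁ E₃
    D₁∣E₃ = only-∪ʳ (D∣t′ h₁₃) (D∣D′ h₁₃)

    D₂∣E₃ : Sep D₂ E₃
    D₂∣E₃ = only-∪ʳ (D∣t′ h₂₃) (D∣D′ h₂₃)

    a∉E₃ : ¬ E₃ a
    a∉E₃ (inj₁ e) = t≢a g₃ (sym e)
    a∉E₃ (inj₂ d) = a∉D g₃ d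

    t₃→ℓ : Walk E₃ t₃ ℓ₃
    t₃→ℓ = map-walk inj₂ (enter (conn g₃) (t~D g₃) (ℓ∈D g₃))

    out₃ : ∀ {w} → w ~ t₃ → Thru E₃ w a
    out₃ e = ℓ₃ , (nil ▸ (e , inj₁ refl)) ++ʷ t₃→ℓ , ℓ~a g₃

    t₁≁a : ¬ t₁ ~ a
    t₁≁a = two-nbrs leafy (t~t′ h₁₂) (t~t′ h₁₃) (t≢a g₂) (t≢a g₃) (~-irrefl (t~t′ h₂₃))

  -- Vertices attached to two legs

  record Both (D₁ D₂ D₃ : Pred V 0ℓ) (w : V) : Set where
    no-eta-equality
    field
      w≢a : w ≢ a
      w∉D₁ : ¬ D₁ w
      w∉D₂ : ¬ D₂ w
      w∉D₃ : ¬ D₃ w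
      w~D₁ : Touch D₁ w
      w~D₂ : Touch D₂ w

  swap-both : ∀ {D₁ D₂ D₃ w} → Both D₁ D₂ D₃ w → Both D₂ D₁ D₃ w
  swap-both β = record { w≢a = w≢a ; w∉D₁ = w∉D₂ ; w∉D₂ = w∉D₁ ; w∉D₃ = w∉D₃ ; w~D₁ = w~D₂ ; w~D₂ = w~D₁ }
    where open Both β

  module BothFacts {ℓ₁ ℓ₂ ℓ₃ D₁ D₂ D₃ t₁ t₂ t₃ w} (π : Thick ℓ₁ ℓ₂ ℓ₃ D₁ D₂ D₃ t₁ t₂ t₃) (β : Both D₁ D₂ D₃ w) where
    open ThickFacts π public
    open Both β public

    nbr₁≢nbr₂ : proj₁ w~D₁ ≢ proj₁ w~D₂
    nbr₁≢nbr₂ = apart (D∣D′ h₁₂) (proj₁ (proj₂ w~D₁)) (proj₁ (proj₂ w~D₂))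

    w≁a : ¬ w ~ a
    w≁a = two-nbrs leafy (~-sym (proj₂ (proj₂ w~D₁))) (~-sym (proj₂ (proj₂ w~D₂)))
            (λ e → a∉D g₁ (subst D₁ e (proj₁ (proj₂ w~D₁)))) (λ e → a∉D g₂ (subst D₂ e (proj₁ (proj₂ w~D₂)))) nbr₁≢nbr₂

    w∉E₃ : ¬ E₃ w
    w∉E₃ (inj₁ e) = touch≢ (sep-sym (D∣t′ h₁₃)) w~D₁ e
    w∉E₃ (inj₂ d) = w∉D₃ d

    -- A third way to `a` would make `w` the centre of a claw whose other two legs run through `D₁`
    -- and `D₂`.
    no-third : ¬ Thru E₃ w a
    no-third p = claw w≢a w≁a w∉D₁ w∉D₂ w∉E₃ (a∉D g₁) (a∉D g₂) a∉E₃ (out g₁ w~D₁) (out g₂ w~D₂) p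
                   (D∣D′ h₁₂) D₁∣E₃ D₂∣E₃

    w≁t₃ : ¬ w ~ t₃
    w≁t₃ = no-third ∘ out₃

    w≁D₃ : ¬ Touch D₃ w
    w≁D₃ = no-third ∘ map-thru inj₂ ∘ out g₃

    w∣E₃ : Sep (Sing w) E₃
    w∣E₃ = only-∪ʳ (only λ { refl refl → (w∉E₃ ∘ inj₁) , w≁t₃ }) (sing-sep w∉D₃ w≁D₃)

    t₁≢t₃ : t₁ ≢ t₃
    t₁≢t₃ = ~-irrefl (t~t′ h₁₃)

    w≢t₁ : w ≢ t₁
    w≢t₁ = touch≢ (t∣D′ h₁₂) w~D₂

    w≢t₂ : w ≢ t₂
    w≢t₂ = touch≢ (sep-sym (D∣t′ h₁₂)) w~D₁

    -- For `fork`, `w` continues to `a` through `D₂`, and `t₁` does so through `t₃` and `D₃`.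
    net : Net D₁ ℓ₁ w t₁
    net = fork leafy (conn g₁) (a∉D g₁) (ℓ∈D g₁) (ℓ~a g₁) w≢a (t≢a g₁) w∉D₁ (t∉D g₁) w≢t₁
            w~D₁ (t~D g₁) (out g₂ w~D₂) (out₃ (t~t′ h₁₃)) (a∉D g₂) a∉E₃
            (sep-sym (D∣D′ h₁₂)) (sep-sym D₁∣E₃) D₂∣E₃ w∣E₃ (t∣D′ h₁₂) w∉D₂
            (λ { (inj₁ e) → t₁≢t₃ e ; (inj₂ d) → apart (t∣D′ h₁₃) refl d refl })

  module TwoNets {ℓ₁ ℓ₂ ℓ₃ D₁ D₂ D₃ t₁ t₂ t₃ w} (π : Thick ℓ₁ ℓ₂ ℓ₃ D₁ D₂ D₃ t₁ t₂ t₃) (β : Both D₁ D₂ D₃ w) (w≁t₁ : ¬ w ~ t₁)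
                 (n₁ : Net D₁ ℓ₁ w t₁) (n₂ : Net D₂ ℓ₂ w t₂) where
    open BothFacts π β
    module N₁ = NetFacts n₁ (a∉D g₁) w≢a w≁a
    module N₂ = NetFacts n₂ (a∉D g₂) w≢a w≁a

    w-F₂ : Sing w ⊆ N₁.F₂
    w-F₂ refl = N₁.w∈

    w-G₂ : Sing w ⊆ N₂.F₂
    w-G₂ refl = N₂.w∈

    a∣F₃ : Sep (Sing a) N₁.F₃
    a∣F₃ = NetFacts.a∣F₂ (flip-net n₁) (a∉D g₁) (t≢a g₁) t₁≁a

    a∣G₃ : Sep (Sing a) N₂.F₃
    a∣G₃ = NetFacts.a∣F₂ (flip-net n₂) (a∉D g₂) (t≢a g₂) (ThickFacts.t₁≁a (swap₁₂ π))

    -- The paths of the prism go from `y` through `ℓ₁`, `a` and `ℓ₃` to `t₃`; from `z` through `w`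
    -- and the second net to `t₂`; and from `z′` along its branch to `t₁`.
    far : N₁.z′ ≢ t₁ → ⊥
    far z′≢t₁ = prism noPrism {E₁ = (N₁.F₁ ∪ Sing a) ∪ E₃} {E₂ = N₁.F₂ ∪ (N₂.F₂ ∪ N₂.F₃)} {E₃ = N₁.F₃}
      N₁.y~z N₁.y~z′ N₁.z~z′ (~-sym (t~t′ h₂₃)) (~-sym (t~t′ h₁₃)) (~-sym (t~t′ h₁₂))
      (apart (D∣t′ h₁₃) (N₁.F₁⊆ N₁.y∈) refl) z≢t₂ z′≢t₁
      (inj₁ (inj₁ N₁.y∈)) (inj₁ N₁.z∈) N₁.z′∈
      (map-walk (inj₁ ∘ inj₁) N₁.y→ℓ ++ʷ (nil ▸ (ℓ~a g₁ , inj₁ (inj₂ refl))) ++ʷ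
        (nil ▸ (~-sym (ℓ~a g₃) , inj₂ (inj₂ (ℓ∈D g₃)))) ++ʷ map-walk inj₂ (reverse-walk (inj₁ refl) t₃→ℓ))
      (map-walk inj₁ N₁.z→w ++ʷ map-walk (inj₂ ∘ inj₁) (reverse-walk N₂.z∈ N₂.z→w) ++ʷ
        (nil ▸ (N₂.z~z′ , inj₂ (inj₂ N₂.z′∈))) ++ʷ map-walk (inj₂ ∘ inj₂) N₂.z′→w′)
      N₁.z′→w′
      (only-∪ˡ (only-∪ˡ F₁-rest (sep-only (only-∪ʳ N₁.a∣F₂ (only-∪ʳ N₂.a∣F₂ a∣G₃)))) E₃-rest)
      (only-∪ˡ (only-∪ˡ (only-map inj₁ N₁.o₁₃) (sep-only a∣F₃)) E₃-F₃)
      (only-∪ˡ (only-map inj₁ N₁.o₂₃) (only-∪ˡ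
        (only-⊆ N₂.F₂⊆ id (only-∪ˡ D₂-F₃ (only-⊆ w-F₂ id (only-map inj₁ N₁.o₂₃))))
        (only-⊆ N₂.F₃⊆ N₁.F₃⊆ (only-∪ˡ (only-∪ʳ (sep-only (sep-sym (D∣D′ h₁₂))) (sep-only (sep-sym (t∣D′ h₁₂))))
          (only-∪ʳ (sep-only (sep-sym (D∣t′ h₁₂))) (adj-only (~-irrefl (~-sym (t~t′ h₁₂))) λ _ → inj₂ (refl , refl)))))))
      where
      z≢t₂ : N₁.z ≢ t₂
      z≢t₂ with N₁.F₂⊆ N₁.z∈
      ... | inj₁ d = apart (D∣t′ h₁₂) d refl
      ... | inj₂ e = λ q → w≢t₂ (trans (sym e) q)

      F₁-rest : Only (Corner noPrism N₁.y t₃ N₁.z t₂) N₁.F₁ (N₁.F₂ ∪ (N₂.F₂ ∪ N₂.F₃))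
      F₁-rest = only-∪ʳ (only-map inj₁ N₁.o₁₂) (only-∪ʳ
        (only-⊆ id N₂.F₂⊆ (only-∪ʳ (sep-only (only-⊆ N₁.F₁⊆ id (D∣D′ h₁₂))) (only-⊆ id w-F₂ (only-map inj₁ N₁.o₁₂))))
        (only-⊆ N₁.F₁⊆ N₂.F₃⊆ (sep-only (only-∪ʳ (D∣D′ h₁₂) (D∣t′ h₁₂)))))

      E₃-rest : Only (Corner noPrism N₁.y t₃ N₁.z t₂) E₃ (N₁.F₂ ∪ (N₂.F₂ ∪ N₂.F₃))
      E₃-rest = only-∪ʳ (only-⊆ id N₁.F₂⊆ (sep-only (only-∪ʳ (sep-sym D₁∣E₃) (sep-sym w∣E₃)))) (only-∪ʳ
        (only-⊆ id N₂.F₂⊆ (sep-only (only-∪ʳ (sep-sym D₂∣E₃) (sep-sym w∣E₃))))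
        (only-⊆ id N₂.F₃⊆ (only-∪ʳ (sep-only (sep-sym D₂∣E₃)) (only-∪ˡ
          (adj-only (~-irrefl (~-sym (t~t′ h₂₃))) λ _ → inj₂ (refl , refl)) (sep-only (sep-sym (t∣D′ h₂₃)))))))

      E₃-F₃ : Only (Corner noPrism N₁.y t₃ N₁.z′ t₁) E₃ N₁.F₃
      E₃-F₃ = only-⊆ id N₁.F₃⊆ (only-∪ʳ (sep-only (sep-sym D₁∣E₃)) (only-∪ˡ
        (adj-only (~-irrefl (~-sym (t~t′ h₁₃))) λ _ → inj₂ (refl , refl)) (sep-only (sep-sym (t∣D′ h₁₃)))))

      D₂-F₃ : Only (Corner noPrism N₁.z t₂ N₁.z′ t₁) D₂ N₁.F₃
      D₂-F₃ = only-⊆ id N₁.F₃⊆ (sep-only (only-∪ʳ (sep-sym (D∣D′ h₁₂)) (sep-sym (t∣D′ h₁₂))))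

    -- Now the triangles of the two nets are the bases. The paths pass through `ℓ₁`, `a` and `ℓ₂`;
    -- through `w`; and from `t₁` through `t₂` into the second net.
    near : N₁.z′ ≡ t₁ → ⊥
    near z′≡t₁ = prism noPrism {E₁ = (N₁.F₁ ∪ Sing a) ∪ N₂.F₁} {E₂ = N₁.F₂ ∪ N₂.F₂} {E₃ = Sing t₁ ∪ N₂.F₃}
      N₁.y~z (subst (N₁.y ~_) z′≡t₁ N₁.y~z′) (subst (N₁.z ~_) z′≡t₁ N₁.z~z′) N₂.y~z N₂.y~z′ N₂.z~z′
      (apart (D∣D′ h₁₂) (N₁.F₁⊆ N₁.y∈) (N₂.F₁⊆ N₂.y∈)) z≢z₂
      (λ e → apart t₁∣G₃ refl N₂.z′∈ e)
      (inj₁ (inj₁ N₁.y∈)) (inj₁ N₁.z∈) (inj₁ refl)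
      (map-walk (inj₁ ∘ inj₁) N₁.y→ℓ ++ʷ (nil ▸ (ℓ~a g₁ , inj₁ (inj₂ refl))) ++ʷ
        (nil ▸ (~-sym (ℓ~a g₂) , inj₂ (endpoint∈ N₂.y∈ N₂.y→ℓ))) ++ʷ map-walk inj₂ (reverse-walk N₂.y∈ N₂.y→ℓ))
      (map-walk inj₁ N₁.z→w ++ʷ map-walk inj₂ (reverse-walk N₂.z∈ N₂.z→w))
      ((nil ▸ (t~t′ h₁₂ , inj₂ N₂.w′∈)) ++ʷ map-walk inj₂ (reverse-walk N₂.z′∈ N₂.z′→w′))
      (only-∪ˡ (only-∪ˡ
          (only-∪ʳ (only-map inj₁ N₁.o₁₂) (only-⊆ id N₂.F₂⊆ (only-∪ʳ
            (sep-only (only-⊆ N₁.F₁⊆ id (D∣D′ h₁₂))) (only-⊆ id w-F₂ (only-map inj₁ N₁.o₁₂)))))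
          (sep-only (only-∪ʳ N₁.a∣F₂ N₂.a∣F₂)))
        (only-∪ʳ (only-⊆ id N₁.F₂⊆ (only-∪ʳ
            (sep-only (only-⊆ N₂.F₁⊆ id (sep-sym (D∣D′ h₁₂)))) (only-⊆ id w-G₂ (only-map inj₂ N₂.o₁₂))))
          (only-map inj₂ N₂.o₁₂)))
      (only-∪ˡ (only-∪ˡ
          (only-∪ʳ (only-⊆ id t₁-F₃ (only-map base N₁.o₁₃))
            (only-⊆ N₁.F₁⊆ N₂.F₃⊆ (sep-only (only-∪ʳ (D∣D′ h₁₂) (D∣t′ h₁₂)))))
          (sep-only (only-∪ʳ (only-⊆ id t₁-F₃ a∣F₃) a∣G₃)))
        (only-∪ʳ (only-⊆ N₂.F₁⊆ id (sep-only (sep-sym (t∣D′ h₁₂)))) (only-map inj₂ N₂.o₁₃)))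
      (only-∪ˡ
        (only-∪ʳ (only-⊆ id t₁-F₃ (only-map base N₁.o₂₃)) (only-⊆ N₁.F₂⊆ id (only-∪ˡ
          (only-⊆ id N₂.F₃⊆ (sep-only (only-∪ʳ (D∣D′ h₁₂) (D∣t′ h₁₂)))) (only-⊆ w-G₂ id (only-map inj₂ N₂.o₂₃)))))
        (only-∪ʳ (only-⊆ N₂.F₂⊆ id (only-∪ˡ (sep-only (sep-sym (t∣D′ h₁₂))) (only-⊆ w-F₂ t₁-F₃ (only-map base N₁.o₂₃))))
          (only-map inj₂ N₂.o₂₃)))
      where
      base : ∀ {p q q′ u v} → u ≡ p × v ≡ N₁.z′ → Corner noPrism p q t₁ q′ u v
      base (e , e′) = inj₁ (e , trans e′ z′≡t₁)

      t₁-F₃ : Sing t₁ ⊆ N₁.F₃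
      t₁-F₃ refl = N₁.w′∈

      t₁∣G₃ : Only (λ _ _ → V) (Sing t₁) N₂.F₃
      t₁∣G₃ = only-⊆ id N₂.F₃⊆ (only-∪ʳ (sep-only (t∣D′ h₁₂)) (adj-only (~-irrefl (t~t′ h₁₂)) λ _ → t₁))

      -- The assumed nonadjacency enters here: the two corners could only coincide in `w`, which
      -- would then be adjacent to `z′`, that is, to `t₁`.
      z≢z₂ : N₁.z ≢ N₂.z
      z≢z₂ e with N₁.F₂⊆ N₁.z∈ | N₂.F₂⊆ N₂.z∈
      ... | inj₂ q | _ = w≁t₁ (subst₂ _~_ q z′≡t₁ N₁.z~z′)
      ... | inj₁ d | inj₁ d′ = apart (D∣D′ h₁₂) d d′ e
      ... | inj₁ d | inj₂ q = w∉D₁ (subst D₁ (trans e q) d)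

    absurd : ⊥
    absurd with N₁.z′ Finₚ.≟ t₁
    ... | yes e = near e
    ... | no ne = far ne

  -- Otherwise the nets joining ℓ₁, w, t₁ in D₁ and ℓ₂, w, t₂ in D₂ combine into a prism, with a on
  -- one of its paths; the triangle t₁ t₂ t₃ serves as its second base unless t₁ is a corner of the first net.
  both-near : ∀ {ℓ₁ ℓ₂ ℓ₃ D₁ D₂ D₃ t₁ t₂ t₃ w} (π : Thick ℓ₁ ℓ₂ ℓ₃ D₁ D₂ D₃ t₁ t₂ t₃) → Both D₁ D₂ D₃ w → w ~ t₁
  both-near {t₁ = t₁} {w = w} π β with w ~? t₁
  ... | yes e = e
  ... | no w≁t₁ = ⊥-elim (TwoNets.absurd π β w≁t₁ (BothFacts.net π β) (BothFacts.net (swap₁₂ π) (swap-both β)))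

  -- Vertices attached to one leg, and saturation of the legs

  record Lone (D₁ D₂ D₃ : Pred V 0ℓ) (w : V) : Set where
    no-eta-equality
    field
      w≢a : w ≢ a
      w∉D₁ : ¬ D₁ w
      w~D₁ : Touch D₁ w
      w≁D₂ : ¬ Touch D₂ w
      w≁D₃ : ¬ Touch D₃ w

  swap-lone : ∀ {D₁ D₂ D₃ w} → Lone D₁ D₂ D₃ w → Lone D₁ D₃ D₂ w
  swap-lone λ₁ = record { w≢a = w≢a ; w∉D₁ = w∉D₁ ; w~D₁ = w~D₁ ; w≁D₂ = w≁D₃ ; w≁D₃ = w≁D₂ }
    where open Lone λ₁

  module LoneFacts {ℓ₁ ℓ₂ ℓ₃ D₁ D₂ D₃ t₁ t₂ t₃ w} (π : Thick ℓ₁ ℓ₂ ℓ₃ D₁ D₂ D₃ t₁ t₂ t₃) (λ₁ : Lone D₁ D₂ D₃ w) where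
    open ThickFacts π public
    open Lone λ₁ public

    w∣D₂ : Sep (Sing w) D₂
    w∣D₂ = sing-sep (touch∉ (D∣D′ h₁₂) w~D₁) w≁D₂

    w∣D₃ : Sep (Sing w) D₃
    w∣D₃ = sing-sep (touch∉ (D∣D′ h₁₃) w~D₁) w≁D₃

    w≢t₂ : w ≢ t₂
    w≢t₂ = touch≢ (sep-sym (D∣t′ h₁₂)) w~D₁

    w≢t₃ : w ≢ t₃
    w≢t₃ = touch≢ (sep-sym (D∣t′ h₁₃)) w~D₁

    w≁a : w ~ t₂ → ¬ w ~ a
    w≁a e = two-nbrs leafy e (~-sym (proj₂ (proj₂ w~D₁))) (t≢a g₂)
      (λ q → a∉D g₁ (subst D₁ q (proj₁ (proj₂ w~D₁))))
      (λ q → apart (D∣t′ h₁₂) (proj₁ (proj₂ w~D₁)) refl (sym q))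

  -- Otherwise `t₂` is the centre of a claw with legs through `D₂`, through `t₃` and `D₃`, and
  -- through `w` and `D₁`.
  lone-forth : ∀ {ℓ₁ ℓ₂ ℓ₃ D₁ D₂ D₃ t₁ t₂ t₃ w} → Thick ℓ₁ ℓ₂ ℓ₃ D₁ D₂ D₃ t₁ t₂ t₃ → Lone D₁ D₂ D₃ w → w ~ t₂ → w ~ t₃
  lone-forth {D₁ = D₁} {D₂} {D₃} {t₂ = t₂} {t₃} {w} π λ₁ w~t₂ with w ~? t₃
  ... | yes e = e
  ... | no w≁t₃ = ⊥-elim (claw {t₂} {D₂} {E₃} {Sing w ∪ D₁} (t≢a g₂) (ThickFacts.t₁≁a (swap₁₂ π)) (t∉D g₂)
      (λ { (inj₁ e) → ~-irrefl (t~t′ h₂₃) e ; (inj₂ d) → apart (t∣D′ h₂₃) refl d refl })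
      (λ { (inj₁ e) → w≢t₂ (sym e) ; (inj₂ d) → apart (D∣t′ h₁₂) d refl refl })
      (a∉D g₂) a∉E₃ (λ { (inj₁ e) → w≢a (sym e) ; (inj₂ d) → a∉D g₁ d })
      (out g₂ (t~D g₂)) (out₃ (t~t′ h₂₃)) ((nil ▸ (~-sym w~t₂ , inj₁ refl)) ++ᵗ map-thru inj₂ (out g₁ w~D₁))
      D₂∣E₃ (only-∪ʳ (sep-sym w∣D₂) (sep-sym (D∣D′ h₁₂)))
      (only-∪ʳ (only-∪ˡ (adj-only (w≢t₃ ∘ sym) (w≁t₃ ∘ ~-sym)) (sep-sym w∣D₃)) (sep-sym D₁∣E₃)))
    where open LoneFacts π λ₁

  -- Lets `w` replace `t₁` in the base, so that statements about base vertices become statements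
  -- about lone vertices.
  rebase : ∀ {ℓ₁ ℓ₂ ℓ₃ D₁ D₂ D₃ t₁ t₂ t₃ w} → Thick ℓ₁ ℓ₂ ℓ₃ D₁ D₂ D₃ t₁ t₂ t₃ → Lone D₁ D₂ D₃ w → w ~ t₂ →
           Thick ℓ₁ ℓ₂ ℓ₃ D₁ D₂ D₃ w t₂ t₃
  rebase π λ₁ e = record
    { g₁ = record { a∉D = a∉D g₁ ; conn = conn g₁ ; ℓ∈D = ℓ∈D g₁ ; ℓ~a = ℓ~a g₁ ; t∉D = w∉D₁ ; t≢a = w≢a ; t~D = w~D₁ }
    ; g₂ = g₂ ; g₃ = g₃
    ; h₁₂ = record { D∣D′ = D∣D′ h₁₂ ; t∣D′ = w∣D₂ ; D∣t′ = D∣t′ h₁₂ ; t~t′ = e }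
    ; h₁₃ = record { D∣D′ = D∣D′ h₁₃ ; t∣D′ = w∣D₃ ; D∣t′ = D∣t′ h₁₃ ; t~t′ = lone-forth π λ₁ e }
    ; h₂₃ = h₂₃ }
    where open LoneFacts π λ₁

  -- Mentions base vertices only and not the sets `D`, so that the three legs can be enlarged
  -- independently.
  Safe : V → V → Pred V 0ℓ
  Safe t t′ x = x ≢ a × x ≢ t × x ≢ t′ × ¬ x ~ t × ¬ x ~ t′

  -- A safe vertex that touches `D₁` touches no other leg: by `both-near` it would be adjacent to
  -- the base vertex of that leg.
  grow : ∀ {ℓ₁ ℓ₂ ℓ₃ D₁ D₂ D₃ t₁ t₂ t₃ w} → Thick ℓ₁ ℓ₂ ℓ₃ D₁ D₂ D₃ t₁ t₂ t₃ → Touch D₁ w → Safe t₂ t₃ w →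
         Thick ℓ₁ ℓ₂ ℓ₃ (D₁ ∪ Sing w) D₂ D₃ t₁ t₂ t₃
  grow {D₁ = D₁} {D₂} {D₃} {t₁} {t₂} {t₃} {w} π w~D₁ (w≢a , w≢t₂ , w≢t₃ , w≁t₂ , w≁t₃) = record
    { g₁ = record
      { a∉D = λ { (inj₁ d) → a∉D g₁ d ; (inj₂ e) → w≢a (sym e) }
      ; conn = conn∪ ; ℓ∈D = inj₁ (ℓ∈D g₁) ; ℓ~a = ℓ~a g₁
      ; t∉D = λ { (inj₁ d) → t∉D g₁ d ; (inj₂ refl) → w≁t₂ (t~t′ h₁₂) } ; t≢a = t≢a g₁ ; t~D = map-touch inj₁ (t~D g₁) }
    ; g₂ = g₂ ; g₃ = g₃
    ; h₁₂ = record { D∣D′ = only-∪ˡ (D∣D′ h₁₂) (sing-sep w∉D₂ (λ w~D₂ → w≁t₂ (both-near (swap₁₂ π) (both w∉D₃ w∉D₂ (touch∉ (sep-sym (D∣D′ h₁₂)) w~D₂) w~D₂))))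
                   ; t∣D′ = t∣D′ h₁₂ ; D∣t′ = only-∪ˡ (D∣t′ h₁₂) (adj-only w≢t₂ w≁t₂) ; t~t′ = t~t′ h₁₂ }
    ; h₁₃ = record { D∣D′ = only-∪ˡ (D∣D′ h₁₃) (sing-sep w∉D₃ (λ w~D₃ → w≁t₃ (both-near (swap₁₂ (swap₂₃ π)) (both w∉D₂ w∉D₃ (touch∉ (sep-sym (D∣D′ h₁₃)) w~D₃) w~D₃))))
                   ; t∣D′ = t∣D′ h₁₃ ; D∣t′ = only-∪ˡ (D∣t′ h₁₃) (adj-only w≢t₃ w≁t₃) ; t~t′ = t~t′ h₁₃ }
    ; h₂₃ = h₂₃ }
    where
    open Thick π
    w∉D₂ : ¬ D₂ w
    w∉D₂ = touch∉ (D∣D′ h₁₂) w~D₁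
    w∉D₃ : ¬ D₃ w
    w∉D₃ = touch∉ (D∣D′ h₁₃) w~D₁
    both : ∀ {D D′} → ¬ D′ w → ¬ D w → ¬ D₁ w → Touch D w → Both D D₁ D′ w
    both p q r s = record { w≢a = w≢a ; w∉D₁ = q ; w∉D₂ = r ; w∉D₃ = p ; w~D₁ = s ; w~D₂ = w~D₁ }
    conn∪ : Conn (D₁ ∪ Sing w)
    conn∪ (inj₁ x) (inj₁ y) = map-walk inj₁ (conn g₁ x y)
    conn∪ (inj₂ refl) (inj₁ y) = map-walk inj₁ (enter (conn g₁) w~D₁ y)
    conn∪ (inj₁ x) (inj₂ refl) = map-walk inj₁ (conn g₁ x (proj₁ (proj₂ w~D₁))) ▸ (proj₂ (proj₂ w~D₁) , inj₂ refl)
    conn∪ (inj₂ refl) (inj₂ refl) = nil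

  grow-along : ∀ {ℓ₁ ℓ₂ ℓ₃ D₁ D₂ D₃ t₁ t₂ t₃ u v} → Thick ℓ₁ ℓ₂ ℓ₃ D₁ D₂ D₃ t₁ t₂ t₃ → D₁ u → Walk (Safe t₂ t₃) u v →
               Σ (Pred V 0ℓ) λ D → Thick ℓ₁ ℓ₂ ℓ₃ D D₂ D₃ t₁ t₂ t₃ × D₁ ⊆ D × D v
  grow-along {D₁ = D₁} π u∈ nil = D₁ , π , id , u∈
  grow-along π u∈ (p ▸ (e , s)) with grow-along π u∈ p
  ... | D , π′ , D₁⊆D , v∈ = _ , grow π′ (_ , v∈ , e) s , inj₁ ∘ D₁⊆D , inj₂ refl

  Closed : Pred V 0ℓ → V → V → Set
  Closed D t t′ = ∀ {w} → Touch D w → Safe t t′ w → D w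

  record Saturated (ℓ₁ ℓ₂ ℓ₃ : V) (D₁ D₂ D₃ : Pred V 0ℓ) (t₁ t₂ t₃ : V) : Set where
    no-eta-equality
    field
      thick : Thick ℓ₁ ℓ₂ ℓ₃ D₁ D₂ D₃ t₁ t₂ t₃
      c₁ : Closed D₁ t₂ t₃
      c₂ : Closed D₂ t₁ t₃
      c₃ : Closed D₃ t₁ t₂

  closed-sym : ∀ {D t t′} → Closed D t t′ → Closed D t′ t
  closed-sym c w~D (p , q , r , s , t) = c w~D (p , r , q , t , s)

  sat₁₂ : ∀ {ℓ₁ ℓ₂ ℓ₃ D₁ D₂ D₃ t₁ t₂ t₃} → Saturated ℓ₁ ℓ₂ ℓ₃ D₁ D₂ D₃ t₁ t₂ t₃ → Saturated ℓ₂ ℓ₁ ℓ₃ D₂ D₁ D₃ t₂ t₁ t₃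
  sat₁₂ σ = record { thick = swap₁₂ thick ; c₁ = c₂ ; c₂ = c₁ ; c₃ = closed-sym c₃ }
    where open Saturated σ

  sat₂₃ : ∀ {ℓ₁ ℓ₂ ℓ₃ D₁ D₂ D₃ t₁ t₂ t₃} → Saturated ℓ₁ ℓ₂ ℓ₃ D₁ D₂ D₃ t₁ t₂ t₃ → Saturated ℓ₁ ℓ₃ ℓ₂ D₁ D₃ D₂ t₁ t₃ t₂
  sat₂₃ σ = record { thick = swap₂₃ thick ; c₁ = closed-sym c₁ ; c₂ = c₃ ; c₃ = c₂ }
    where open Saturated σ

  -- The maximal legs are the components of the leaves among safe vertices. Their separation is
  -- checked pair by pair: growing one leg along a walk to `u`, then another along a walk to `v`,
  -- gives a thick pyramid that holds both vertices in different legs.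
  saturate : ∀ {ℓ₁ ℓ₂ ℓ₃ D₁ D₂ D₃ t₁ t₂ t₃} → Thick ℓ₁ ℓ₂ ℓ₃ D₁ D₂ D₃ t₁ t₂ t₃ →
             Saturated ℓ₁ ℓ₂ ℓ₃ (Walk (Safe t₂ t₃) ℓ₁) (Walk (Safe t₁ t₃) ℓ₂) (Walk (Safe t₁ t₂) ℓ₃) t₁ t₂ t₃
  saturate {ℓ₁} {ℓ₂} {ℓ₃} {D₁} {D₂} {D₃} {t₁} {t₂} {t₃} π = record
    { thick = record
      { g₁ = leg g₁ h₁₂ h₁₃ ; g₂ = leg g₂ (spread-sym h₁₂) h₂₃ ; g₃ = leg g₃ (spread-sym h₁₃) (spread-sym h₂₃)
      ; h₁₂ = record { D∣D′ = sep π ; t∣D′ = near g₂ (spread-sym h₁₂) h₂₃ ; D∣t′ = sep-sym (near g₁ h₁₂ h₁₃) ; t~t′ = t~t′ h₁₂ }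
      ; h₁₃ = record { D∣D′ = only λ p q → rel (sep (swap₂₃ π)) (map-walk safe-sym p) q
                     ; t∣D′ = near g₃ (spread-sym h₁₃) (spread-sym h₂₃) ; D∣t′ = sep-sym (only-⊆ id (map-walk safe-sym) (near g₁ h₁₃ h₁₂)) ; t~t′ = t~t′ h₁₃ }
      ; h₂₃ = record { D∣D′ = only λ p q → rel (sep (swap₂₃ (swap₁₂ π))) (map-walk safe-sym p) (map-walk safe-sym q)
                     ; t∣D′ = only-⊆ id (map-walk safe-sym) (near g₃ (spread-sym h₂₃) (spread-sym h₁₃))
                     ; D∣t′ = sep-sym (only-⊆ id (map-walk safe-sym) (near g₂ h₂₃ (spread-sym h₁₂))) ; t~t′ = t~t′ h₂₃ } }
    ; c₁ = closed ; c₂ = closed ; c₃ = closed }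
    where
    open Thick π

    safe-sym : ∀ {t t′} → Safe t t′ ⊆ Safe t′ t
    safe-sym (p , q , r , s , t) = p , r , q , t , s

    inside : ∀ {ℓ D t D′ t′ D″ t″} → Leg ℓ D t → Spread D t D′ t′ → Spread D t D″ t″ → D ⊆ Safe t′ t″
    inside g h h′ d = (λ { refl → a∉D g d }) , apart (D∣t′ h) d refl , apart (D∣t′ h′) d refl , edge-of (D∣t′ h) d refl , edge-of (D∣t′ h′) d refl

    safe : ∀ {ℓ D t D′ t′ D″ t″} → Leg ℓ D t → Spread D t D′ t′ → Spread D t D″ t″ → Walk (Safe t′ t″) ℓ ⊆ Safe t′ t″
    safe g h h′ = endpoint∈ (inside g h h′ (ℓ∈D g))

    near : ∀ {ℓ D t D′ t′ D″ t″} → Leg ℓ D t → Spread D t D′ t′ → Spread D t D″ t″ → Sep (Sing t′) (Walk (Safe t′ t″) ℓ)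
    near g h h′ = only λ { refl p → (proj₁ (proj₂ (safe g h h′ p)) ∘ sym) , (proj₁ (proj₂ (proj₂ (proj₂ (safe g h h′ p)))) ∘ ~-sym) }

    leg : ∀ {ℓ D t D′ t′ D″ t″} → Leg ℓ D t → Spread D t D′ t′ → Spread D t D″ t″ → Leg ℓ (Walk (Safe t′ t″) ℓ) t
    leg g h h′ = record
      { a∉D = λ p → proj₁ (safe g h h′ p) refl ; conn = reach-conn ; ℓ∈D = nil ; ℓ~a = ℓ~a g
      ; t∉D = λ p → proj₁ (proj₂ (proj₂ (proj₂ (safe g h h′ p)))) (t~t′ h) ; t≢a = t≢a g
      ; t~D = map-touch (λ d → map-walk (inside g h h′) (conn g (ℓ∈D g) d)) (t~D g) }

    closed : ∀ {t t′ ℓ} → Closed (Walk (Safe t t′) ℓ) t t′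
    closed (_ , p , e) s = p ▸ (e , s)

    sep : ∀ {ℓ₁ ℓ₂ ℓ₃ D₁ D₂ D₃ t₁ t₂ t₃} → Thick ℓ₁ ℓ₂ ℓ₃ D₁ D₂ D₃ t₁ t₂ t₃ → Sep (Walk (Safe t₂ t₃) ℓ₁) (Walk (Safe t₁ t₃) ℓ₂)
    sep π = only both
      where
      both : ∀ {u v} → Walk _ _ u → Walk _ _ v → u ≢ v × (u ~ v → ⊥)
      both p q with grow-along π (ℓ∈D (Thick.g₁ π)) p
      ... | _ , π′ , _ , u∈ with grow-along (swap₁₂ π′) (ℓ∈D (Thick.g₂ π)) q
      ... | _ , π″ , _ , v∈ = rel (sep-sym (D∣D′ (Thick.h₁₂ π″))) u∈ v∈

  -- Missing `t₂`, the vertex would miss `t₃` too by `lone-forth`; it would then be safe and already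
  -- in `D₁`.
  lone-near : ∀ {ℓ₁ ℓ₂ ℓ₃ D₁ D₂ D₃ t₁ t₂ t₃ w} → Saturated ℓ₁ ℓ₂ ℓ₃ D₁ D₂ D₃ t₁ t₂ t₃ → Lone D₁ D₂ D₃ w → w ~ t₂
  lone-near {t₂ = t₂} {t₃} {w} σ λ₁ with w ~? t₂
  ... | yes e = e
  ... | no w≁t₂ = ⊥-elim (w∉D₁ (c₁ w~D₁ (w≢a , w≢t₂ , w≢t₃ , w≁t₂ , w≁t₂ ∘ lone-forth (swap₂₃ thick) (swap-lone λ₁))))
    where
    open Saturated σ
    open LoneFacts thick λ₁

  -- The conclusion `⊥` lets members be used that are known only up to double negation.
  Clique : Pred V 0ℓ → Set
  Clique K = ∀ {u v} → K u → K v → u ≢ v → ¬ u ~ v → ⊥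

  module _ {ℓ₁ ℓ₂ ℓ₃ D₁ D₂ D₃ t₁ t₂ t₃} (σ : Saturated ℓ₁ ℓ₂ ℓ₃ D₁ D₂ D₃ t₁ t₂ t₃) where
    open Saturated σ
    open ThickFacts thick

    -- Once `u` has replaced `t₁`, `lone-forth` carries the adjacency of `v` from `t₃` over to `u`.
    lone-lone : ∀ {u v} → Lone D₁ D₂ D₃ u → Lone D₂ D₁ D₃ v → u ~ v
    lone-lone {u} {v} λ₁ λ₂ = ~-sym (lone-forth (swap₂₃ (swap₁₂ (rebase thick λ₁ (lone-near σ λ₁))))
                                (swap-lone λ₂) (lone-near (sat₂₃ (sat₁₂ σ)) (swap-lone λ₂)))

    both-lone : ∀ {u v} → Both D₁ D₂ D₃ u → Lone D₁ D₂ D₃ v → u ~ v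
    both-lone β λ₁ = both-near (rebase thick λ₁ (lone-near σ λ₁)) β

    -- By `lone-lone`, `x` and `x′` are both adjacent to `u` and to `u′`. If they were nonadjacent,
    -- `u` and `u′` would be the ends of a theta through `x`, `x′` and `D₁`.
    lone-cliques : ∀ {u u′} → Lone D₁ D₂ D₃ u → Lone D₁ D₂ D₃ u′ → u ≢ u′ → ¬ u ~ u′ → Clique (Lone D₂ D₁ D₃)
    lone-cliques {u} {u′} λ₁ λ₁′ u≢u′ u≁u′ {x} {x′} λ₂ λ₂′ x≢x′ x≁x′ =
      theta noTheta {u} {u′} {Sing x} {Sing x′} {D₁} u≢u′ u≁u′
        (~-irrefl (lone-lone λ₁ λ₂)) (~-irrefl (lone-lone λ₁ λ₂′)) (Lone.w∉D₁ λ₁)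
        (~-irrefl (lone-lone λ₁′ λ₂)) (~-irrefl (lone-lone λ₁′ λ₂′)) (Lone.w∉D₁ λ₁′)
        (via λ₂) (via λ₂′) (across (conn g₁) (Lone.w~D₁ λ₁) (Lone.w~D₁ λ₁′))
        (adj-only x≢x′ x≁x′) (LoneFacts.w∣D₂ (swap₁₂ thick) λ₂) (LoneFacts.w∣D₂ (swap₁₂ thick) λ₂′)
      where
      via : ∀ {x} → Lone D₂ D₁ D₃ x → Thru (Sing x) u u′
      via λ₂ = _ , nil ▸ (lone-lone λ₁ λ₂ , refl) , ~-sym (lone-lone λ₁′ λ₂)

    -- Two nonadjacent lone vertices would be common neighbours of `v` and `t₃`, which are joined a
    -- third time through `D₂`, `a` and `D₃`.
    both⇒lone-clique : ∀ {v} → Both D₁ D₂ D₃ v → Clique (Lone D₁ D₂ D₃)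
    both⇒lone-clique {v} β {u} {u′} λ₁ λ₁′ u≢u′ u≁u′ =
      theta noTheta {v} {t₃} {Sing u} {Sing u′} {(D₂ ∪ Sing a) ∪ D₃} v≢t₃ B.w≁t₃
        (~-irrefl (both-lone β λ₁)) (~-irrefl (both-lone β λ₁′))
        (λ { (inj₁ (inj₁ d)) → B.w∉D₂ d ; (inj₁ (inj₂ e)) → B.w≢a e ; (inj₂ d) → B.w∉D₃ d })
        (LoneFacts.w≢t₃ thick λ₁ ∘ sym) (LoneFacts.w≢t₃ thick λ₁′ ∘ sym)
        (λ { (inj₁ (inj₁ d)) → apart (D∣t′ h₂₃) d refl refl ; (inj₁ (inj₂ e)) → t≢a g₃ e ; (inj₂ d) → t∉D g₃ d })
        (via λ₁) (via λ₁′) round (adj-only u≢u′ u≁u′) (sep λ₁) (sep λ₁′)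
      where
      module B = BothFacts thick β
      v≢t₃ : v ≢ t₃
      v≢t₃ e = B.w∉E₃ (inj₁ e)
      near₃ : ∀ {u} → Lone D₁ D₂ D₃ u → u ~ t₃
      near₃ λ₁ = lone-near (sat₂₃ σ) (swap-lone λ₁)
      via : ∀ {u} → Lone D₁ D₂ D₃ u → Thru (Sing u) v t₃
      via λ₁ = _ , nil ▸ (both-lone β λ₁ , refl) , near₃ λ₁
      round : Thru ((D₂ ∪ Sing a) ∪ D₃) v t₃
      round = (map-walk (inj₁ ∘ inj₁) (enter (conn g₂) B.w~D₂ (ℓ∈D g₂)) ▸ (ℓ~a g₂ , inj₁ (inj₂ refl)) ▸ (~-sym (ℓ~a g₃) , inj₂ (ℓ∈D g₃)))
                ++ᵗ (_ , map-walk inj₂ (conn g₃ (ℓ∈D g₃) (proj₁ (proj₂ (t~D g₃)))) , proj₂ (proj₂ (t~D g₃)))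
      sep : ∀ {u} → Lone D₁ D₂ D₃ u → Sep (Sing u) ((D₂ ∪ Sing a) ∪ D₃)
      sep λ₁ = only-∪ʳ (only-∪ʳ L.w∣D₂ (adj-only L.w≢a (L.w≁a (lone-near σ λ₁)))) L.w∣D₃
        where module L = LoneFacts thick λ₁

  -- Cliques of doubly attached vertices, and exclusion between different pairs of legs

  record Tip (D : Pred V 0ℓ) (ℓ w w′ : V) : Set₁ where
    no-eta-equality
    field
      y : V
      F : Pred V 0ℓ
      F⊆ : F ⊆ D
      y∈ : F y
      y→ℓ : Walk F y ℓ
      y~w : y ~ w
      y~w′ : y ~ w′
      o : Only (λ u v → u ≡ y × v ≡ w) F (Sing w)
      o′ : Only (λ u v → u ≡ y × v ≡ w′) F (Sing w′)

  -- The only edge between the last two branches is `z z′`, so adjacency of `w` and `w′` forces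
  -- `w = z` and `w′ = z′`.
  tip : ∀ {D ℓ w w′} → Net D ℓ w w′ → w ~ w′ → Tip D ℓ w w′
  tip {w = w} {w′} N e = record
    { y = y ; F = F₁ ; F⊆ = F₁⊆ ; y∈ = y∈ ; y→ℓ = y→ℓ
    ; y~w = subst (y ~_) (sym w≡z) y~z ; y~w′ = subst (y ~_) (sym w′≡z′) y~z′
    ; o = only-map (λ { (p , q) → p , trans q (sym w≡z) }) (only-⊆ id (λ { refl → w∈ }) o₁₂)
    ; o′ = only-map (λ { (p , q) → p , trans q (sym w′≡z′) }) (only-⊆ id (λ { refl → w′∈ }) o₁₃) }
    where
    open Net N
    w≡z : w ≡ z
    w≡z = proj₁ (edge-of o₂₃ w∈ w′∈ e)
    w′≡z′ : w′ ≡ z′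
    w′≡z′ = proj₂ (edge-of o₂₃ w∈ w′∈ e)

  -- Turns a branch into a leg, with its tip cut off to become a base vertex.
  prune : ∀ {F y ℓ} → Walk F y ℓ → F y → y ≢ ℓ →
          Σ (Pred V 0ℓ) λ D → Conn D × D ℓ × D ⊆ F × ¬ D y × Touch D y
  prune {F} {y} {ℓ} p y∈ y≢ℓ with last-visit (Finₚ._≟ y) p y∈ refl
  ... | _ , _ , refl , q with first-step q
  ... | inj₁ e = ⊥-elim (y≢ℓ e)
  ... | inj₂ (x , e , s , r) = Walk S ℓ , reach-conn , nil , proj₁ ∘ inS , (λ d → proj₂ (inS d) refl) ,
                               x , reverse-walk s r , ~-sym e
    where
    S : Pred V 0ℓ
    S = F ∩ ∁ (Sing y)
    inS : Walk S ℓ ⊆ S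
    inS = endpoint∈ (endpoint∈ s r)

  module _ {ℓ₁ ℓ₂ ℓ₃ D₁ D₂ D₃ t₁ t₂ t₃} (π : Thick ℓ₁ ℓ₂ ℓ₃ D₁ D₂ D₃ t₁ t₂ t₃) where
    open ThickFacts π

    -- The tip `y` of the net that joins `ℓ₁`, `v` and `t₁` gives a second thick pyramid, with base
    -- `y v t₁` and legs `D`, `D₂` and `E₃`, where `D` is a part of `D₁`. Relative to it, `v′` is
    -- attached either to two legs or to `D₂` alone.
    both-clique : Clique (Both D₁ D₂ D₃)
    both-clique {v} {v′} β β′ v≢v′ v≁v′ = go (tip B.net (both-near π β))
      where
      module B = BothFacts π β
      module B′ = BothFacts π β′

      module _ (T : Tip D₁ ℓ₁ v t₁) where
        open Tip T

        y∈D₁ : D₁ y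
        y∈D₁ = F⊆ y∈

        y≢ℓ : y ≢ ℓ₁
        y≢ℓ e = two-nbrs leafy y~w y~w′ B.w≢a (t≢a g₁) B.w≢t₁ (subst (_~ a) (sym e) (ℓ~a g₁))

        conclude : (Σ (Pred V 0ℓ) λ D → Conn D × D ℓ₁ × D ⊆ F × ¬ D y × Touch D y) → ⊥
        conclude (D , connD , ℓ∈ , D⊆ , y∉D , y~D) = by-cases touching apart′
          where
          D⊆D₁ : D ⊆ D₁
          D⊆D₁ = F⊆ ∘ D⊆

          clear : ∀ {x} → Only (λ u v → u ≡ y × v ≡ x) F (Sing x) → Sep D (Sing x)
          clear o = only λ d x → apart o (D⊆ d) x , λ e → y∉D (subst D (proj₁ (edge-of o (D⊆ d) x e)) d)

          connE₃ : Conn E₃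
          connE₃ (inj₁ refl) (inj₁ refl) = nil
          connE₃ (inj₁ refl) (inj₂ d) = map-walk inj₂ (enter (conn g₃) (t~D g₃) d)
          connE₃ (inj₂ d) (inj₁ refl) = map-walk inj₂ (conn g₃ d (proj₁ (proj₂ (t~D g₃)))) ▸ (proj₂ (proj₂ (t~D g₃)) , inj₁ refl)
          connE₃ (inj₂ d) (inj₂ d′) = map-walk inj₂ (conn g₃ d d′)

          π′ : Thick ℓ₁ ℓ₂ ℓ₃ D D₂ E₃ y v t₁
          π′ = record
            { g₁ = record { a∉D = a∉D g₁ ∘ D⊆D₁ ; conn = connD ; ℓ∈D = ℓ∈ ; ℓ~a = ℓ~a g₁ ; t∉D = y∉D
                          ; t≢a = λ e → a∉D g₁ (subst D₁ e y∈D₁) ; t~D = y~D }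
            ; g₂ = record { a∉D = a∉D g₂ ; conn = conn g₂ ; ℓ∈D = ℓ∈D g₂ ; ℓ~a = ℓ~a g₂ ; t∉D = B.w∉D₂ ; t≢a = B.w≢a ; t~D = B.w~D₂ }
            ; g₃ = record { a∉D = a∉E₃ ; conn = connE₃ ; ℓ∈D = inj₂ (ℓ∈D g₃) ; ℓ~a = ℓ~a g₃
                          ; t∉D = λ { (inj₁ e) → B.t₁≢t₃ e ; (inj₂ d) → apart (t∣D′ h₁₃) refl d refl }
                          ; t≢a = t≢a g₁ ; t~D = t₃ , inj₁ refl , ~-sym (t~t′ h₁₃) }
            ; h₁₂ = record { D∣D′ = only-⊆ D⊆D₁ id (D∣D′ h₁₂) ; t∣D′ = only λ { refl d → rel (D∣D′ h₁₂) y∈D₁ d } ; D∣t′ = clear o ; t~t′ = y~w }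
            ; h₁₃ = record { D∣D′ = only-⊆ D⊆D₁ id D₁∣E₃ ; t∣D′ = only λ { refl d → rel D₁∣E₃ y∈D₁ d } ; D∣t′ = clear o′ ; t~t′ = y~w′ }
            ; h₂₃ = record { D∣D′ = D₂∣E₃ ; t∣D′ = B.w∣E₃ ; D∣t′ = sep-sym (t∣D′ h₁₂) ; t~t′ = both-near π β } }

          -- Attached to `D₂` and `D`, the vertex `v′` is adjacent to the new base vertex `v` by
          -- `both-near`.
          touching : Touch D v′ → ⊥
          touching v′~D = v≁v′ (~-sym (both-near (swap₁₂ π′) (record
            { w≢a = B′.w≢a ; w∉D₁ = B′.w∉D₂ ; w∉D₂ = B′.w∉D₁ ∘ D⊆D₁ ; w∉D₃ = B′.w∉E₃ ; w~D₁ = B′.w~D₂ ; w~D₂ = v′~D })))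

          -- Now `v′` is lone at `D₂`, so `lone-forth` carries its adjacency from `t₁` to `y`. Then
          -- `v` and `v′` are common neighbours of `y` and `t₂`, which are joined again through `D`,
          -- `a` and `E₃`.
          apart′ : ¬ Touch D v′ → ⊥
          apart′ v′≁D = theta noTheta {y} {t₂} {Sing v} {Sing v′} {(D ∪ Sing a) ∪ E₃}
            (apart (D∣t′ h₁₂) y∈D₁ refl) (edge-of (D∣t′ h₁₂) y∈D₁ refl)
            (~-irrefl y~w) (~-irrefl y~v′)
            (λ { (inj₁ (inj₁ d)) → y∉D d ; (inj₁ (inj₂ e)) → a∉D g₁ (subst D₁ e y∈D₁) ; (inj₂ x) → apart D₁∣E₃ y∈D₁ x refl })
            (B.w≢t₂ ∘ sym) (B′.w≢t₂ ∘ sym)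
            (λ { (inj₁ (inj₁ d)) → apart (D∣t′ h₁₂) (D⊆D₁ d) refl refl ; (inj₁ (inj₂ e)) → t≢a g₂ e
               ; (inj₂ (inj₁ e)) → ~-irrefl (t~t′ h₂₃) e ; (inj₂ (inj₂ d)) → apart (t∣D′ h₂₃) refl d refl })
            (v , nil ▸ (y~w , refl) , both-near (swap₁₂ π) (swap-both β))
            (v′ , nil ▸ (y~v′ , refl) , both-near (swap₁₂ π) (swap-both β′))
            ((map-walk (inj₁ ∘ inj₁) (enter connD y~D ℓ∈) ▸ (ℓ~a g₁ , inj₁ (inj₂ refl)) ▸ (~-sym (ℓ~a g₃) , inj₂ (inj₂ (ℓ∈D g₃))))
               ++ᵗ (t₃ , map-walk inj₂ (reverse-walk (inj₁ refl) t₃→ℓ) , ~-sym (t~t′ h₂₃)))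
            (adj-only v≢v′ v≁v′)
            (only-∪ʳ (only-∪ʳ (sep-sym (clear o)) (adj-only B.w≢a B.w≁a)) B.w∣E₃)
            (only-∪ʳ (only-∪ʳ (sing-sep (B′.w∉D₁ ∘ D⊆D₁) v′≁D) (adj-only B′.w≢a B′.w≁a)) B′.w∣E₃)
            where
            y~v′ : y ~ v′
            y~v′ = ~-sym (lone-forth (swap₂₃ (swap₁₂ π′)) (record
              { w≢a = B′.w≢a ; w∉D₁ = B′.w∉D₂ ; w~D₁ = B′.w~D₂
              ; w≁D₂ = λ { (_ , inj₁ refl , e) → B′.w≁t₃ (~-sym e) ; (_ , inj₂ d , e) → B′.w≁D₃ (_ , d , e) }
              ; w≁D₃ = v′≁D }) (both-near π β′))

        go : ⊥
        go = conclude (prune y→ℓ y∈ y≢ℓ)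

  module TwoBoths {ℓ₁ ℓ₂ ℓ₃ D₁ D₂ D₃ t₁ t₂ t₃ v u} (π : Thick ℓ₁ ℓ₂ ℓ₃ D₁ D₂ D₃ t₁ t₂ t₃)
                  (β : Both D₁ D₂ D₃ v) (γ : Both D₁ D₃ D₂ u) where
    open ThickFacts π
    module β = BothFacts π β
    module γ = BothFacts (swap₂₃ π) γ

    v≢u : v ≢ u
    v≢u e = γ.w≁D₃ (subst (Touch D₂) e β.w~D₂)

    net₁ : Net D₁ ℓ₁ v u
    net₁ = fork leafy (conn g₁) (a∉D g₁) (ℓ∈D g₁) (ℓ~a g₁) β.w≢a γ.w≢a β.w∉D₁ γ.w∉D₁ v≢u
             β.w~D₁ γ.w~D₁ (out g₂ β.w~D₂) (out g₃ γ.w~D₂) (a∉D g₂) (a∉D g₃)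
             (sep-sym (D∣D′ h₁₂)) (sep-sym (D∣D′ h₁₃)) (D∣D′ h₂₃)
             (sing-sep β.w∉D₃ β.w≁D₃) (sing-sep γ.w∉D₃ γ.w≁D₃) β.w∉D₂ γ.w∉D₂

    tip₂ : Tip D₂ ℓ₂ v t₂
    tip₂ = tip (BothFacts.net (swap₁₂ π) (swap-both β)) (both-near (swap₁₂ π) (swap-both β))

    t₂≁u : Sep (Sing t₂) (Sing u)
    t₂≁u = adj-only (λ e → γ.w∉E₃ (inj₁ (sym e))) (γ.w≁t₃ ∘ ~-sym)

    -- The bases are the triangle of the net and the triangle of `T.y`, `v`, `t₂`. The paths pass
    -- through `ℓ₁`, `a` and `ℓ₂`; along the branch of `v`; and through `u` and `t₃` to `t₂`.
    far : (N : Net D₁ ℓ₁ v u) → Tip D₂ ℓ₂ v t₂ → Net.z N ≢ v → ⊥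
    far N T z≢v = prism noPrism {E₁ = (N.F₁ ∪ Sing a) ∪ T.F} {E₂ = N.F₂} {E₃ = N.F₃ ∪ (Sing t₃ ∪ Sing t₂)}
      N.y~z N.y~z′ N.z~z′ T.y~w T.y~w′ (both-near (swap₁₂ π) (swap-both β))
      (apart (D∣D′ h₁₂) (N.F₁⊆ N.y∈) (T.F⊆ T.y∈)) z≢v
      (λ { refl → [ (λ d → apart (D∣t′ h₁₂) d refl refl) , (λ e → apart t₂≁u refl refl e) ]′ (N.F₃⊆ N.z′∈) })
      (inj₁ (inj₁ N.y∈)) N.z∈ (inj₁ N.z′∈)
      (map-walk (inj₁ ∘ inj₁) N.y→ℓ ++ʷ (nil ▸ (ℓ~a g₁ , inj₁ (inj₂ refl)) ▸ (~-sym (ℓ~a g₂) , inj₂ (endpoint∈ T.y∈ T.y→ℓ))) ++ʷ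
        map-walk inj₂ (reverse-walk T.y∈ T.y→ℓ))
      N.z→w
      (map-walk inj₁ N.z′→w′ ▸ (both-near (swap₁₂ (swap₂₃ π)) (swap-both γ) , inj₂ (inj₁ refl)) ▸ (~-sym (t~t′ h₂₃) , inj₂ (inj₂ refl)))
      (only-∪ˡ (only-∪ˡ (only-map inj₁ N.o₁₂) (sep-only N.a∣F₂))
        (only-⊆ id N.F₂⊆ (only-∪ʳ (sep-only (only-⊆ T.F⊆ id (sep-sym (D∣D′ h₁₂)))) (only-map inj₂ T.o))))
      (only-∪ˡ (only-∪ˡ
        (only-∪ʳ (only-map inj₁ N.o₁₃) (sep-only (only-⊆ N.F₁⊆ id (only-∪ʳ (D∣t′ h₁₃) (D∣t′ h₁₂)))))
        (sep-only (only-∪ʳ a∣F₃ (only-∪ʳ (adj-only (t≢a g₃ ∘ sym) (ThickFacts.t₁≁a (swap₁₂ (swap₂₃ π)) ∘ ~-sym))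
                                           (adj-only (t≢a g₂ ∘ sym) (ThickFacts.t₁≁a (swap₁₂ π) ∘ ~-sym))))))
        (only-⊆ T.F⊆′ id (only-∪ʳ (sep-only (only-⊆ proj₁ N.F₃⊆ (only-∪ʳ (sep-sym (D∣D′ h₁₂)) (sep-sym (sing-sep γ.w∉D₃ γ.w≁D₃)))))
          (only-∪ʳ (sep-only (only-⊆ proj₁ id (D∣t′ h₂₃))) (only-⊆ proj₂ id (only-map inj₂ T.o′))))))
      (only-∪ʳ (only-map inj₁ N.o₂₃) (only-⊆ N.F₂⊆ id (only-∪ʳ
        (sep-only (only-∪ˡ (D∣t′ h₁₃) (only-⊆ id inj₁ β.w∣E₃)))
        (only-∪ˡ (sep-only (D∣t′ h₁₂)) (adj-only β.w≢t₂ λ _ → inj₂ (refl , refl))))))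
      where
      module N = NetFacts N (a∉D g₁) β.w≢a β.w≁a
      module T where
        open Tip T public
        F⊆′ : F ⊆ D₂ ∩ F
        F⊆′ x = F⊆ x , x
      a∣F₃ : Sep (Sing a) N.F₃
      a∣F₃ = NetFacts.a∣F₂ (flip-net N) (a∉D g₁) γ.w≢a γ.w≁a

  module _ {ℓ₁ ℓ₂ ℓ₃ D₁ D₂ D₃ t₁ t₂ t₃ v u} (π : Thick ℓ₁ ℓ₂ ℓ₃ D₁ D₂ D₃ t₁ t₂ t₃)
           (β : Both D₁ D₂ D₃ v) (γ : Both D₁ D₃ D₂ u) where
    open ThickFacts π

    private
      module β = TwoBoths π β γ
      module γ = TwoBoths (swap₂₃ π) γ β

      -- The two tips supply the bases. The edges `v u` and `t₂ t₃` are two of the paths, and the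
      -- third goes through `ℓ₂`, `a` and `ℓ₃`.
      middle : Tip D₂ ℓ₂ v t₂ → Tip D₃ ℓ₃ u t₃ → v ~ u → ⊥
      middle T T′ v~u = prism noPrism {E₁ = (T.F ∪ Sing a) ∪ T′.F} {E₂ = Sing v ∪ Sing u} {E₃ = Sing t₂ ∪ Sing t₃}
        T.y~w T.y~w′ (both-near (swap₁₂ π) (swap-both β)) T′.y~w T′.y~w′ (both-near (swap₁₂ (swap₂₃ π)) (swap-both γ))
        (apart (D∣D′ h₂₃) (T.F⊆ T.y∈) (T′.F⊆ T′.y∈)) β.v≢u (~-irrefl (t~t′ h₂₃))
        (inj₁ (inj₁ T.y∈)) (inj₁ refl) (inj₁ refl)
        (map-walk (inj₁ ∘ inj₁) T.y→ℓ ++ʷ (nil ▸ (ℓ~a g₂ , inj₁ (inj₂ refl)) ▸ (~-sym (ℓ~a g₃) , inj₂ (endpoint∈ T′.y∈ T′.y→ℓ))) ++ʷ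
          map-walk inj₂ (reverse-walk T′.y∈ T′.y→ℓ))
        (nil ▸ (v~u , inj₂ refl)) (nil ▸ (t~t′ h₂₃ , inj₂ refl))
        (only-∪ˡ (only-∪ˡ
          (only-∪ʳ (only-map inj₁ T.o) (sep-only (only-⊆ T.F⊆ id (sep-sym (sing-sep γ.β.w∉D₃ γ.β.w≁D₃)))))
          (sep-only (only-∪ʳ (adj-only (β.β.w≢a ∘ sym) (β.β.w≁a ∘ ~-sym)) (adj-only (γ.β.w≢a ∘ sym) (γ.β.w≁a ∘ ~-sym)))))
          (only-∪ʳ (sep-only (only-⊆ T′.F⊆ id (sep-sym (sing-sep β.β.w∉D₃ β.β.w≁D₃)))) (only-map inj₂ T′.o)))
        (only-∪ˡ (only-∪ˡ
          (only-∪ʳ (only-map inj₁ T.o′) (sep-only (only-⊆ T.F⊆ id (D∣t′ h₂₃))))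
          (sep-only (only-∪ʳ (adj-only (t≢a g₂ ∘ sym) (ThickFacts.t₁≁a (swap₁₂ π) ∘ ~-sym))
                             (adj-only (t≢a g₃ ∘ sym) (ThickFacts.t₁≁a (swap₁₂ (swap₂₃ π)) ∘ ~-sym)))))
          (only-∪ʳ (sep-only (only-⊆ T′.F⊆ id (sep-sym (t∣D′ h₂₃)))) (only-map inj₂ T′.o′)))
        (only-∪ˡ
          (only-∪ʳ (adj-only β.β.w≢t₂ λ _ → inj₁ (refl , refl)) (sep-only (only-⊆ id inj₁ β.β.w∣E₃)))
          (only-∪ʳ (sep-only (sep-sym β.t₂≁u)) (adj-only γ.β.w≢t₂ λ _ → inj₂ (refl , refl))))
        where
        module T = Tip T
        module T′ = Tip T′

    no-two-boths : ⊥
    no-two-boths = go β.net₁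
      where
      go : Net D₁ ℓ₁ v u → ⊥
      go N with Net.z N Finₚ.≟ v | Net.z′ N Finₚ.≟ u
      ... | no z≢v | _ = β.far N β.tip₂ z≢v
      ... | _ | no z′≢u = γ.far (flip-net N) γ.tip₂ z′≢u
      ... | yes p | yes q = middle β.tip₂ γ.tip₂ (subst₂ _~_ p q (Net.z~z′ N))

  -- A clique whose removal from G ∖ a leaves ℓ₁, ℓ₂, ℓ₃ in three different components.
  record Split (ℓ₁ ℓ₂ ℓ₃ : V) : Set₁ where
    no-eta-equality
    field
      C₁ C₂ C₃ K : Pred V 0ℓ
      conn₁ : Conn C₁
      conn₂ : Conn C₂
      conn₃ : Conn C₃
      ℓ∈₁ : C₁ ℓ₁
      ℓ∈₂ : C₂ ℓ₂
      ℓ∈₃ : C₃ ℓ₃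
      a∉₁ : ¬ C₁ a
      a∉₂ : ¬ C₂ a
      a∉₃ : ¬ C₃ a
      s₁₂ : Sep C₁ C₂
      s₁₃ : Sep C₁ C₃
      s₂₃ : Sep C₂ C₃
      K-clique : Clique K
      out₁ : ∀ {v} → K v → ¬ C₁ v
      out₂ : ∀ {v} → K v → ¬ C₂ v
      out₃ : ∀ {v} → K v → ¬ C₃ v
      bd₁ : ∀ {v} → v ≢ a → ¬ C₁ v → Touch C₁ v → ¬ ¬ K v
      bd₂ : ∀ {v} → v ≢ a → ¬ C₂ v → Touch C₂ v → ¬ ¬ K v
      bd₃ : ∀ {v} → v ≢ a → ¬ C₃ v → Touch C₃ v → ¬ ¬ K v

  split₁₂ : ∀ {ℓ₁ ℓ₂ ℓ₃} → Split ℓ₁ ℓ₂ ℓ₃ → Split ℓ₂ ℓ₁ ℓ₃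
  split₁₂ S = record
    { C₁ = C₂ ; C₂ = C₁ ; C₃ = C₃ ; K = K ; conn₁ = conn₂ ; conn₂ = conn₁ ; conn₃ = conn₃
    ; ℓ∈₁ = ℓ∈₂ ; ℓ∈₂ = ℓ∈₁ ; ℓ∈₃ = ℓ∈₃ ; a∉₁ = a∉₂ ; a∉₂ = a∉₁ ; a∉₃ = a∉₃
    ; s₁₂ = sep-sym s₁₂ ; s₁₃ = s₂₃ ; s₂₃ = s₁₃ ; K-clique = K-clique
    ; out₁ = out₂ ; out₂ = out₁ ; out₃ = out₃ ; bd₁ = bd₂ ; bd₂ = bd₁ ; bd₃ = bd₃ }
    where open Split S

  split₂₃ : ∀ {ℓ₁ ℓ₂ ℓ₃} → Split ℓ₁ ℓ₂ ℓ₃ → Split ℓ₁ ℓ₃ ℓ₂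
  split₂₃ S = record
    { C₁ = C₁ ; C₂ = C₃ ; C₃ = C₂ ; K = K ; conn₁ = conn₁ ; conn₂ = conn₃ ; conn₃ = conn₂
    ; ℓ∈₁ = ℓ∈₁ ; ℓ∈₂ = ℓ∈₃ ; ℓ∈₃ = ℓ∈₂ ; a∉₁ = a∉₁ ; a∉₂ = a∉₃ ; a∉₃ = a∉₂
    ; s₁₂ = s₁₃ ; s₁₃ = s₁₂ ; s₂₃ = sep-sym s₂₃ ; K-clique = K-clique
    ; out₁ = out₁ ; out₂ = out₃ ; out₃ = out₂ ; bd₁ = bd₁ ; bd₂ = bd₃ ; bd₃ = bd₂ }
    where open Split S

  module _ {ℓ₁ ℓ₂ ℓ₃ D₁ D₂ D₃ t₁ t₂ t₃} (π : Thick ℓ₁ ℓ₂ ℓ₃ D₁ D₂ D₃ t₁ t₂ t₃) where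
    open ThickFacts π

    Boundary₁₂ : Pred V 0ℓ
    Boundary₁₂ v = v ≢ a × ¬ D₁ v × ¬ D₂ v × (Touch D₁ v ⊎ Touch D₂ v)

    -- `D₃` may have neighbours outside the boundary of the other two legs, so it gives way to the
    -- whole component of `ℓ₃` that remains when `a` and this boundary are removed.
    split-at : Clique Boundary₁₂ → Split ℓ₁ ℓ₂ ℓ₃
    split-at cl = record
      { C₁ = D₁ ; C₂ = D₂ ; C₃ = C ; K = Boundary₁₂ ; conn₁ = conn g₁ ; conn₂ = conn g₂ ; conn₃ = reach-conn
      ; ℓ∈₁ = ℓ∈D g₁ ; ℓ∈₂ = ℓ∈D g₂ ; ℓ∈₃ = nil ; a∉₁ = a∉D g₁ ; a∉₂ = a∉D g₂ ; a∉₃ = λ p → proj₁ (C-spec p) refl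
      ; s₁₂ = D∣D′ h₁₂ ; s₁₃ = sep-sym (only λ p d → c-sep p (proj₁ (proj₂ (proj₂ (C-spec p)))) inj₁ d)
      ; s₂₃ = sep-sym (only λ p d → c-sep p (proj₂ (proj₂ (proj₂ (C-spec p)))) inj₂ d) ; K-clique = cl
      ; out₁ = λ k → proj₁ (proj₂ k) ; out₂ = λ k → proj₁ (proj₂ (proj₂ k)) ; out₃ = λ k p → proj₁ (proj₂ (C-spec p)) k
      ; bd₁ = λ v≢a v∉ t ¬k → ¬k (v≢a , v∉ , touch∉ (D∣D′ h₁₂) t , inj₁ t)
      ; bd₂ = λ v≢a v∉ t ¬k → ¬k (v≢a , touch∉ (sep-sym (D∣D′ h₁₂)) t , v∉ , inj₂ t)
      ; bd₃ = λ { v≢a v∉ (u , p , e) ¬k → v∉ (p ▸ (e , v≢a , ¬k)) } }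
      where
      C : Pred V 0ℓ
      C = Walk (λ x → x ≢ a × ¬ Boundary₁₂ x) ℓ₃

      C-spec : ∀ {v} → C v → v ≢ a × ¬ Boundary₁₂ v × ¬ D₁ v × ¬ D₂ v
      C-spec nil = (λ { refl → a∉D g₃ (ℓ∈D g₃) }) ,
        (λ { (_ , _ , _ , inj₁ t) → touch∉ (D∣D′ h₁₃) t (ℓ∈D g₃) ; (_ , _ , _ , inj₂ t) → touch∉ (D∣D′ h₂₃) t (ℓ∈D g₃) }) ,
        (λ d → apart (D∣D′ h₁₃) d (ℓ∈D g₃) refl) , λ d → apart (D∣D′ h₂₃) d (ℓ∈D g₃) refl
      C-spec (p ▸ (e , v≢a , ¬k)) with C-spec p
      ... | u≢a , ¬k′ , u∉₁ , u∉₂ = v≢a , ¬k ,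
        (λ d → ¬k′ (u≢a , u∉₁ , u∉₂ , inj₁ (_ , d , ~-sym e))) , λ d → ¬k′ (u≢a , u∉₁ , u∉₂ , inj₂ (_ , d , ~-sym e))

      c-sep : ∀ {D u v} → C u → ¬ D u → (Touch D u → Touch D₁ u ⊎ Touch D₂ u) → D v → u ≢ v × (u ~ v → ⊥)
      c-sep p u∉ f d with C-spec p
      ... | u≢a , ¬k , u∉₁ , u∉₂ = (λ { refl → u∉ d }) , λ e → ¬k (u≢a , u∉₁ , u∉₂ , f (_ , d , ~-sym e))

  module _ {ℓ₁ ℓ₂ ℓ₃ D₁ D₂ D₃ t₁ t₂ t₃} (σ : Saturated ℓ₁ ℓ₂ ℓ₃ D₁ D₂ D₃ t₁ t₂ t₃) where
    open Saturated σ
    open ThickFacts thick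

    private
      Class : Pred V 0ℓ
      Class v = Lone D₁ D₂ D₃ v ⊎ Lone D₂ D₁ D₃ v ⊎ Both D₁ D₂ D₃ v

      classify : (∀ {v} → Both D₁ D₃ D₂ v → ⊥) → (∀ {v} → Both D₂ D₃ D₁ v → ⊥) →
                 ∀ {v} → Boundary₁₂ thick v → (Class v → ⊥) → ⊥
      classify no₁₃ no₂₃ {v} (v≢a , v∉₁ , v∉₂ , t) k = by-cases (λ t₁ → by-cases (both t₁) (lone₁ t₁)) (λ ¬t₁ → lone₂ ¬t₁ ([ ⊥-elim ∘ ¬t₁ , id ]′ t))
        where
        both : Touch D₁ v → Touch D₂ v → ⊥
        both t t′ = k (inj₂ (inj₂ record { w≢a = v≢a ; w∉D₁ = v∉₁ ; w∉D₂ = v∉₂ ; w∉D₃ = touch∉ (D∣D′ h₁₃) t ; w~D₁ = t ; w~D₂ = t′ }))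
        lone₁ : Touch D₁ v → ¬ Touch D₂ v → ⊥
        lone₁ t ¬t′ = k (inj₁ record { w≢a = v≢a ; w∉D₁ = v∉₁ ; w~D₁ = t ; w≁D₂ = ¬t′ ; w≁D₃ = λ t″ → no₁₃ record
          { w≢a = v≢a ; w∉D₁ = v∉₁ ; w∉D₂ = touch∉ (D∣D′ h₁₃) t ; w∉D₃ = v∉₂ ; w~D₁ = t ; w~D₂ = t″ } })
        lone₂ : ¬ Touch D₁ v → Touch D₂ v → ⊥
        lone₂ ¬t t′ = k (inj₂ (inj₁ record { w≢a = v≢a ; w∉D₁ = v∉₂ ; w~D₁ = t′ ; w≁D₂ = ¬t ; w≁D₃ = λ t″ → no₂₃ record
          { w≢a = v≢a ; w∉D₁ = v∉₂ ; w∉D₂ = touch∉ (D∣D′ h₂₃) t′ ; w∉D₃ = v∉₁ ; w~D₁ = t′ ; w~D₂ = t″ } }))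

    -- Every boundary vertex is lone at `D₁`, lone at `D₂` or attached to both, and different
    -- classes are complete to each other; it remains that each class is a clique.
    split-node : (∀ {v} → Both D₁ D₃ D₂ v → ⊥) → (∀ {v} → Both D₂ D₃ D₁ v → ⊥) →
                 Clique (Lone D₁ D₂ D₃) → Clique (Lone D₂ D₁ D₃) → Split ℓ₁ ℓ₂ ℓ₃
    split-node no₁₃ no₂₃ cl₁ cl₂ = split-at thick λ k k′ u≢v u≁v →
      classify no₁₃ no₂₃ k λ c → classify no₁₃ no₂₃ k′ λ c′ → pair u≢v u≁v c c′
      where
      pair : ∀ {u v} → u ≢ v → ¬ u ~ v → Class u → Class v → ⊥
      pair ne na (inj₁ p) (inj₁ q) = cl₁ p q ne na
      pair ne na (inj₁ p) (inj₂ (inj₁ q)) = na (lone-lone σ p q)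
      pair ne na (inj₁ p) (inj₂ (inj₂ q)) = na (~-sym (both-lone σ q p))
      pair ne na (inj₂ (inj₁ p)) (inj₁ q) = na (~-sym (lone-lone σ q p))
      pair ne na (inj₂ (inj₁ p)) (inj₂ (inj₁ q)) = cl₂ p q ne na
      pair ne na (inj₂ (inj₁ p)) (inj₂ (inj₂ q)) = na (~-sym (both-lone (sat₁₂ σ) (swap-both q) p))
      pair ne na (inj₂ (inj₂ p)) (inj₁ q) = na (both-lone σ p q)
      pair ne na (inj₂ (inj₂ p)) (inj₂ (inj₁ q)) = na (both-lone (sat₁₂ σ) (swap-both p) q)
      pair ne na (inj₂ (inj₂ p)) (inj₂ (inj₂ q)) = both-clique thick p q ne na

    both⇒split : ∀ {v} → Both D₁ D₂ D₃ v → Split ℓ₁ ℓ₂ ℓ₃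
    both⇒split β = split-node (no-two-boths thick β) (no-two-boths (swap₁₂ thick) (swap-both β))
                     (both⇒lone-clique σ β) (both⇒lone-clique (sat₁₂ σ) (swap-both β))

  -- A vertex attached to two legs settles the choice of these legs. Without one, `lone-cliques`
  -- leaves at most one lone class that is not a clique, and the other two legs are chosen.
  saturated⇒split : ∀ {ℓ₁ ℓ₂ ℓ₃ D₁ D₂ D₃ t₁ t₂ t₃} → Saturated ℓ₁ ℓ₂ ℓ₃ D₁ D₂ D₃ t₁ t₂ t₃ → ¬ ¬ Split ℓ₁ ℓ₂ ℓ₃
  saturated⇒split {ℓ₁} {ℓ₂} {ℓ₃} {D₁} {D₂} {D₃} σ k =
    by-cases {∃ (Both D₁ D₂ D₃)} (λ { (_ , β) → k (both⇒split σ β) }) λ no₁₂ →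
    by-cases {∃ (Both D₁ D₃ D₂)} (λ { (_ , β) → k (split₂₃ (both⇒split (sat₂₃ σ) β)) }) λ no₁₃ →
    by-cases {∃ (Both D₂ D₃ D₁)} (λ { (_ , β) → k (split₁₂ (split₂₃ (both⇒split (sat₂₃ (sat₁₂ σ)) β))) }) λ no₂₃ →
    by-cases {Clique (Lone D₁ D₂ D₃)}
      (λ cl₁ → by-cases {Clique (Lone D₂ D₁ D₃)}
        (λ cl₂ → k (split-node σ (λ β → no₁₃ (_ , β)) (λ β → no₂₃ (_ , β)) cl₁ cl₂))
        (λ ncl₂ → k (split₂₃ (split-node (sat₂₃ σ) (λ β → no₁₂ (_ , β)) (λ β → no₂₃ (_ , swap-both β)) (λ p q → cl₁ (swap-lone p) (swap-lone q))
          λ p q ne na → ncl₂ λ r s ne′ na′ → lone-cliques (sat₂₃ (sat₁₂ σ)) (swap-lone r) (swap-lone s) ne′ na′ (swap-lone p) (swap-lone q) ne na))))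
      (λ ncl₁ → k (split₁₂ (split₂₃ (split-node (sat₂₃ (sat₁₂ σ)) (λ β → no₁₂ (_ , swap-both β)) (λ β → no₁₃ (_ , swap-both β))
        (λ p q ne na → ncl₁ λ r s ne′ na′ → lone-cliques σ r s ne′ na′ (swap-lone p) (swap-lone q) ne na)
        (λ p q ne na → ncl₁ λ r s ne′ na′ → lone-cliques (sat₂₃ σ) (swap-lone r) (swap-lone s) ne′ na′ (swap-lone p) (swap-lone q) ne na)))))

  avoid-tips : ∀ {F F′ D D′ : Pred V 0ℓ} {y z} → Only (λ u v → u ≡ y × v ≡ z) F F′ → D ⊆ F → ¬ D y → D′ ⊆ F′ → ¬ D′ z →
               F y → F′ z → y ~ z → Spread D y D′ z
  avoid-tips {D = D} {D′} o D⊆ y∉ D′⊆ z∉ y∈ z∈ y~z = record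
    { D∣D′ = only λ d d′ → apart o (D⊆ d) (D′⊆ d′) , λ e → y∉ (subst D (proj₁ (edge-of o (D⊆ d) (D′⊆ d′) e)) d)
    ; t∣D′ = only λ { refl d′ → apart o y∈ (D′⊆ d′) , λ e → z∉ (subst D′ (proj₂ (edge-of o y∈ (D′⊆ d′) e)) d′) }
    ; D∣t′ = only λ { d refl → apart o (D⊆ d) z∈ , λ e → y∉ (subst D (proj₁ (edge-of o (D⊆ d) z∈ e)) d) }
    ; t~t′ = y~z }

  -- A leaf has only one neighbour besides `a`, so no corner of the net is a leaf. The corners can
  -- therefore be pruned from the branches to form the base of a thick pyramid.
  net⇒split : ∀ {D ℓ₁ ℓ₂ ℓ₃} → Net D ℓ₁ ℓ₂ ℓ₃ → ¬ D a → ℓ₂ ≢ a → ℓ₃ ≢ a → ℓ₁ ~ a → ℓ₂ ~ a → ℓ₃ ~ a → ¬ ¬ Split ℓ₁ ℓ₂ ℓ₃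
  net⇒split {D} {ℓ₁} {ℓ₂} {ℓ₃} N a∉ ℓ₂≢a ℓ₃≢a e₁ e₂ e₃ =
    go (prune y→ℓ y∈ (branching e₁ y~z y~z′ z≢a z′≢a (~-irrefl z~z′)))
       (prune z→w z∈ (branching e₂ (~-sym y~z) z~z′ y≢a z′≢a (~-irrefl y~z′)))
       (prune z′→w′ z′∈ (branching e₃ (~-sym y~z′) (~-sym z~z′) y≢a z≢a (~-irrefl y~z)))
    where
    open Net N
    y≢a : y ≢ a
    y≢a e = a∉ (subst D e (F₁⊆ y∈))
    z≢a : z ≢ a
    z≢a e = avoids {D} a∉ ℓ₂≢a (subst (D ∪ Sing ℓ₂) e (F₂⊆ z∈))
    z′≢a : z′ ≢ a
    z′≢a e = avoids {D} a∉ ℓ₃≢a (subst (D ∪ Sing ℓ₃) e (F₃⊆ z′∈))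
    branching : ∀ {x u v ℓ} → ℓ ~ a → x ~ u → x ~ v → u ≢ a → v ≢ a → u ≢ v → x ≢ ℓ
    branching ℓ~a p q u≢a v≢a u≢v refl = two-nbrs leafy p q u≢a v≢a u≢v ℓ~a
    go : (Σ (Pred V 0ℓ) λ D → Conn D × D ℓ₁ × D ⊆ F₁ × ¬ D y × Touch D y) →
         (Σ (Pred V 0ℓ) λ D → Conn D × D ℓ₂ × D ⊆ F₂ × ¬ D z × Touch D z) →
         (Σ (Pred V 0ℓ) λ D → Conn D × D ℓ₃ × D ⊆ F₃ × ¬ D z′ × Touch D z′) → ¬ ¬ Split ℓ₁ ℓ₂ ℓ₃
    go (D₁ , conn₁ , m₁ , D₁⊆ , y∉ , y~D) (D₂ , conn₂ , m₂ , D₂⊆ , z∉ , z~D) (D₃ , conn₃ , m₃ , D₃⊆ , z′∉ , z′~D) =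
      saturated⇒split (saturate {t₁ = y} {z} {z′} record
        { g₁ = record { a∉D = a∉ ∘ F₁⊆ ∘ D₁⊆ ; conn = conn₁ ; ℓ∈D = m₁ ; ℓ~a = e₁ ; t∉D = y∉ ; t≢a = y≢a ; t~D = y~D }
        ; g₂ = record { a∉D = avoids {D} a∉ ℓ₂≢a ∘ F₂⊆ ∘ D₂⊆ ; conn = conn₂ ; ℓ∈D = m₂ ; ℓ~a = e₂ ; t∉D = z∉ ; t≢a = z≢a ; t~D = z~D }
        ; g₃ = record { a∉D = avoids {D} a∉ ℓ₃≢a ∘ F₃⊆ ∘ D₃⊆ ; conn = conn₃ ; ℓ∈D = m₃ ; ℓ~a = e₃ ; t∉D = z′∉ ; t≢a = z′≢a ; t~D = z′~D }
        ; h₁₂ = avoid-tips o₁₂ D₁⊆ y∉ D₂⊆ z∉ y∈ z∈ y~z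
        ; h₁₃ = avoid-tips o₁₃ D₁⊆ y∉ D₃⊆ z′∉ y∈ z′∈ y~z′
        ; h₂₃ = avoid-tips o₂₃ D₂⊆ z∉ D₃⊆ z′∉ z∈ z′∈ z~z′ })

  Reach : V → V → V → Pred V 0ℓ
  Reach ℓ₁ ℓ₂ ℓ₃ = Walk (λ x → x ≢ a × x ≢ ℓ₂ × x ≢ ℓ₃) ℓ₁

  leaves⇒split : ∀ {ℓ₁ ℓ₂ ℓ₃} → ℓ₁ ≢ ℓ₂ → ℓ₁ ≢ ℓ₃ → ℓ₂ ≢ ℓ₃ → ℓ₁ ~ a → ℓ₂ ~ a → ℓ₃ ~ a →
                 Touch (Reach ℓ₁ ℓ₂ ℓ₃) ℓ₂ → Touch (Reach ℓ₁ ℓ₂ ℓ₃) ℓ₃ → ¬ ¬ Split ℓ₁ ℓ₂ ℓ₃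
  leaves⇒split {ℓ₁} {ℓ₂} {ℓ₃} n₁₂ n₁₃ n₂₃ e₁ e₂ e₃ t₂ t₃ = net⇒split N a∉ (~-irrefl e₂) (~-irrefl e₃) e₁ e₂ e₃
    where
    D : Pred V 0ℓ
    D = Reach ℓ₁ ℓ₂ ℓ₃
    spec : D ⊆ λ x → x ≢ a × x ≢ ℓ₂ × x ≢ ℓ₃
    spec = endpoint∈ (~-irrefl e₁ , n₁₂ , n₁₃)
    a∉ : ¬ D a
    a∉ d = proj₁ (spec d) refl
    N : Net D ℓ₁ ℓ₂ ℓ₃
    -- `ℓ₂` and `ℓ₃` are adjacent to `a` themselves, so the tails are empty.
    N = fork leafy {B = ∅} {∅} reach-conn a∉ nil e₁ (~-irrefl e₂) (~-irrefl e₃) (λ d → proj₁ (proj₂ (spec d)) refl) (λ d → proj₂ (proj₂ (spec d)) refl) n₂₃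
          t₂ t₃ (_ , nil , e₂) (_ , nil , e₃) (λ ()) (λ ()) (only λ ()) (only λ ()) (only λ ()) (only λ _ ()) (only λ _ ()) (λ ()) (λ ())

-- Hulls: maximal sets around a leaf that a clique cuts off from b

-- Over a finite type every predicate may be assumed decidable under a double negation. This brings
-- arbitrary good sets into the range of `Hull`.
comprehension : ∀ {n} (P : Fin n → Set) → ¬ ¬ (Σ (Fin n → Bool) λ X → ∀ v → (X v ≡ true → P v) × (P v → X v ≡ true))
comprehension {zero} P k = k ((λ ()) , λ ())
comprehension {suc n} P k = comprehension (P ∘ Fin.suc) λ { (X , spec) → by-cases
  (λ p → k ((λ { Fin.zero → true ; (Fin.suc i) → X i }) , λ { Fin.zero → (λ _ → p) , (λ _ → refl) ; (Fin.suc i) → spec i }))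
  (λ ¬p → k ((λ { Fin.zero → false ; (Fin.suc i) → X i }) , λ { Fin.zero → (λ ()) , (λ p → ⊥-elim (¬p p)) ; (Fin.suc i) → spec i })) }

module Hulls {n : ℕ} (G : Graph n) (a : Fin n) (noTheta : ¬ HasTheta G) (noPrism : ¬ HasPrism G)
             (leafy : Apex.Leafy G a noTheta) (b : Fin n) (b≢a : b ≢ a) (b≁a : ¬ Adj G b a) where

  open Pyramid G a noTheta noPrism leafy public

  ∂ : Pred V 0ℓ → Pred V 0ℓ
  ∂ X v = v ≢ a × ¬ X v × Touch X v

  record Good (ℓ : V) (X : Pred V 0ℓ) : Set where
    no-eta-equality
    field
      conn : Conn X
      ℓ∈X : X ℓ
      a∉X : ¬ X a
      b∉X : ¬ X b
      b≁X : ¬ Touch X b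
      ∂-clique : Clique (∂ X)

  open Good

  -- How connectedness is used: a connected set that starts in `C` and never crosses the boundary of
  -- `C` lies in `C`.
  stay : ∀ {X C u v} → (∀ {w} → X w → Touch C w → ¬ ¬ C w) → Walk X u v → C u → ¬ ¬ C v
  stay f nil u∈ k = k u∈
  stay f (p ▸ (e , s)) u∈ k = stay f p u∈ λ v∈ → f s (_ , v∈ , e) k

  -- For u in the boundary of X and v in that of Y: if the boundary of X misses Y then Y lies inside X,
  -- and otherwise it contains some s in Y, whose adjacency to u puts u in the boundary of Y as well.
  good-∪ : ∀ {ℓ ℓ′ X Y x y} → Good ℓ X → Good ℓ′ Y → X x → Y y → x ≡ y ⊎ x ~ y → Good ℓ (X ∪ Y)
  good-∪ {X = X} {Y} {x} {y} g h x∈ y∈ link = record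
    { conn = conn∪ ; ℓ∈X = inj₁ (ℓ∈X g) ; a∉X = [ a∉X g , a∉X h ]′ ; b∉X = [ b∉X g , b∉X h ]′
    ; b≁X = λ { (_ , inj₁ s , e) → b≁X g (_ , s , e) ; (_ , inj₂ s , e) → b≁X h (_ , s , e) }
    ; ∂-clique = clique }
    where
    cross : Walk (X ∪ Y) x y
    cross = [ (λ { refl → nil }) , (λ e → nil ▸ (e , inj₂ y∈)) ]′ link

    conn∪ : Conn (X ∪ Y)
    conn∪ (inj₁ p) (inj₁ q) = map-walk inj₁ (conn g p q)
    conn∪ (inj₁ p) (inj₂ q) = map-walk inj₁ (conn g p x∈) ++ʷ cross ++ʷ map-walk inj₂ (conn h y∈ q)
    conn∪ (inj₂ p) (inj₁ q) = map-walk inj₂ (conn h p y∈) ++ʷ reverse-walk (inj₁ x∈) cross ++ʷ map-walk inj₁ (conn g x∈ q)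
    conn∪ (inj₂ p) (inj₂ q) = map-walk inj₂ (conn h p q)

    mixed : ∀ {u v} → u ≢ a → ¬ (X ∪ Y) u → Touch X u → v ≢ a → ¬ (X ∪ Y) v → Touch Y v → u ≢ v → ¬ u ~ v → ⊥
    mixed {u} {v} u≢a u∉ u~X v≢a v∉ (y′ , y′∈ , e) u≢v u≁v = by-cases {∃ λ s → ∂ X s × Y s}
      (λ { (s , s∂ , s∈) → by-cases {u ~ s}
        (λ u~s → ∂-clique h (u≢a , u∉ ∘ inj₂ , s , s∈ , ~-sym u~s) (v≢a , v∉ ∘ inj₂ , y′ , y′∈ , e) u≢v u≁v)
        (∂-clique g (u≢a , u∉ ∘ inj₁ , u~X) s∂ (λ { refl → u∉ (inj₂ s∈) })) })
      (λ none → let inX = λ {w} (w∈ : Y w) (t : Touch X w) (w∉ : ¬ X w) → none (w , ((λ { refl → a∉X h w∈ }) , w∉ , t) , w∈) in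
        begin-in inX λ y∈X → stay inX (conn h y∈ y′∈) y∈X λ y′∈X →
        ∂-clique g (u≢a , u∉ ∘ inj₁ , u~X) (v≢a , v∉ ∘ inj₁ , y′ , y′∈X , e) u≢v u≁v)
      where
      begin-in : (∀ {w} → Y w → Touch X w → ¬ ¬ X w) → ¬ ¬ X y
      begin-in f k = [ (λ { refl → k x∈ }) , (λ e → f y∈ (x , x∈ , e) k) ]′ link

    clique : Clique (∂ (X ∪ Y))
    clique (u≢a , u∉ , p , inj₁ p∈ , e) (v≢a , v∉ , q , inj₁ q∈ , f) = ∂-clique g (u≢a , u∉ ∘ inj₁ , p , p∈ , e) (v≢a , v∉ ∘ inj₁ , q , q∈ , f)
    clique (u≢a , u∉ , p , inj₂ p∈ , e) (v≢a , v∉ , q , inj₂ q∈ , f) = ∂-clique h (u≢a , u∉ ∘ inj₂ , p , p∈ , e) (v≢a , v∉ ∘ inj₂ , q , q∈ , f)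
    clique (u≢a , u∉ , p , inj₁ p∈ , e) (v≢a , v∉ , q , inj₂ q∈ , f) = mixed u≢a u∉ (p , p∈ , e) v≢a v∉ (q , q∈ , f)
    clique (u≢a , u∉ , p , inj₂ p∈ , e) (v≢a , v∉ , q , inj₁ q∈ , f) ne na = mixed v≢a v∉ (q , q∈ , f) u≢a u∉ (p , p∈ , e) (ne ∘ sym) (na ∘ ~-sym)

  -- The union of all good sets around `ℓ`. Ranging over Boolean sets instead of predicates keeps it
  -- at level zero, so that it can be a good set itself.
  Hull : V → Pred V 0ℓ
  Hull ℓ v = Σ (V → Bool) λ X → Good ℓ (λ u → X u ≡ true) × X v ≡ true

  hull-max : ∀ {ℓ C v} → Good ℓ C → C v → ¬ ¬ Hull ℓ v
  hull-max {ℓ} {C} {v} g v∈ k = comprehension C λ { (X , spec) → k (X , record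
    { conn = λ p q → map-walk (λ {u} → proj₂ (spec u)) (conn g (proj₁ (spec _) p) (proj₁ (spec _) q))
    ; ℓ∈X = proj₂ (spec ℓ) (ℓ∈X g) ; a∉X = a∉X g ∘ proj₁ (spec a) ; b∉X = b∉X g ∘ proj₁ (spec b)
    ; b≁X = b≁X g ∘ map-touch (λ {u} → proj₁ (spec u))
    ; ∂-clique = λ { (p , q , r) (p′ , q′ , r′) → ∂-clique g (p , q ∘ proj₂ (spec _) , map-touch (λ {u} → proj₁ (spec u)) r)
                                                           (p′ , q′ ∘ proj₂ (spec _) , map-touch (λ {u} → proj₁ (spec u)) r′) } }
    , proj₂ (spec v) v∈) }

  -- The leaf alone is good, since its boundary has one vertex. Two boundary vertices of the hull
  -- come from two good sets, whose union is good because both contain `ℓ`.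
  hull-good : ∀ {ℓ} → ℓ ~ a → ¬ ℓ ~ b → ¬ ¬ Good ℓ (Hull ℓ)
  hull-good {ℓ} ℓ~a ℓ≁b k = hull-max single refl λ ℓ∈ → k record
    { conn = λ { (X , g , p) (Y , h , q) → map-walk (λ r → X , g , r) (conn g p (ℓ∈X g)) ++ʷ map-walk (λ r → Y , h , r) (conn h (ℓ∈X h) q) }
    ; ℓ∈X = ℓ∈ ; a∉X = λ { (X , g , p) → a∉X g p } ; b∉X = λ { (X , g , p) → b∉X g p }
    ; b≁X = λ { (u , (X , g , p) , e) → b≁X g (u , p , e) }
    ; ∂-clique = λ { (u≢a , u∉ , x , (X , g , p) , e) (v≢a , v∉ , y , (Y , h , q) , f) →
        ∂-clique (good-∪ g h (ℓ∈X g) (ℓ∈X h) (inj₁ refl))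
          (u≢a , [ (λ r → u∉ (X , g , r)) , (λ r → u∉ (Y , h , r)) ]′ , x , inj₁ p , e)
          (v≢a , [ (λ r → v∉ (X , g , r)) , (λ r → v∉ (Y , h , r)) ]′ , y , inj₂ q , f) } }
    where
    single : Good ℓ (Sing ℓ)
    single = record
      { conn = λ { refl refl → nil } ; ℓ∈X = refl ; a∉X = λ e → ~-irrefl ℓ~a (sym e) ; b∉X = λ { refl → b≁a ℓ~a }
      ; b≁X = λ { (_ , refl , e) → ℓ≁b e }
      ; ∂-clique = λ { (u≢a , _ , _ , refl , e) (v≢a , _ , _ , refl , f) ne _ → ne (leafy ℓ~a e f u≢a v≢a) } }

  -- Rays to `b` and their exits from the hulls

  record Ray (R : Pred V 0ℓ) (ℓ : V) : Set where
    no-eta-equality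
    field
      ℓ~a : ℓ ~ a
      ℓ≁b : ¬ ℓ ~ b
      a∉R : ¬ R a
      ℓ∈R : R ℓ
      ray : Walk R ℓ b

    ℓ≢b : ℓ ≢ b
    ℓ≢b e = b≁a (subst (_~ a) e ℓ~a)

  open Ray

  record Exit (R : Pred V 0ℓ) (ℓ x : V) : Set where
    no-eta-equality
    field
      good : Good ℓ (Hull ℓ)
      x∈∂ : ∂ (Hull ℓ) x
      x∈R : R x

    x≢b : x ≢ b
    x≢b e = b≁X good (subst (Touch (Hull ℓ)) e (proj₂ (proj₂ x∈∂)))

  open Exit

  exits : ∀ {R ℓ} → Ray R ℓ → ¬ ¬ (∃ (Exit R ℓ))
  exits {R} {ℓ} r k = hull-good (ℓ~a r) (ℓ≁b r) λ g → leave (ray r) (ℓ∈X g) (b∉X g)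
      λ { (x , x∈R , x∉ , t) → k (x , record { good = g ; x∈∂ = (λ { refl → a∉R r x∈R }) , x∉ , t ; x∈R = x∈R }) }
    where
    leave : ∀ {X u v} → Walk R u v → X u → ¬ X v → ¬ ¬ (∃ λ x → R x × ¬ X x × Touch X x)
    leave nil u∈ v∉ _ = v∉ u∈
    leave (p ▸ (e , s)) u∈ v∉ k = by-cases (λ v∈ → k (_ , s , v∉ , _ , v∈ , e)) λ v′∉ → leave p u∈ v′∉ k

  module _ {R₁ R₂ ℓ₁ ℓ₂ x₁ x₂} (E₁ : Exit R₁ ℓ₁ x₁) (E₂ : Exit R₂ ℓ₂ x₂) (x₁≢x₂ : x₁ ≢ x₂) (x₁≁x₂ : ¬ x₁ ~ x₂) where

    -- If the hulls met or touched, their union would be good around either leaf. By maximality they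
    -- would coincide, and both exits would lie in one clique boundary.
    hulls-sep : Sep (Hull ℓ₁) (Hull ℓ₂)
    hulls-sep = only λ p q → (λ e → linked p q (inj₁ e)) , λ e → linked p q (inj₂ e)
      where
      linked : ∀ {x y} → Hull ℓ₁ x → Hull ℓ₂ y → x ≡ y ⊎ x ~ y → ⊥
      linked p q link with x∈∂ E₂
      ... | x₂≢a , x₂∉ , (d , d∈ , e) =
        hull-max (good-∪ (good E₁) (good E₂) p q link) (inj₂ d∈) λ d∈₁ →
        ∂-clique (good E₁) (x∈∂ E₁) (x₂≢a , (λ x₂∈ → hull-max (good-∪ (good E₂) (good E₁) q p (flip link)) (inj₂ x₂∈) x₂∉) , d , d∈₁ , e) x₁≢x₂ x₁≁x₂
        where
        flip : ∀ {x y} → x ≡ y ⊎ x ~ y → y ≡ x ⊎ y ~ x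
        flip = [ inj₁ ∘ sym , inj₂ ∘ ~-sym ]′

    exit-sep : Sep (Hull ℓ₁) (Sing x₂)
    exit-sep = sep-sym (sing-sep x₂∉ λ t → ∂-clique (good E₁) (x∈∂ E₁) (proj₁ (x∈∂ E₂) , x₂∉ , t) x₁≢x₂ x₁≁x₂)
      where
      x₂∉ : ¬ Hull ℓ₁ x₂
      x₂∉ = touch∉ (sep-sym hulls-sep) (proj₂ (proj₂ (x∈∂ E₂)))

  module _ {R₁ R₂ R₃ ℓ₁ ℓ₂ ℓ₃ x₁ x₂ x₃} (r₁ : Ray R₁ ℓ₁) (r₂ : Ray R₂ ℓ₂) (r₃ : Ray R₃ ℓ₃)
           (E₁ : Exit R₁ ℓ₁ x₁) (E₂ : Exit R₂ ℓ₂ x₂) (E₃ : Exit R₃ ℓ₃ x₃)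
           (n₁₂ : x₁ ≢ x₂) (n₁₃ : x₁ ≢ x₃) (n₂₃ : x₂ ≢ x₃)
           (m₁₂ : ¬ x₁ ~ x₂) (m₁₃ : ¬ x₁ ~ x₃) (m₂₃ : ¬ x₂ ~ x₃) where

    exits-near-b : x₁ ~ b → x₂ ~ b → x₃ ~ b → ⊥
    exits-near-b e₁ e₂ e₃ = claw b≢a b≁a (b∉ E₁) (b∉ E₂) (b∉ E₃) (a∉ E₁) (a∉ E₂) (a∉ E₃)
      (arm r₁ E₁ e₁) (arm r₂ E₂ e₂) (arm r₃ E₃ e₃) (sep E₁ E₂ n₁₂ m₁₂) (sep E₁ E₃ n₁₃ m₁₃) (sep E₂ E₃ n₂₃ m₂₃)
      where
      b∉ : ∀ {R ℓ x} → Exit R ℓ x → ¬ (Sing x ∪ Hull ℓ) b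
      b∉ E (inj₁ e) = x≢b E (sym e)
      b∉ E (inj₂ h) = b∉X (good E) h
      a∉ : ∀ {R ℓ x} → Exit R ℓ x → ¬ (Sing x ∪ Hull ℓ) a
      a∉ E (inj₁ e) = proj₁ (x∈∂ E) (sym e)
      a∉ E (inj₂ h) = a∉X (good E) h
      arm : ∀ {R ℓ x} → Ray R ℓ → Exit R ℓ x → x ~ b → Thru (Sing x ∪ Hull ℓ) b a
      arm r E e = _ , (nil ▸ (~-sym e , inj₁ refl)) ++ʷ map-walk inj₂ (enter (conn (good E)) (proj₂ (proj₂ (x∈∂ E))) (ℓ∈X (good E))) , ℓ~a r
      sep : ∀ {R ℓ x R′ ℓ′ x′} → Exit R ℓ x → Exit R′ ℓ′ x′ → x ≢ x′ → ¬ x ~ x′ → Sep (Sing x ∪ Hull ℓ) (Sing x′ ∪ Hull ℓ′)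
      sep E E′ ne na = only-∪ˡ
        (only-∪ʳ (adj-only ne na) (sep-sym (exit-sep E′ E (ne ∘ sym) (na ∘ ~-sym))))
        (only-∪ʳ (exit-sep E E′ ne na) (hulls-sep E E′ ne na))

  -- Clique separators against hulls

  record Side (K : Pred V 0ℓ) (ℓ : V) (C : Pred V 0ℓ) : Set where
    no-eta-equality
    field
      connC : Conn C
      ℓ∈C : C ℓ
      a∉C : ¬ C a
      K∌ : ∀ {v} → K v → ¬ C v
      bd : ∀ {v} → v ≢ a → ¬ C v → Touch C v → ¬ ¬ K v

  open Side

  module _ {K : Pred V 0ℓ} (K-clique : Clique K) where

    side-good : ∀ {ℓ C} → Side K ℓ C → ¬ C b → ¬ Touch C b → Good ℓ C
    side-good s b∉ b≁ = record
      { conn = connC s ; ℓ∈X = ℓ∈C s ; a∉X = a∉C s ; b∉X = b∉ ; b≁X = b≁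
      ; ∂-clique = λ { (p , q , r) (p′ , q′ , r′) ne na → bd s p q r λ k → bd s p′ q′ r′ λ k′ → K-clique k k′ ne na } }

    -- A hull that misses `K` cannot leave `C`, so `x` touches `C`. If `x` were in `C`, it would be
    -- in the hull, because `C` is itself good; hence it is in the boundary of `C`.
    exit∈K : ∀ {R ℓ x C} → Exit R ℓ x → Side K ℓ C → ¬ C b → ¬ Touch C b → (∀ {v} → K v → ¬ Hull ℓ v) → ¬ ¬ K x
    exit∈K {C = C} E s b∉ b≁ K∩X k with x∈∂ E
    ... | x≢a , x∉ , d , d∈ , e =
      stay {C = C} (λ {w} w∈ t w∉ → bd s (λ { refl → a∉X (good E) w∈ }) w∉ t λ kw → K∩X kw w∈) (conn (good E) (ℓ∈X (good E)) d∈) (ℓ∈C s) λ d∈C →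
      bd s x≢a (λ x∈C → hull-max (side-good s b∉ b≁) x∈C x∉) (d , d∈C , e) k

    -- If `K` misses both hulls, it contains both exits. If it meets one hull, it misses the other,
    -- whose exit is then in `K` together with a vertex of the first hull, contrary to `exit-sep`.
    b-between : ∀ {R₁ R₂ ℓ₁ ℓ₂ x₁ x₂ C₁ C₂} → Exit R₁ ℓ₁ x₁ → Exit R₂ ℓ₂ x₂ → x₁ ≢ x₂ → ¬ x₁ ~ x₂ →
                Side K ℓ₁ C₁ → Side K ℓ₂ C₂ → ¬ K b → ¬ C₁ b → ¬ C₂ b → ⊥
    b-between {ℓ₁ = ℓ₁} {ℓ₂} {x₁} {x₂} E₁ E₂ ne na s₁ s₂ b∉K b∉₁ b∉₂ =
      by-cases {∃ λ k → K k × Hull ℓ₁ k} (λ { (k , k∈ , h) → meets E₁ E₂ s₂ b∉₂ ne na k∈ h }) λ none₁ →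
      by-cases {∃ λ k → K k × Hull ℓ₂ k} (λ { (k , k∈ , h) → meets E₂ E₁ s₁ b∉₁ (ne ∘ sym) (na ∘ ~-sym) k∈ h }) λ none₂ →
      exit∈K E₁ s₁ b∉₁ (b≁ s₁ b∉₁) (λ p q → none₁ (_ , p , q)) λ k₁ →
      exit∈K E₂ s₂ b∉₂ (b≁ s₂ b∉₂) (λ p q → none₂ (_ , p , q)) λ k₂ → K-clique k₁ k₂ ne na
      where
      b≁ : ∀ {ℓ C} → Side K ℓ C → ¬ C b → ¬ Touch C b
      b≁ s b∉ t = bd s b≢a b∉ t b∉K
      meets : ∀ {R₁ R₂ ℓ₁ ℓ₂ x₁ x₂ C₂ k} → Exit R₁ ℓ₁ x₁ → Exit R₂ ℓ₂ x₂ → Side K ℓ₂ C₂ → ¬ C₂ b → x₁ ≢ x₂ → ¬ x₁ ~ x₂ →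
              K k → Hull ℓ₁ k → ⊥
      meets E₁ E₂ s₂ b∉₂ ne na k∈ h = exit∈K E₂ s₂ b∉₂ (b≁ s₂ b∉₂)
        (λ k′∈ h′ → K-clique k∈ k′∈ (apart (hulls-sep E₁ E₂ ne na) h h′) (edge-of (hulls-sep E₁ E₂ ne na) h h′)) λ kx →
        K-clique k∈ kx (apart (exit-sep E₁ E₂ ne na) h refl) (edge-of (exit-sep E₁ E₂ ne na) h refl)

    -- All of `K` lies in the closed neighbourhood of `b`, which the hull avoids. So the exit is in
    -- `K`, and adjacent to `b`.
    b-inside : ∀ {R ℓ x C} → Exit R ℓ x → Side K ℓ C → ¬ x ~ b → K b → ¬ Touch C b → ⊥
    b-inside E s x≁b b∈K b≁ = exit∈K E s (K∌ s b∈K) b≁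
      (λ {v} k h → K-clique k b∈K (λ { refl → b∉X (good E) h }) λ e → b≁X (good E) (v , h , e))
      λ kx → K-clique kx b∈K (x≢b E) x≁b

  record Apart (R₁ R₂ : Pred V 0ℓ) : Set where
    constructor mkApart
    field meet : ∀ {v} → R₁ v → R₂ v → v ≡ b

  open Apart

  -- Follow the first ray to `b`, then the second one backwards until just short of `ℓ₂`.
  reaches : ∀ {R₁ R₂ R₃ ℓ₁ ℓ₂ ℓ₃} → Ray R₁ ℓ₁ → Ray R₂ ℓ₂ → Ray R₃ ℓ₃ → Apart R₁ R₂ → Apart R₁ R₃ → Apart R₂ R₃ →
            Touch (Reach ℓ₁ ℓ₂ ℓ₃) ℓ₂
  reaches {R₁} {R₂} {R₃} {ℓ₁} {ℓ₂} {ℓ₃} r₁ r₂ r₃ a₁₂ a₁₃ a₂₃ with last-visit (Finₚ._≟ ℓ₂) (ray r₂) (ℓ∈R r₂) refl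
  ... | _ , _ , refl , q with first-step q
  ... | inj₁ e = ⊥-elim (ℓ≢b r₂ e)
  ... | inj₂ (x , e , (x∈ , x≢) , p) = x ,
      map-walk (λ {v} v∈ → (λ { refl → a∉R r₁ v∈ }) , (λ { refl → ℓ≢b r₂ (meet a₁₂ v∈ (ℓ∈R r₂)) }) , (λ { refl → ℓ≢b r₃ (meet a₁₃ v∈ (ℓ∈R r₃)) })) (ray r₁)
      ++ʷ map-walk (λ { {v} (v∈ , v≢) → (λ { refl → a∉R r₂ v∈ }) , v≢ , (λ { refl → ℓ≢b r₃ (meet a₂₃ v∈ (ℓ∈R r₃)) }) }) (reverse-walk (x∈ , x≢) p) ,
      ~-sym e

  module _ {R₁ R₂ R₃ ℓ₁ ℓ₂ ℓ₃ x₁ x₂ x₃} (r₁ : Ray R₁ ℓ₁) (r₂ : Ray R₂ ℓ₂) (r₃ : Ray R₃ ℓ₃)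
           (E₁ : Exit R₁ ℓ₁ x₁) (E₂ : Exit R₂ ℓ₂ x₂) (E₃ : Exit R₃ ℓ₃ x₃)
           (n₁₂ : x₁ ≢ x₂) (n₁₃ : x₁ ≢ x₃) (n₂₃ : x₂ ≢ x₃)
           (m₁₂ : ¬ x₁ ~ x₂) (m₁₃ : ¬ x₁ ~ x₃) (m₂₃ : ¬ x₂ ~ x₃)
           (a₁₂ : Apart R₁ R₂) (a₁₃ : Apart R₁ R₃) (a₂₃ : Apart R₂ R₃) where

    exits-far-from-b : ¬ x₁ ~ b → ¬ x₂ ~ b → ¬ x₃ ~ b → ⊥
    exits-far-from-b f₁ f₂ f₃ =
      leaves⇒split (distinct r₁ r₂ a₁₂) (distinct r₁ r₃ a₁₃) (distinct r₂ r₃ a₂₃) (ℓ~a r₁) (ℓ~a r₂) (ℓ~a r₃)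
        (reaches r₁ r₂ r₃ a₁₂ a₁₃ a₂₃)
        (map-touch (map-walk λ { (p , q , r) → p , r , q }) (reaches r₁ r₃ r₂ a₁₃ a₁₂ (mkApart λ p q → meet a₂₃ q p)))
        contradict
      where
      distinct : ∀ {R R′ ℓ ℓ′} → Ray R ℓ → Ray R′ ℓ′ → Apart R R′ → ℓ ≢ ℓ′
      distinct r r′ ap refl = ℓ≢b r (meet ap (ℓ∈R r) (ℓ∈R r′))

      contradict : Split ℓ₁ ℓ₂ ℓ₃ → ⊥
      contradict S = by-cases
        (λ b∈K → by-cases
          (λ t₁ → by-cases
            (λ t₂ → by-cases
              (λ t₃ → claw b≢a b≁a (out₁ b∈K) (out₂ b∈K) (out₃ b∈K) a∉₁ a∉₂ a∉₃
                 (_ , enter conn₁ t₁ ℓ∈₁ , ℓ~a r₁) (_ , enter conn₂ t₂ ℓ∈₂ , ℓ~a r₂) (_ , enter conn₃ t₃ ℓ∈₃ , ℓ~a r₃) s₁₂ s₁₃ s₂₃)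
              (b-inside K-clique E₃ side₃ f₃ b∈K))
            (b-inside K-clique E₂ side₂ f₂ b∈K))
          (b-inside K-clique E₁ side₁ f₁ b∈K))
        -- At most one of the three components contains `b`; the other two are used.
        λ b∉K → by-cases {C₁ b}
          (λ b∈₁ → b-between K-clique E₂ E₃ n₂₃ m₂₃ side₂ side₃ b∉K (λ b∈₂ → apart s₁₂ b∈₁ b∈₂ refl) (λ b∈₃ → apart s₁₃ b∈₁ b∈₃ refl))
          λ b∉₁ → by-cases {C₂ b}
            (λ b∈₂ → b-between K-clique E₁ E₃ n₁₃ m₁₃ side₁ side₃ b∉K b∉₁ (λ b∈₃ → apart s₂₃ b∈₂ b∈₃ refl))
            λ b∉₂ → b-between K-clique E₁ E₂ n₁₂ m₁₂ side₁ side₂ b∉K b∉₁ b∉₂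
        where
        open Split S
        side₁ : Side K ℓ₁ C₁
        side₁ = record { connC = conn₁ ; ℓ∈C = ℓ∈₁ ; a∉C = a∉₁ ; K∌ = out₁ ; bd = bd₁ }
        side₂ : Side K ℓ₂ C₂
        side₂ = record { connC = conn₂ ; ℓ∈C = ℓ∈₂ ; a∉C = a∉₂ ; K∌ = out₂ ; bd = bd₂ }
        side₃ : Side K ℓ₃ C₃
        side₃ = record { connC = conn₃ ; ℓ∈C = ℓ∈₃ ; a∉C = a∉₃ ; K∌ = out₃ ; bd = bd₃ }

-- Ramsey reductions

module _ {A : Set} where

  AllPairs-resp-⊑ : ∀ {R : A → A → Set} {xs ys} → xs ⊑ ys → AllPairs R ys → AllPairs R xs
  AllPairs-resp-⊑ []ˢ [] = []
  AllPairs-resp-⊑ (_ ∷ʳˢ p) (_ ∷ qs) = AllPairs-resp-⊑ p qs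
  AllPairs-resp-⊑ (refl ∷ˢ p) (q ∷ qs) = All-resp-⊆ p q ∷ AllPairs-resp-⊑ p qs

  lookup-AllPairs : ∀ {R : A → A → Set} {xs} → AllPairs R xs → ∀ i j → i <ᶠ j → R (lookup xs i) (lookup xs j)
  lookup-AllPairs (q ∷ _) zero (suc j) _ = All.lookup q (∈-lookup j)
  lookup-AllPairs (_ ∷ qs) (suc i) (suc j) (s≤s lt) = lookup-AllPairs qs i j lt

  lookup-AllPairs-sym : ∀ {R : A → A → Set} {xs} → (∀ {x y} → R x y → R y x) → AllPairs R xs →
                        ∀ i j → i ≢ j → R (lookup xs i) (lookup xs j)
  lookup-AllPairs-sym R-sym qs i j i≢j with Finₚ.<-cmp i j
  ... | Bin.tri< lt _ _ = lookup-AllPairs qs i j lt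
  ... | Bin.tri≈ _ e _ = ⊥-elim (i≢j e)
  ... | Bin.tri> _ _ gt = R-sym (lookup-AllPairs qs j i gt)

  separate : ∀ {Q : A → Set} → Decidable Q → ∀ xs → ∃ λ ys → ∃ λ zs →
             ys ⊑ xs × zs ⊑ xs × All Q ys × All (¬_ ∘ Q) zs × length ys + length zs ≡ length xs
  separate Q? [] = [] , [] , []ˢ , []ˢ , [] , [] , refl
  separate Q? (x ∷ xs) with Q? x | separate Q? xs
  ... | yes q | ys , zs , p , p′ , qs , ¬qs , e = x ∷ ys , zs , refl ∷ˢ p , x ∷ʳˢ p′ , q ∷ qs , ¬qs , cong suc e
  ... | no ¬q | ys , zs , p , p′ , qs , ¬qs , e =
    ys , x ∷ zs , x ∷ʳˢ p , refl ∷ˢ p′ , qs , ¬q ∷ ¬qs , trans (ℕₚ.+-suc (length ys) (length zs)) (cong suc e)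

pigeonhole₂ : ∀ m {n p q} → m + n ≤ p + q → m ≤ p ⊎ n ≤ q
pigeonhole₂ m {n} {p} {q} le with ℕₚ.≤-total m p
... | inj₁ m≤p = inj₁ m≤p
... | inj₂ p≤m = inj₂ (ℕₚ.+-cancelˡ-≤ m n q (ℕₚ.≤-trans le (ℕₚ.+-monoˡ-≤ q p≤m)))

ramsey : ℕ → ℕ → ℕ
ramsey zero t = zero
ramsey (suc s) zero = zero
ramsey (suc s) (suc t) = suc (ramsey s (suc t) + ramsey (suc s) t)

Chain : {A : Set} → (A → A → Set) → ℕ → List A → Set
Chain R s xs = ∃ λ ys → ys ⊑ xs × length ys ≡ s × AllPairs R ys

-- `R` need not be symmetric: it is evaluated from earlier to later entries, as the directed links
-- require.
ramsey-theorem : ∀ {A : Set} {R : A → A → Set} → Bin.Decidable R → ∀ s t xs → ramsey s t ≤ length xs →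
                 Chain R s xs ⊎ Chain (λ x y → ¬ R x y) t xs
ramsey-theorem R? zero t xs _ = inj₁ ([] , ⊑-minimum xs , refl , [])
ramsey-theorem R? (suc s) zero xs _ = inj₂ ([] , ⊑-minimum xs , refl , [])
ramsey-theorem R? (suc s) (suc t) (x ∷ xs) (s≤s le) with separate (R? x) xs
... | ys , zs , p , p′ , qs , ¬qs , e with pigeonhole₂ (ramsey s (suc t)) (subst (_ ≤_) (sym e) le)
... | inj₁ l with ramsey-theorem R? s (suc t) ys l
...   | inj₁ (us , r , m , ap) = inj₁ (x ∷ us , refl ∷ˢ ⊑-trans r p , cong suc m , All-resp-⊆ r qs ∷ ap)
...   | inj₂ (us , r , c) = inj₂ (us , x ∷ʳˢ ⊑-trans r p , c)
ramsey-theorem R? (suc s) (suc t) (x ∷ xs) (s≤s le) | ys , zs , p , p′ , qs , ¬qs , e | inj₂ l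
  with ramsey-theorem R? (suc s) t zs l
...   | inj₁ (us , r , c) = inj₁ (us , x ∷ʳˢ ⊑-trans r p′ , c)
...   | inj₂ (us , r , m , ap) = inj₂ (x ∷ us , refl ∷ˢ ⊑-trans r p′ , cong suc m , All-resp-⊆ r ¬qs ∷ ap)

three : ∀ {A : Set} {R : A → A → Set} {Q : A → Set} {xs} → 3 ≤ length xs → AllPairs R xs → All Q xs →
        ∃ λ x → ∃ λ y → ∃ λ z → R x y × R x z × R y z × Q x × Q y × Q z
three {xs = x ∷ y ∷ z ∷ _} _ ((xy ∷ xz ∷ _) ∷ (yz ∷ _) ∷ _) (qx ∷ qy ∷ qz ∷ _) = x , y , z , xy , xz , yz , qx , qy , qz
three {xs = []} () _ _
three {xs = _ ∷ []} (s≤s ()) _ _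
three {xs = _ ∷ _ ∷ []} (s≤s (s≤s ())) _ _

no-adjacent-chain : ∀ {n m t} (G : Graph n) → NoClique t G → (x : Fin m → Fin n) → ∀ {zs} →
                    ¬ Chain (λ k l → Adj G (x k) (x l)) t zs
no-adjacent-chain G noClique x (ys , _ , refl , ap) = noClique (x ∘ lookup ys) inj clique
  where
  clique : ∀ i j → i ≢ j → Adj G (x (lookup ys i)) (x (lookup ys j))
  clique = lookup-AllPairs-sym {R = λ k l → Adj G (x k) (x l)} (Walks.~-sym G) ap
  inj : Injective _≡_ _≡_ (x ∘ lookup ys)
  inj {i} {j} e with i Finₚ.≟ j
  ... | yes p = p
  ... | no ne = ⊥-elim (Walks.~-irrefl G (clique i j ne) e)

¬¬-∀ : ∀ {n} {P : Fin n → Set} → (∀ i → ¬ ¬ P i) → ¬ ¬ (∀ i → P i)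
¬¬-∀ {zero} f k = k λ ()
¬¬-∀ {suc n} f k = f zero λ p → ¬¬-∀ (f ∘ suc) λ q → k λ { zero → p ; (suc i) → q i }

-- Induced paths from `a` to `b`

second : ∀ {n} → Path n → Fin n
-- A default value; a path between distinct vertices has positive length.
second (mkPath zero f) = f zero
second (mkPath (suc l) f) = f (suc zero)

interior⇒on : ∀ {n v} {P : Path n} → Interior v P → OnPath v P
interior⇒on (i , _ , _ , e) = i , e

module InducedPath {n : ℕ} (G : Graph n) {a b : Fin n} (a≢b : a ≢ b) (a≁b : ¬ Adj G a b) where

  open Walks G

  second-interior : ∀ {P} → IsInducedPath G P a b → Interior (second P) P
  second-interior {mkPath zero f} (_ , refl , refl , _) = ⊥-elim (a≢b refl)
  second-interior {mkPath (suc zero) f} (_ , refl , refl , e) = ⊥-elim (a≁b (proj₂ (e zero (suc zero)) (inj₂ refl)))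
  second-interior {mkPath (suc (suc l)) f} _ = suc zero , s≤s z≤n , s≤s (s≤s z≤n) , refl

  second-adj : ∀ {P} → IsInducedPath G P a b → a ~ second P
  second-adj {mkPath zero f} (_ , refl , refl , _) = ⊥-elim (a≢b refl)
  second-adj {mkPath (suc l) f} (_ , refl , _ , e) = proj₂ (e zero (suc zero)) (inj₂ refl)

  second-unique : ∀ {P v} → IsInducedPath G P a b → OnPath v P → a ~ v → v ≡ second P
  second-unique {mkPath (suc l) f} (_ , refl , _ , e) (suc zero , refl) _ = refl
  second-unique {mkPath l f} (_ , refl , _ , e) (zero , refl) q = ⊥-elim (~-irrefl q refl)
  second-unique {mkPath (suc (suc l)) f} (_ , refl , _ , e) (suc (suc i) , refl) q with proj₁ (e zero (suc (suc i))) q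
  ... | inj₁ ()
  ... | inj₂ ()

  second-next : ∀ {P u v} → IsInducedPath G P a b → OnPath u P → OnPath v P → u ≢ a → v ≢ a →
                second P ~ u → second P ~ v → u ≡ v
  second-next {mkPath zero f} (_ , refl , refl , _) = ⊥-elim (a≢b refl)
  second-next {mkPath (suc l) f} (_ , refl , _ , e) (i , refl) (j , refl) u≢a v≢a p q =
    cong f (Finₚ.toℕ-injective (trans (two i u≢a p) (sym (two j v≢a q))))
    where
    two : ∀ i → f i ≢ f zero → f (suc zero) ~ f i → toℕ i ≡ 2
    two zero ne _ = ⊥-elim (ne refl)
    two (suc i) _ p with proj₁ (e (suc zero) (suc i)) p
    ... | inj₂ q = q

  interior : ∀ {P v} → IsInducedPath G P a b → OnPath v P → v ≢ a → v ≢ b → Interior v P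
  interior {mkPath l f} (_ , refl , refl , _) (i , refl) v≢a v≢b =
    i , ℕₚ.n≢0⇒n>0 (λ e → v≢a (cong f (Finₚ.toℕ-injective e))) ,
    ℕₚ.≤∧≢⇒< (Finₚ.toℕ≤pred[n] i) (λ e → v≢b (cong f (Finₚ.toℕ-injective (trans e (sym (Finₚ.toℕ-fromℕ l)))))) , refl

  interior≢a : ∀ {P v} → IsInducedPath G P a b → Interior v P → v ≢ a
  interior≢a (inj , refl , _) (i , 0<i , _ , refl) e = ℕₚ.<-irrefl (sym (cong toℕ (inj e))) 0<i

walk-along : ∀ {n} (G : Graph n) l (f : Fin (suc l) → Fin n) → (∀ i → Adj G (f (inject₁ i)) (f (suc i))) →
             Walks.Walk G (λ v → ∃ λ i → f (suc i) ≡ v) (f zero) (f (fromℕ l))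
walk-along G zero f e = Walks.nil
walk-along G (suc l) f e = (Walks.nil Walks.▸ (e zero , zero , refl)) ++ʷ
    map-walk (λ { (i , q) → suc i , q }) (walk-along G l (f ∘ suc) (e ∘ suc))
  where open Walks G

-- The subgraph of G induced by U, with the other vertices kept as isolated ones.
restrict : ∀ {n} → Graph n → (Fin n → Bool) → Graph n
adj (restrict G U) u v = (U u ∧ U v) ∧ adj G u v
adj-sym (restrict G U) u v rewrite adj-sym G u v = cong (_∧ adj G v u) (Boolₚ.∧-comm (U u) (U v))
adj-irrefl (restrict G U) v rewrite adj-irrefl G v = Boolₚ.∧-zeroʳ (U v ∧ U v)

module Restriction {n : ℕ} (G : Graph n) (U : Fin n → Bool) where

  private
    G′ : Graph n
    G′ = restrict G U

    ∧-true : ∀ {x y} → x ∧ y ≡ true → x ≡ true × y ≡ true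
    ∧-true {true} {true} _ = refl , refl

  restrict-adj⁻ : ∀ {u v} → Adj G′ u v → U u ≡ true × U v ≡ true × Adj G u v
  restrict-adj⁻ e with ∧-true e
  ... | p , q = proj₁ (∧-true p) , proj₂ (∧-true p) , q

  restrict-adj⁺ : ∀ {u v} → U u ≡ true → U v ≡ true → Adj G u v → Adj G′ u v
  restrict-adj⁺ p q e rewrite p | q = e

  private
    -- Vertices outside `U` are isolated in the restricted graph, whereas on a path with distinct
    -- ends every vertex has a neighbour.
    on-path : ∀ {P a b v} → a ≢ b → IsInducedPath G′ P a b → OnPath v P → U v ≡ true
    on-path {mkPath zero f} a≢b (_ , refl , refl , _) _ = ⊥-elim (a≢b refl)
    on-path {mkPath (suc l) f} _ (_ , _ , _ , e) (zero , refl) = proj₁ (restrict-adj⁻ (proj₂ (e zero (suc zero)) (inj₂ refl)))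
    on-path {mkPath (suc l) f} _ (_ , _ , _ , e) (suc i , refl) =
      proj₁ (restrict-adj⁻ (proj₂ (e (suc i) (inject₁ i)) (inj₁ (cong suc (sym (Finₚ.toℕ-inject₁ i))))))

    unrestrict-path : ∀ {P a b} → a ≢ b → IsInducedPath G′ P a b → IsInducedPath G P a b
    unrestrict-path a≢b π@(inj , s , t , e) = inj , s , t , λ i j →
      (λ q → proj₁ (e i j) (restrict-adj⁺ (on-path a≢b π (i , refl)) (on-path a≢b π (j , refl)) q)) ,
      λ c → proj₂ (proj₂ (restrict-adj⁻ (proj₂ (e i j) c)))

  restrict-theta : HasTheta G′ → HasTheta G
  restrict-theta (a , b , P , a≢b , a≁b , path , disj , anti) =
    a , b , P , a≢b , (λ e → a≁b (lift {zero} {zero} (start∈ zero) (end∈ zero) e)) ,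
    (λ i → unrestrict-path a≢b (proj₁ (path i)) , proj₂ (path i)) , disj ,
    λ i j ne u v p q e → anti i j ne u v p q (lift {i} {j} (interior⇒on p) (interior⇒on q) e)
    where
    lift : ∀ {i j u v} → OnPath u (P i) → OnPath v (P j) → Adj G u v → Adj G′ u v
    lift {i} {j} p q = restrict-adj⁺ (on-path a≢b (proj₁ (path i)) p) (on-path a≢b (proj₁ (path j)) q)
    start∈ : ∀ i → OnPath a (P i)
    start∈ i = zero , proj₁ (proj₂ (proj₁ (path i)))
    end∈ : ∀ i → OnPath b (P i)
    end∈ i = fromℕ (len (P i)) , proj₁ (proj₂ (proj₂ (proj₁ (path i))))

  restrict-prism : HasPrism G′ → HasPrism G
  restrict-prism (a , b , P , tri , a≢b , path , disj , edges) =
    a , b , P , (λ i j ne → proj₁ (tri i j ne) , proj₁ (proj₂ (tri i j ne)) , drop (proj₁ (proj₂ (proj₂ (tri i j ne)))) , drop (proj₂ (proj₂ (proj₂ (tri i j ne))))) ,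
    a≢b , (λ i → unrestrict-path (a≢b i i) (path i)) , disj ,
    λ i j ne u v p q e → edges i j ne u v p q (restrict-adj⁺ (on-path (a≢b i i) (path i) p) (on-path (a≢b j j) (path j) q) e)
    where
    drop : ∀ {u v} → Adj G′ u v → Adj G u v
    drop e = proj₂ (proj₂ (restrict-adj⁻ e))

-- The case without links

module Unlinked {n t : ℕ} (G : Graph n) (free : ThetaPrismFree G) (noClique : NoClique t G)
                {a b : Fin n} (a≢b : a ≢ b) (a≁b : ¬ Adj G a b) {N : ℕ} (Q : Fin N → Path n)
                (path : ∀ k → IsInducedPath G (Q k) a b)
                (disjoint : ∀ k l → k ≢ l → ∀ v → Interior v (Q k) → ¬ Interior v (Q l))
                (stable : ∀ k l → k ≢ l → ¬ Adj G (second (Q k)) (second (Q l)))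
                (second≁b : ∀ k → ¬ Adj G (second (Q k)) b)
                (unlinked : ∀ k l → k ≢ l → ∀ v → Interior v (Q l) → v ≢ second (Q l) → ¬ Adj G (second (Q k)) v)
                (large : ramsey t 6 ≤ N) where

  private
    U? : ∀ v → Dec (∃ λ k → OnPath v (Q k))
    U? v = Finₚ.any? λ k → Finₚ.any? λ i → vtx (Q k) i Finₚ.≟ v

    U : Fin n → Bool
    U v = does (U? v)

    U⁻ : ∀ {v} → U v ≡ true → ∃ λ k → OnPath v (Q k)
    U⁻ {v} e with U? v
    ... | yes p = p
    U⁻ () | no _

    U⁺ : ∀ {k v} → OnPath v (Q k) → U v ≡ true
    U⁺ {k} {v} p with U? v
    ... | yes _ = refl
    ... | no ¬p = ⊥-elim (¬p (k , p))

    G′ : Graph n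
    G′ = restrict G U

    open Restriction G U
    open InducedPath G a≢b a≁b

    noTheta : ¬ HasTheta G′
    noTheta = proj₁ free ∘ restrict-theta

    noPrism : ¬ HasPrism G′
    noPrism = proj₂ free ∘ restrict-prism

    restrict-noClique : NoClique t G′
    restrict-noClique c inj adjacent = noClique c inj λ i j ne → proj₂ (proj₂ (restrict-adj⁻ (adjacent i j ne)))

    ~-symᴳ : ∀ {u v} → Adj G u v → Adj G v u
    ~-symᴳ = Walks.~-sym G

    -- On another path the neighbour would be `b`, the second vertex or a later inner vertex;
    -- `second≁b`, `stable` and `unlinked` exclude these in turn.
    leaf-nbr : ∀ {k u} → Adj G′ (second (Q k)) u → u ≢ a → OnPath u (Q k)
    leaf-nbr {k} {u} e u≢a with restrict-adj⁻ e
    ... | _ , u∈ , e′ with U⁻ u∈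
    ... | l , on with k Finₚ.≟ l
    ... | yes refl = on
    ... | no k≢l with u Finₚ.≟ b | u Finₚ.≟ second (Q l)
    ... | yes refl | _ = ⊥-elim (second≁b k e′)
    ... | no _ | yes refl = ⊥-elim (stable k l k≢l e′)
    ... | no u≢b | no u≢s = ⊥-elim (unlinked k l k≢l u (interior (path l) on u≢a u≢b) u≢s e′)

    leafy : Apex.Leafy G′ a noTheta
    leafy {v} {u} {u′} v~a v~u v~u′ u≢a u′≢a with restrict-adj⁻ v~a
    ... | v∈ , _ , e with U⁻ v∈
    ... | k , on with second-unique (path k) on (~-symᴳ e)
    ... | refl = second-next (path k) (leaf-nbr v~u u≢a) (leaf-nbr v~u′ u′≢a) u≢a u′≢a
                   (proj₂ (proj₂ (restrict-adj⁻ v~u))) (proj₂ (proj₂ (restrict-adj⁻ v~u′)))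

    open Hulls G′ a noTheta noPrism leafy b (a≢b ∘ sym) (λ e → a≁b (~-symᴳ (proj₂ (proj₂ (restrict-adj⁻ e)))))

    R : Fin N → Pred V 0ℓ
    R k v = OnPath v (Q k) × v ≢ a

    ℓ : Fin N → V
    ℓ k = second (Q k)

    a∈ : ∀ k → OnPath a (Q k)
    a∈ k = zero , proj₁ (proj₂ (path k))

    ray : ∀ k → Ray (R k) (ℓ k)
    ray k = record
      { ℓ~a = restrict-adj⁺ (U⁺ {k} on) (U⁺ (a∈ k)) (~-symᴳ (second-adj (path k)))
      ; ℓ≁b = second≁b k ∘ proj₂ ∘ proj₂ ∘ restrict-adj⁻ ; a∉R = λ r → proj₂ r refl
      ; ℓ∈R = on , interior≢a (path k) (second-interior (path k)) ; ray = walk (Q k) (path k) U⁺ }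
      where
      on : OnPath (second (Q k)) (Q k)
      on = interior⇒on (second-interior (path k))

      walk : ∀ P → IsInducedPath G P a b → (∀ {v} → OnPath v P → U v ≡ true) → Walk (λ v → OnPath v P × v ≢ a) (second P) b
      walk (mkPath zero f) (_ , refl , refl , _) _ = ⊥-elim (a≢b refl)
      walk (mkPath (suc l) f) (inj , refl , refl , e) on⇒U = map-walk
        (λ { (i , refl) → (suc (suc i) , refl) , λ q → Finₚ.0≢1+n (inj (sym q)) })
        (walk-along G′ l (f ∘ suc) λ i → restrict-adj⁺ (on⇒U (suc (inject₁ i) , refl)) (on⇒U (suc (suc i) , refl))
          (proj₂ (e (suc (inject₁ i)) (suc (suc i))) (inj₂ (cong (2 +_) (sym (Finₚ.toℕ-inject₁ i))))))

    apart-rays : ∀ {k l} → k ≢ l → Apart (R k) (R l)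
    apart-rays {k} {l} k≢l = mkApart λ {v} → meet v
      where
      meet : ∀ v → R k v → R l v → v ≡ b
      meet v (p , v≢a) (q , _) with v Finₚ.≟ b
      ... | yes e = e
      ... | no v≢b = ⊥-elim (disjoint k l k≢l v (interior (path k) p v≢a v≢b) (interior (path l) q v≢a v≢b))

  contradiction : ⊥
  contradiction = ¬¬-∀ (λ k → exits (ray k)) go
    where
    go : (∀ k → ∃ (Exit (R k) (ℓ k))) → ⊥
    go ex = [ no-adjacent-chain G′ restrict-noClique x , sparse ]′ (ramsey-theorem (λ k l → x k ~? x l) t 6 (allFin N) (subst (ramsey t 6 ≤_) (sym (length-tabulate id)) large))
      where
      x : Fin N → V
      x k = proj₁ (ex k)

      E : ∀ k → Exit (R k) (ℓ k) (x k)
      E k = proj₂ (ex k)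

      x-distinct : ∀ {k l} → k ≢ l → x k ≢ x l
      x-distinct {k} {l} ne e = Exit.x≢b (E l) (Apart.meet (apart-rays ne) (subst (R k) e (Exit.x∈R (E k))) (Exit.x∈R (E l)))

      sparse : Chain (λ k l → ¬ x k ~ x l) 6 (allFin N) → ⊥
      sparse (ys , sub , six , ap) with separate (λ k → x k ~? b) ys
      ... | us , ws , p , q , near , far , e with pigeonhole₂ 3 {3} (ℕₚ.≤-reflexive (trans (sym six) (sym e)))
      ...   | inj₁ three≤ with three three≤ (AllPairs-resp-⊑ p (AllPairs.zip (AllPairs-resp-⊑ sub (allFin⁺ N) , ap))) near
      ...     | i , j , k , (n₁₂ , m₁₂) , (n₁₃ , m₁₃) , (n₂₃ , m₂₃) , e₁ , e₂ , e₃ =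
        exits-near-b (ray i) (ray j) (ray k) (E i) (E j) (E k) (x-distinct n₁₂) (x-distinct n₁₃) (x-distinct n₂₃) m₁₂ m₁₃ m₂₃ e₁ e₂ e₃
      sparse (ys , sub , six , ap) | us , ws , p , q , near , far , e | inj₂ three≤
        with three three≤ (AllPairs-resp-⊑ q (AllPairs.zip (AllPairs-resp-⊑ sub (allFin⁺ N) , ap))) far
      ...     | i , j , k , (n₁₂ , m₁₂) , (n₁₃ , m₁₃) , (n₂₃ , m₂₃) , f₁ , f₂ , f₃ =
        exits-far-from-b (ray i) (ray j) (ray k) (E i) (E j) (E k) (x-distinct n₁₂) (x-distinct n₁₃) (x-distinct n₂₃) m₁₂ m₁₃ m₂₃
          (apart-rays n₁₂) (apart-rays n₁₃) (apart-rays n₂₃) f₁ f₂ f₃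

-- Four successive Ramsey reductions: stable seconds, forward links, backward links, no links.
Ψ : ℕ → ℕ → ℕ
Ψ t ν = suc (ramsey t (3 + ramsey ν (ramsey ν (ramsey t 6))))

-- Selecting the paths

module Selection {n t ν : ℕ} (G : Graph n) (free : ThetaPrismFree G) (noClique : NoClique t G)
                 {a b : Fin n} (a≢b : a ≢ b) (a≁b : ¬ Adj G a b) {m : ℕ} (P : Fin m → Path n)
                 (path : ∀ k → IsInducedPath G (P k) a b)
                 (disjoint : ∀ k l → k ≢ l → ∀ v → Interior v (P k) → ¬ Interior v (P l)) where

  open Walks G
  open InducedPath G a≢b a≁b

  x : Fin m → V
  x k = second (P k)

  x∈ : ∀ k → Interior (x k) (P k)
  x∈ k = second-interior (path k)

  x-distinct : ∀ {k l} → k ≢ l → x k ≢ x l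
  x-distinct {k} {l} ne e = disjoint k l ne (x k) (x∈ k) (subst (λ v → Interior v (P l)) (sym e) (x∈ l))

  Linked : Fin m → Fin m → Set
  Linked k l = ∃ λ v → Interior v (P l) × v ≢ x l × x k ~ v

  linked? : Bin.Decidable Linked
  linked? k l with Finₚ.any? (λ i → (0 ℕₚ.<? toℕ i) ×-dec ((toℕ i ℕₚ.<? len (P l)) ×-dec ((¬? (vtx (P l) i Finₚ.≟ x l)) ×-dec (x k ~? vtx (P l) i))))
  ... | yes (i , p , q , ne , e) = yes (vtx (P l) i , (i , p , q , refl) , ne , e)
  ... | no none = no λ { (_ , (i , p , q , refl) , ne , e) → none (i , p , q , ne , e) }

  Stable : Fin m → Fin m → Set
  Stable k l = k ≢ l × ¬ x k ~ x l

  stable-sym : ∀ {k l} → Stable k l → Stable l k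
  stable-sym (p , q) = p ∘ sym , q ∘ ~-sym

  Selected : Set
  Selected = Σ (Fin ν → Fin m) λ f → Injective _≡_ _≡_ f ×
    Σ (Fin ν → Fin n) λ y →
    (∀ i → OnPath (y i) (P (f i)) × Adj G a (y i)) ×
    (∀ i j → i ≢ j → ¬ Adj G (y i) (y j)) ×
    (∀ i → ¬ Adj G (y i) b) ×
    (∀ i j → i <ᶠ j → ∃ λ v → Interior v (P (f j)) × v ≢ y j × Adj G (y i) v)

  select : ∀ (f : Fin ν → Fin m) → (∀ i j → i ≢ j → Stable (f i) (f j)) → (∀ i → ¬ x (f i) ~ b) →
           (∀ i j → i <ᶠ j → Linked (f i) (f j)) → Selected
  select f st nb lk = f , inj , x ∘ f ,
    (λ i → interior⇒on (x∈ (f i)) , second-adj (path (f i))) , (λ i j ne → proj₂ (st i j ne)) , nb , lk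
    where
    inj : Injective _≡_ _≡_ f
    inj {i} {j} e with i Finₚ.≟ j
    ... | yes p = p
    ... | no ne = ⊥-elim (proj₁ (st i j ne) e)

  module _ {zs : List (Fin m)} (stable : AllPairs Stable zs) (far : All (λ k → ¬ x k ~ b) zs) where

    forward : Chain Linked ν zs → Selected
    forward (ys , sub , refl , ap) = select (lookup ys)
      (lookup-AllPairs-sym stable-sym (AllPairs-resp-⊑ sub stable))
      (λ i → All.lookup (All-resp-⊆ sub far) (∈-lookup i)) (lookup-AllPairs ap)

    -- The links run from later to earlier entries, so the chain is read in reverse.
    backward : Chain (λ k l → Linked l k) ν zs → Selected
    backward (ys , sub , refl , ap) = select (lookup ys ∘ opposite)
      (λ i j ne → lookup-AllPairs-sym stable-sym (AllPairs-resp-⊑ sub stable) (opposite i) (opposite j) (ne ∘ opposite-injective))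
      (λ i → All.lookup (All-resp-⊆ sub far) (∈-lookup (opposite i)))
      λ i j lt → lookup-AllPairs ap (opposite j) (opposite i) (opposite-< lt)
      where
      opposite-injective : ∀ {k} {i j : Fin k} → opposite i ≡ opposite j → i ≡ j
      opposite-injective {i = i} {j} e = trans (sym (Finₚ.opposite-involutive i)) (trans (cong opposite e) (Finₚ.opposite-involutive j))
      opposite-< : ∀ {k} {i j : Fin k} → i <ᶠ j → opposite j <ᶠ opposite i
      opposite-< {k} {i} {j} lt = subst₂ _<_ (sym (Finₚ.opposite-prop j)) (sym (Finₚ.opposite-prop i)) (ℕₚ.∸-monoʳ-< (s≤s lt) (Finₚ.toℕ<n j))

    neither : ∀ {k} → ramsey t 6 ≤ k → AllPairs (λ k l → ¬ Linked k l) zs → AllPairs (λ k l → ¬ Linked l k) zs → length zs ≡ k → ⊥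
    neither le fw bw refl = Unlinked.contradiction G free noClique a≢b a≁b (P ∘ lookup zs) (path ∘ lookup zs)
      (λ i j ne → disjoint _ _ (proj₁ (st i j ne))) (λ i j ne → proj₂ (st i j ne))
      (λ i → All.lookup far (∈-lookup i))
      (λ i j ne v v∈ v≢ e → proj₁ (unlinked i j ne) (v , v∈ , v≢ , e)) le
      where
      st : ∀ i j → i ≢ j → Stable (lookup zs i) (lookup zs j)
      st = lookup-AllPairs-sym stable-sym stable
      unlinked : ∀ i j → i ≢ j → ¬ Linked (lookup zs i) (lookup zs j) × ¬ Linked (lookup zs j) (lookup zs i)
      unlinked = lookup-AllPairs-sym (λ { (p , q) → q , p }) (AllPairs.zip (fw , bw))

  near-b : ∀ {i j k} → Stable i j → Stable i k → Stable j k → x i ~ b → x j ~ b → x k ~ b → ⊥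
  near-b {i} {j} {k} (n₁₂ , m₁₂) (n₁₃ , m₁₃) (n₂₃ , m₂₃) e₁ e₂ e₃ =
    theta (proj₁ free) a≢b a≁b (a∉ i) (a∉ j) (a∉ k) (~-irrefl e₁ ∘ sym) (~-irrefl e₂ ∘ sym) (~-irrefl e₃ ∘ sym)
      (via i e₁) (via j e₂) (via k e₃) (sep n₁₂ m₁₂) (sep n₁₃ m₁₃) (sep n₂₃ m₂₃)
    where
    a∉ : ∀ i → ¬ Sing (x i) a
    a∉ i = ~-irrefl (second-adj (path i))
    via : ∀ i → x i ~ b → Thru (Sing (x i)) a b
    via i e = x i , nil ▸ (second-adj (path i) , refl) , e
    sep : ∀ {i j} → i ≢ j → ¬ x i ~ x j → Sep (Sing (x i)) (Sing (x j))
    sep ne na = only λ { refl refl → x-distinct ne , na }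

  selected : Ψ t ν ≤ m → Selected
  selected le = [ ⊥-elim ∘ no-adjacent-chain G noClique x , sparse ]′ (ramsey-theorem (λ k l → x k ~? x l) t _ (allFin m)
                  (ℕₚ.≤-trans (ℕₚ.≤-trans (ℕₚ.n≤1+n _) le) (ℕₚ.≤-reflexive (sym (length-tabulate id)))))
    where
    M : ℕ
    M = ramsey ν (ramsey ν (ramsey t 6))

    links : ∀ {zs} → AllPairs Stable zs → All (λ k → ¬ x k ~ b) zs → M ≤ length zs → Selected
    links {zs} st far le with ramsey-theorem linked? ν (ramsey ν (ramsey t 6)) zs le
    ... | inj₁ c = forward st far c
    ... | inj₂ (ys , sub , l , fw) with ramsey-theorem (λ k l → linked? l k) ν (ramsey t 6) ys (ℕₚ.≤-reflexive (sym l))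
    ...   | inj₁ c = backward (AllPairs-resp-⊑ sub st) (All-resp-⊆ sub far) c
    ...   | inj₂ (us , sub′ , l′ , bw) = ⊥-elim (neither (AllPairs-resp-⊑ (⊑-trans sub′ sub) st) (All-resp-⊆ (⊑-trans sub′ sub) far)
              ℕₚ.≤-refl (AllPairs-resp-⊑ sub′ fw) bw l′)

    sparse : Chain (λ k l → ¬ x k ~ x l) (3 + M) (allFin m) → Selected
    sparse (ys , sub , l , ap) with separate (λ k → x k ~? b) ys
    -- At most two of the `3 + M` stable indices are near `b`, which leaves `M` of them.
    ... | us , zs , p , q , near , far , e with pigeonhole₂ 3 {M} (ℕₚ.≤-reflexive (trans (sym l) (sym e)))
    ...   | inj₁ le with three le (AllPairs-resp-⊑ p (AllPairs.zip (AllPairs-resp-⊑ sub (allFin⁺ m) , ap))) near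
    ...     | i , j , k , s₁₂ , s₁₃ , s₂₃ , e₁ , e₂ , e₃ = ⊥-elim (near-b s₁₂ s₁₃ s₂₃ e₁ e₂ e₃)
    sparse (ys , sub , l , ap) | us , zs , p , q , near , far , e | inj₂ le =
      links (AllPairs-resp-⊑ q (AllPairs.zip (AllPairs-resp-⊑ sub (allFin⁺ m) , ap))) far le

theorem7p1 : (t ν : ℕ) → 1 ≤ t → 1 ≤ ν →
    Σ ℕ λ ψ → (1 ≤ ψ) ×
    ((n : ℕ) (G : Graph n) → ThetaPrismFree G → NoClique t G →
    (a b : Fin n) → a ≢ b → ¬ Adj G a b →
    (m : ℕ) (P : Fin m → Path n) →
    (∀ k → IsInducedPath G (P k) a b) →
    (∀ k l → k ≢ l → ∀ v → Interior v (P k) → ¬ Interior v (P l)) →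
    ψ ≤ m →
    Σ (Fin ν → Fin m) λ f → Injective _≡_ _≡_ f ×
    Σ (Fin ν → Fin n) λ x →
    (∀ i → OnPath (x i) (P (f i)) × Adj G a (x i)) ×
    (∀ i j → i ≢ j → ¬ Adj G (x i) (x j)) ×
    (∀ i → ¬ Adj G (x i) b) ×
    (∀ i j → i <ᶠ j →
    ∃ λ v → Interior v (P (f j)) × v ≢ x j × Adj G (x i) v))
-- The outermost `suc` of `Ψ` gives `1 ≤ ψ`.
theorem7p1 t ν _ _ = Ψ t ν , s≤s z≤n , λ n G free noClique a b a≢b a≁b m P path disjoint le →
  Selection.selected G free noClique a≢b a≁b P path disjoint le
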